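{- For all $n\ge0$, $$\sum_{a=0}^{n}k(3n-a;\,a,a)=T(n).$$ Moreover, for $0\le a\le n$, $$k(3n-a;\,a,a)=K(n)\cdot\frac{(a+1)!\,(2a+1)!\,n!\,(3n-a)!}{4^{a}(a!)^{3}(n-a)!\,(3n)!},$$ and the diagonal generating function $Q_d(x;t):=\sum_{m,a\ge0}k(m;a,a)\,x^{a}t^{m}$ is algebraic, given by $$Q_d(x;t)=\frac{1}{\sqrt{1-xU^{2}}}\left(\frac{U}{2t}+\frac{\sqrt{1-xU^{2}}-1+\tfrac12xU^{2}}{t\,x^{2}}\right),$$ where $U\equiv U(t)$ is the unique power series in $t$ with $U=t(2+U^{3})$.
   Context: For integers $m,i,j\ge0$, $k(m;i,j)$ denotes the number of reverse Kreweras walks of length $m$ from $(0,0)$ to $(i,j)$: lattice walks staying in the quarter plane $\{(x,y):x,y\ge0\}$ with steps $(1,0)$, $(0,1)$, $(-1,-1)$. Further $$K(n)=\frac{4^{n}(3n)!}{(n+1)!\,(2n+1)!},\qquad T(n)=\frac{7n+5}{5}\prod_{k=1}^{n}\frac{6(2k-1)(6k-1)(6k+1)}{(k+1)(4k+3)(4k+5)}.$$ Square roots denote the branch with constant term $1$, as formal power series. -}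

module Defs where

open import Algebra.Bundles using (RawRing)
import Algebra.Definitions.RawSemiring as RawSemiringDefs
open import Data.Fin using (Fin; toℕ)
open import Data.Integer as ℤ using (ℤ; +_; 0ℤ; 1ℤ; -1ℤ)
import Data.Integer.Properties as ℤₚ
open import Data.List using (List; []; _∷_; [_]; length; filter; foldl; cartesianProductWith)
open import Data.List.Relation.Unary.All using (All; all?)
open import Data.List.Scans.Base using (scanl)
open import Data.Nat as ℕ using (ℕ; zero; suc; _∸_; _!)
open import Data.Nat.Properties using (_!≢0; m*n≢0; m^n≢0)
open import Data.Product using (Σ-syntax; ∃-syntax; ∃!; _×_; _,_; proj₁)
open import Data.Product.Properties using (≡-dec)
open import Data.Rational as ℚ using (ℚ; _/_; 0ℚ; 1ℚ)
open import Data.Sum using (_⊎_)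
open import Function using (_∘_)
open import Level using (Level)
open import Relation.Binary.PropositionalEquality using (_≡_)
open import Relation.Nullary using (¬_; _×-dec_)
open import Relation.Unary using (Decidable)

private
  variable
    c ℓ a b d : Level

Point : Set
Point = ℤ × ℤ

data Step : Set where
  east north southwest : Step

move : Point → Step → Point
move (x , y) east      = x ℤ.+ 1ℤ , y
move (x , y) north     = x , y ℤ.+ 1ℤ
move (x , y) southwest = x ℤ.+ -1ℤ , y ℤ.+ -1ℤ

words : ℕ → List (List Step)
words zero    = [ [] ]
words (suc m) = cartesianProductWith _∷_ (east ∷ north ∷ southwest ∷ []) (words m)

origin : Point
origin = 0ℤ , 0ℤ

InQuadrant : Point → Set
InQuadrant (x , y) = 0ℤ ℤ.≤ x × 0ℤ ℤ.≤ y

-- scanl lists every vertex visited, including the starting and final ones.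
IsWalkTo : Point → List Step → Set
IsWalkTo p w = All InQuadrant (scanl move origin w) × foldl move origin w ≡ p

inQuadrant? : Decidable InQuadrant
inQuadrant? (x , y) = (0ℤ ℤ.≤? x) ×-dec (0ℤ ℤ.≤? y)

isWalkTo? : ∀ p → Decidable (IsWalkTo p)
isWalkTo? p w =
  all? inQuadrant? (scanl move origin w) ×-dec ≡-dec ℤ._≟_ ℤ._≟_ (foldl move origin w) p

k : ℕ → ℕ → ℕ → ℕ
k m i j = length (filter (isWalkTo? (+ i , + j)) (words m))

ℚ-rawRing : RawRing _ _
ℚ-rawRing = ℚ.+-*-rawRing

open RawSemiringDefs (RawRing.rawSemiring ℚ-rawRing) public
  using () renaming (sum to sumℚ; product to productℚ)

fromℕ : ℕ → ℚ
fromℕ n = + n / 1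

K : ℕ → ℚ
K n = + (4 ℕ.^ n ℕ.* (3 ℕ.* n) !) / ((n ℕ.+ 1) ! ℕ.* (2 ℕ.* n ℕ.+ 1) !)
  where instance
    _ = (n ℕ.+ 1) !≢0
    _ = (2 ℕ.* n ℕ.+ 1) !≢0
    _ = m*n≢0 ((n ℕ.+ 1) !) ((2 ℕ.* n ℕ.+ 1) !)

-- Used only with j ≥ 1, so that ∸ is ordinary subtraction.
T-factor : ℕ → ℚ
T-factor j =
  + (6 ℕ.* (2 ℕ.* j ∸ 1) ℕ.* (6 ℕ.* j ∸ 1) ℕ.* (6 ℕ.* j ℕ.+ 1))
    / ((1 ℕ.+ j) ℕ.* (3 ℕ.+ 4 ℕ.* j) ℕ.* (5 ℕ.+ 4 ℕ.* j))

T : ℕ → ℚ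
T n = (+ (7 ℕ.* n ℕ.+ 5) / 5) ℚ.* productℚ {n} (λ i → T-factor (suc (toℕ i)))

-- Used only with a ≤ n, so that ∸ is ordinary subtraction.
diagonalRatio : ℕ → ℕ → ℚ
diagonalRatio n a =
  + ((a ℕ.+ 1) ! ℕ.* (2 ℕ.* a ℕ.+ 1) ! ℕ.* n ! ℕ.* (3 ℕ.* n ∸ a) !)
    / (4 ℕ.^ a ℕ.* (a !) ℕ.^ 3 ℕ.* (n ∸ a) ! ℕ.* (3 ℕ.* n) !)
  where instance
    _ = a !≢0
    _ = (n ∸ a) !≢0
    _ = (3 ℕ.* n) !≢0
    _ = m^n≢0 4 a
    _ = m^n≢0 (a !) 3
    _ = m*n≢0 (4 ℕ.^ a) ((a !) ℕ.^ 3)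
    _ = m*n≢0 (4 ℕ.^ a ℕ.* (a !) ℕ.^ 3) ((n ∸ a) !)
    _ = m*n≢0 (4 ℕ.^ a ℕ.* (a !) ℕ.^ 3 ℕ.* (n ∸ a) !) ((3 ℕ.* n) !)

-- Formal power series in one variable X over R, as coefficient sequences.
module PowerSeries (R : RawRing c ℓ) where
  private module R = RawRing R

  Series : Set _
  Series = ℕ → R.Carrier

  constant : R.Carrier → Series
  constant r zero    = r
  constant r (suc _) = R.0#

  X : Series
  X 1 = R.1#
  X _ = R.0#

  open RawSemiringDefs R.rawSemiring using (sum)

  rawRing : RawRing _ _
  rawRing = record
    { Carrier = Series
    ; _≈_     = λ f g → ∀ n → f n R.≈ g n
    ; _+_     = λ f g n → f n R.+ g n
    ; _*_     = λ f g n → sum {suc n} (λ i → f (toℕ i) R.* g (n ∸ toℕ i))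
    ; -_      = λ f n → R.- f n
    ; 0#      = constant R.0#
    ; 1#      = constant R.1#
    }

module ℚ[[t]] where
  private module S = PowerSeries ℚ-rawRing
  open S public using (rawRing)
  open RawRing rawRing public using (Carrier; _≈_; _+_; _*_; -_; 0#; 1#)
  open RawSemiringDefs (RawRing.rawSemiring rawRing) public using (_^_)

  t : Carrier
  t = S.X

  two : Carrier
  two = 1# + 1#

-- ℚ[[x,t]] is taken as ℚ[[t]][[x]]: f i j is the coefficient of xⁱtʲ.
module ℚ[[x,t]] where
  private module S = PowerSeries ℚ[[t]].rawRing
  open S public using (rawRing)
  open RawRing rawRing public using (Carrier; _≈_; _+_; _*_; -_; 0#; 1#)
  open RawSemiringDefs (RawRing.rawSemiring rawRing) public using (_^_; sum)

  infixl 6 _-_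
  _-_ : Carrier → Carrier → Carrier
  f - g = f + (- g)

  embed : ℚ[[t]].Carrier → Carrier
  embed = S.constant

  x t two half : Carrier
  x    = S.X
  t    = embed ℚ[[t]].t
  two  = 1# + 1#
  half = embed (PowerSeries.constant ℚ-rawRing ℚ.½)

  IsSqrt : Carrier → Carrier → Set
  IsSqrt f s = s ^ 2 ≈ f × s 0 0 ≡ 1ℚ

  -- h = f / g in the field of fractions, with h a power series.
  IsQuotient : Carrier → Carrier → Carrier → Set
  IsQuotient f g h = g * h ≈ f

  IsPolynomial : Carrier → Set
  IsPolynomial f = ∃[ N ] (∀ i j → N ℕ.≤ i ⊎ N ℕ.≤ j → f i j ≡ 0ℚ)

  -- Algebraic over ℚ(x,t), with denominators cleared in the coefficients p.
  Algebraic : Carrier → Set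
  Algebraic f =
    ∃[ N ] Σ[ p ∈ (Fin N → Carrier) ]
      (∀ i → IsPolynomial (p i)) ×
      (∃[ i ] ¬ (p i ≈ 0#)) ×
      sum (λ i → p i * f ^ toℕ i) ≈ 0#

Qd : ℚ[[x,t]].Carrier
Qd a m = fromℕ (k m a a)

-- Definite description: exactly one element (up to ≈) satisfies P, and it
-- satisfies Φ.
The : {A : Set a} → (A → A → Set ℓ) → (A → Set b) → (A → Set d) → Set _
The _≈_ P Φ = Σ[ u ∈ ∃! _≈_ P ] Φ (proj₁ u)

{-# OPTIONS --safe #-}
module Submission where

-- The three assertions rest on an explicit description of the generating functions
-- of the walks. Put V = U/2, so that V = t (1 + 4 V³), and W = 1 + 4 V³ = V/t. Let
-- R(x) count the walks ending at (i,0), marked by xⁱ, let Q(x,y) count all walks and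
-- let D(u) count the walks ending at (a,a), marked by uᵃ.
--
-- The axis. With σ = 1 + x (V σ + V⁴ σ²), define R = W Θ for an explicit polynomial Θ
-- in x, V and σ. This R satisfies the quadratic equation
--   (1 + t x R) (1 - t x - t² R′) = 1 - t² R′(0),   R′ = (R - R(0)) / x
-- (quadratic). Writing Δf = (f(x) - f(y)) / (x - y), let Q be the solution of
-- Q = Δ(x R) + t x y Q Δ(R). The quadratic equations at x and at y imply that Q
-- satisfies the functional equation of the walks
--   x y Q = x y + t (x² y + x y² + 1) Q - t (R(x) + R(y) - R(0))
-- (functional). Its coefficients of positive degree in x and in y are the recurrence
-- by the last step, so Q counts the walks (Q-coefficient), and R = Q(x,0) counts those
-- ending on the axis (R-coefficient).
--
-- The diagonal. Separating the walks that end on and below the diagonal gives an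
-- equation with kernel κ = u x - t (x² u + u² + x) that involves D, R and the series
-- of walks below the diagonal (wedge-equation). Eliminating R by its quadratic
-- equation leaves κ N = x² f with f free of x (eliminate), which forces f = 0
-- (kernel-method). Now f = 0 is a quadratic equation for D, and in terms of V it
-- simplifies to
--   (1 - 4 V² u) (t u² D - 1)² = (1 - 2 V² u - V u²)²
-- (D-square). Taking the root with the right constant term yields
--   t u² D = 1 - (1 - 2 V² u - V u²) / √(1 - 4 V² u)
-- (diagonal), which is the asserted formula since 4 V² = U² and W = U / (2 t).
--
-- Coefficients. Expanding the inverse square root in central binomial coefficients
-- and the powers of V by Lagrange inversion (V^-coefficient) gives the closed form for
-- the numbers of walks (D-closed, walks-ratio). Their sum over a satisfies a recurrence
-- of order one in n, found by creative telescoping (sum-recurrence), which T satisfies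
-- as well (T-recurrence).
--
-- Algebraicity. The coefficients of the quadratic equation of D are of the form
-- C₀ + C₁ V + C₂ V² with polynomials Cᵢ in u and t. Since V is cubic over the rational
-- functions in t, taking norms gives a polynomial equation of degree six for D
-- (algebraic-equation).

open import Algebra.Bundles using (CommutativeRing; RawRing)
import Algebra.Definitions.RawSemiring as RawSemiringDefs
open import Algebra.Morphism.Structures using (IsRingHomomorphism)
import Algebra.Properties.Group as GroupProperties
import Algebra.Properties.Ring as RingProperties
import Algebra.Properties.Semiring.Exp as SemiringExp
import Algebra.Properties.Semiring.Mult as SemiringMultiple
import Algebra.Properties.Semiring.Mult.TCOptimised as SemiringMult
import Algebra.Solver.Ring as RingSolver
import Algebra.Solver.Ring.AlmostCommutativeRing as ACR
open import Algebra.Structures using (IsCommutativeRing)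
open import Data.Fin using (Fin; zero; suc; toℕ)
open import Data.Integer as ℤ using (ℤ; +_; -[1+_]; -1ℤ; 0ℤ; 1ℤ)
import Data.Integer.Properties as ℤₚ
open import Data.List using (List; []; _∷_; length; filter; foldl; map; _++_)
import Data.List.Properties as Listₚ
open import Data.List.Relation.Unary.All as Allₚ using (All; []; _∷_; all?)
open import Data.List.Scans.Base using (scanl)
open import Data.List.Scans.Properties using (scanl-defn)
open import Data.Maybe.Base using (Maybe; just; nothing)
open import Data.Nat as ℕ using (ℕ; zero; suc; _∸_; _!; _⊔_; z≤n; s≤s)
import Data.Nat.Properties as ℕₚ
open import Data.Nat.Solver using (module +-*-Solver)
open import Data.Product using (_×_; _,_; proj₁; proj₂)
open import Data.Product.Properties using (≡-dec)
open import Data.Rational as ℚ using (ℚ; _/_; 0ℚ; 1ℚ; toℚᵘ)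
import Data.Rational.Properties as ℚₚ
open import Data.Rational.Unnormalised as ℚᵘ using (mkℚᵘ; *≡*)
import Data.Rational.Unnormalised.Properties as ℚᵘₚ
open import Data.Sum using (_⊎_; inj₁; inj₂)
open import Data.Vec as Vec using (Vec; []; _∷_)
import Data.Vec.Properties as Vecₚ
open import Function using (_⟨_⟩_)
open import Function.Bundles using (_⇔_; mk⇔; Equivalence)
open import Level using (Level) renaming (_⊔_ to _⊔ℓ_)
import Relation.Binary.Reasoning.Setoid as SetoidReasoning
open import Relation.Binary.PropositionalEquality as ≡ using (_≡_; _≢_)
open import Relation.Nullary using (¬_; Dec; yes; no; _×-dec_; contradiction)
open import Relation.Unary using (Pred; Decidable)
open import Defs

-- Polynomial identities in commutative rings

-- The normalising solver for polynomial identities with integer coefficients,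
-- valid in every commutative ring.
module IntegerCoefficients {c ℓ : Level} (R : CommutativeRing c ℓ) where
  open CommutativeRing R
  open RingProperties ring
    using (-‿distribˡ-*; -‿distribʳ-*; -0#≈0#; -‿involutive; -‿+-comm)
  open SemiringMult semiring using (×-homo-+; ×1-homo-*; 1+×) renaming (_×_ to infixl 8 _⋆_)
  open SetoidReasoning setoid

  -- The ring homomorphism from the integers.
  fromℤ : ℤ → Carrier
  fromℤ (+ n)    = n ⋆ 1#
  fromℤ -[1+ n ] = - (suc n ⋆ 1#)

  private
    ⊖-homo : ∀ m n → fromℤ (m ℤ.⊖ n) ≈ m ⋆ 1# - n ⋆ 1#
    ⊖-homo zero zero = sym (trans (+-congˡ -0#≈0#) (+-identityʳ 0#))
    ⊖-homo zero (suc n) = sym (+-identityˡ _)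
    ⊖-homo (suc m) zero = sym (trans (+-congˡ -0#≈0#) (+-identityʳ _))
    ⊖-homo (suc m) (suc n) = begin
      fromℤ (suc m ℤ.⊖ suc n)             ≡⟨ ≡.cong fromℤ (ℤₚ.[1+m]⊖[1+n]≡m⊖n m n) ⟩
      fromℤ (m ℤ.⊖ n)                     ≈⟨ ⊖-homo m n ⟩
      m ⋆ 1# - n ⋆ 1#                     ≈⟨ +-congʳ (+-identityʳ _) ⟨
      m ⋆ 1# + 0# - n ⋆ 1#                ≈⟨ +-congʳ (+-congˡ (-‿inverseʳ 1#)) ⟨
      m ⋆ 1# + (1# - 1#) - n ⋆ 1#         ≈⟨ +-congʳ (+-assoc _ _ _) ⟨
      m ⋆ 1# + 1# - 1# - n ⋆ 1#           ≈⟨ +-assoc _ _ _ ⟩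
      m ⋆ 1# + 1# + (- 1# - n ⋆ 1#)       ≈⟨ +-cong (+-comm _ _) (-‿+-comm _ _) ⟩
      1# + m ⋆ 1# - (1# + n ⋆ 1#)         ≈⟨ +-cong (1+× m 1#) (-‿cong (1+× n 1#)) ⟨
      suc m ⋆ 1# - suc n ⋆ 1#             ∎

    +-homo : ∀ i j → fromℤ (i ℤ.+ j) ≈ fromℤ i + fromℤ j
    +-homo (+ m)    (+ n)    = ×-homo-+ 1# m n
    +-homo (+ m)    -[1+ n ] = ⊖-homo m (suc n)
    +-homo -[1+ m ] (+ n)    = trans (⊖-homo n (suc m)) (+-comm _ _)
    +-homo -[1+ m ] -[1+ n ] = begin
      - (suc (suc (m ℕ.+ n)) ⋆ 1#)     ≡⟨ ≡.cong (λ k → - (suc k ⋆ 1#)) (≡.sym (ℕₚ.+-suc m n)) ⟩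
      - ((suc m ℕ.+ suc n) ⋆ 1#)       ≈⟨ -‿cong (×-homo-+ 1# (suc m) (suc n)) ⟩
      - (suc m ⋆ 1# + suc n ⋆ 1#)      ≈⟨ -‿+-comm _ _ ⟨
      - (suc m ⋆ 1#) - suc n ⋆ 1#      ∎

    -‿homo : ∀ i → fromℤ (ℤ.- i) ≈ - fromℤ i
    -‿homo (+ zero)  = sym -0#≈0#
    -‿homo (+ suc n) = refl
    -‿homo -[1+ n ]  = sym (-‿involutive _)

    pos-*-homo : ∀ m j → fromℤ (+ m ℤ.* j) ≈ m ⋆ 1# * fromℤ j
    pos-*-homo m (+ n) = begin
      fromℤ (+ m ℤ.* + n)   ≡⟨ ≡.cong fromℤ (≡.sym (ℤₚ.pos-* m n)) ⟩
      (m ℕ.* n) ⋆ 1#        ≈⟨ ×1-homo-* m n ⟩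
      m ⋆ 1# * n ⋆ 1#       ∎
    pos-*-homo m -[1+ n ] = begin
      fromℤ (+ m ℤ.* -[1+ n ])       ≡⟨ ≡.cong fromℤ (≡.sym (ℤₚ.neg-distribʳ-* (+ m) (+ suc n))) ⟩
      fromℤ (ℤ.- (+ m ℤ.* + suc n))  ≈⟨ -‿homo (+ m ℤ.* + suc n) ⟩
      - fromℤ (+ m ℤ.* + suc n)      ≈⟨ -‿cong (pos-*-homo m (+ suc n)) ⟩
      - (m ⋆ 1# * suc n ⋆ 1#)        ≈⟨ -‿distribʳ-* _ _ ⟩
      m ⋆ 1# * - (suc n ⋆ 1#)        ∎

    *-homo : ∀ i j → fromℤ (i ℤ.* j) ≈ fromℤ i * fromℤ j
    *-homo (+ m) j    = pos-*-homo m j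
    *-homo -[1+ m ] j = begin
      fromℤ (-[1+ m ] ℤ.* j)        ≡⟨ ≡.cong fromℤ (≡.sym (ℤₚ.neg-distribˡ-* (+ suc m) j)) ⟩
      fromℤ (ℤ.- (+ suc m ℤ.* j))   ≈⟨ -‿homo (+ suc m ℤ.* j) ⟩
      - fromℤ (+ suc m ℤ.* j)       ≈⟨ -‿cong (pos-*-homo (suc m) j) ⟩
      - (suc m ⋆ 1# * fromℤ j)      ≈⟨ -‿distribˡ-* _ _ ⟩
      - (suc m ⋆ 1#) * fromℤ j      ∎

    morphism : ℤ.+-*-rawRing ACR.-Raw-AlmostCommutative⟶ ACR.fromCommutativeRing R
    morphism = record
      { ⟦_⟧    = fromℤ
      ; +-homo = +-homo
      ; *-homo = *-homo
      ; -‿homo = -‿homo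
      ; 0-homo = refl
      ; 1-homo = refl
      }

    weaklyDecide : ∀ i j → Maybe (fromℤ i ≈ fromℤ j)
    weaklyDecide i j with i ℤ.≟ j
    ... | yes ≡.refl = just refl
    ... | no _       = nothing

  open RingSolver ℤ.+-*-rawRing (ACR.fromCommutativeRing R) morphism weaklyDecide public
    using (solve; _:=_; _:+_; _:*_; _:-_; :-_; _:^_; con; var; op; [+]; [*]; Polynomial; ⟦_⟧)

  -- Integer constants inside solver expressions.
  :1 : ∀ {n} → Polynomial n
  :1 = con (+ 1)
  :# : ∀ {n} → ℕ → Polynomial n
  :# k = con (+ k)

-- Ring homomorphisms commute with the evaluation of integer polynomials.
module Naturality {c ℓ c′ ℓ′ : Level} (R : CommutativeRing c ℓ) (S : CommutativeRing c′ ℓ′)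
  {φ : CommutativeRing.Carrier R → CommutativeRing.Carrier S}
  (φ-hom : IsRingHomomorphism (CommutativeRing.rawRing R) (CommutativeRing.rawRing S) φ) where
  private
    module R = CommutativeRing R
    module S = CommutativeRing S
    module P = IntegerCoefficients R
    module Q = IntegerCoefficients S
  open IsRingHomomorphism φ-hom
  open SemiringMult R.semiring using () renaming (_×_ to _×R_; 1+× to 1+×R)
  open SemiringMult S.semiring using () renaming (_×_ to _×S_; 1+× to 1+×S)
  open RawSemiringDefs (RawRing.rawSemiring R.rawRing) using () renaming (_^_ to _^R_)
  open RawSemiringDefs (RawRing.rawSemiring S.rawRing) using () renaming (_^_ to _^S_)
  open SemiringExp S.semiring using (^-congˡ)

  -- The same expression, read over the other ring.
  translate : ∀ {n} → P.Polynomial n → Q.Polynomial n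
  translate (P.op P.[+] p q) = Q.op Q.[+] (translate p) (translate q)
  translate (P.op P.[*] p q) = Q.op Q.[*] (translate p) (translate q)
  translate (P.con i)        = Q.con i
  translate (P.var i)        = Q.var i
  translate (p P.:^ n)       = translate p Q.:^ n
  translate (P.:- p)         = Q.:- translate p

  private
    ×1-natural : ∀ n → φ (n ×R R.1#) S.≈ n ×S S.1#
    ×1-natural zero    = 0#-homo
    ×1-natural (suc n) = S.trans (⟦⟧-cong (1+×R n R.1#)) (S.trans (+-homo _ _)
      (S.trans (S.+-cong 1#-homo (×1-natural n)) (S.sym (1+×S n S.1#))))

    fromℤ-natural : ∀ i → φ (P.fromℤ i) S.≈ Q.fromℤ i
    fromℤ-natural (+ n)    = ×1-natural n
    fromℤ-natural -[1+ n ] = S.trans (-‿homo _) (S.-‿cong (×1-natural (suc n)))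

    ^-natural : ∀ x n → φ (x ^R n) S.≈ φ x ^S n
    ^-natural x zero    = 1#-homo
    ^-natural x (suc n) = S.trans (*-homo _ _) (S.*-congˡ (^-natural x n))

  natural : ∀ {n} (p : P.Polynomial n) ρ → φ (P.⟦ p ⟧ ρ) S.≈ Q.⟦ translate p ⟧ (Vec.map φ ρ)
  natural (P.op P.[+] p q) ρ = S.trans (+-homo _ _) (S.+-cong (natural p ρ) (natural q ρ))
  natural (P.op P.[*] p q) ρ = S.trans (*-homo _ _) (S.*-cong (natural p ρ) (natural q ρ))
  natural (P.con i)        ρ = fromℤ-natural i
  natural (P.var i)        ρ = S.reflexive (≡.sym (Vecₚ.lookup-map i φ ρ))
  natural (p P.:^ n)       ρ = S.trans (^-natural _ n) (^-congˡ n (natural p ρ))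
  natural (P.:- p)         ρ = S.trans (-‿homo _) (S.-‿cong (natural p ρ))

-- Formal power series over a commutative ring

-- r is not a zero divisor.
Regular : {c ℓ : Level} (R : CommutativeRing c ℓ) → CommutativeRing.Carrier R → Set (c ⊔ℓ ℓ)
Regular R r = ∀ s → r * s ≈ 0# → s ≈ 0#
  where open CommutativeRing R

-- The ring of power series in one variable X, multiplied by the Cauchy product.
-- Several variables are obtained by iterating the construction.
module SeriesRing {c ℓ : Level} (R : CommutativeRing c ℓ) where
  private
    module R = CommutativeRing R
    module S = PowerSeries R.rawRing
    open IntegerCoefficients R
  open S public using (Series; constant; X)
  open SetoidReasoning R.setoid

  infix  4 _≈_
  infixl 7 _*_ _·_
  infixl 6 _+_

  -- (f - f(0)) / X.
  tail : Series → Series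
  tail f n = f (suc n)

  -- Multiplication by a scalar.
  _·_ : R.Carrier → Series → Series
  (r · f) n = r R.* f n

  -- The operations are opaque so that they are not unfolded when rings of
  -- series are nested; the lemmas below describe them coefficientwise.
  opaque
    _≈_ : Series → Series → Set ℓ
    f ≈ g = ∀ n → f n R.≈ g n

    _+_ _*_ : Series → Series → Series
    _+_ = RawRing._+_ S.rawRing
    _*_ = RawRing._*_ S.rawRing

    -_ : Series → Series
    -_ = RawRing.-_ S.rawRing

    ext : ∀ {f g} → (∀ n → f n R.≈ g n) → f ≈ g
    ext p = p

    at : ∀ {f g} → f ≈ g → ∀ n → f n R.≈ g n
    at p = p

    +-at : ∀ f g n → (f + g) n R.≈ f n R.+ g n
    +-at f g n = R.refl

    -‿at : ∀ f n → (- f) n R.≈ R.- f n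
    -‿at f n = R.refl

    *-zero : ∀ f g → (f * g) 0 R.≈ f 0 R.* g 0
    *-zero f g = R.+-identityʳ _

    -- By this recursion, which the definition of the product unfolds to,
    -- the ring laws follow by induction on the index.
    *-suc : ∀ f g n → (f * g) (suc n) R.≈ f 0 R.* g (suc n) R.+ (tail f * g) n
    *-suc f g n = R.refl

    *-cong : ∀ {f f′ g g′} → f ≈ f′ → g ≈ g′ → f * g ≈ f′ * g′
    *-cong p q zero    = R.+-congʳ (R.*-cong (p 0) (q 0))
    *-cong p q (suc n) = R.+-cong (R.*-cong (p 0) (q (suc n)))
                                  (*-cong (λ m → p (suc m)) q n)

    distribʳ : ∀ h f g → (f + g) * h ≈ f * h + g * h
    distribʳ h f g zero = solve 3 (λ a b d →
      (a :+ b) :* d :+ :# 0 := (a :* d :+ :# 0) :+ (b :* d :+ :# 0)) R.refl _ _ _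
    distribʳ h f g (suc n) = R.trans (R.+-congˡ (distribʳ h (tail f) (tail g) n))
      (solve 5 (λ a b d p q → (a :+ b) :* d :+ (p :+ q) := (a :* d :+ p) :+ (b :* d :+ q))
        R.refl _ _ _ _ _)

    ·-*-assoc : ∀ r f g → (r · f) * g ≈ r · (f * g)
    ·-*-assoc r f g zero = solve 3 (λ r a b →
      r :* a :* b :+ :# 0 := r :* (a :* b :+ :# 0)) R.refl _ _ _
    ·-*-assoc r f g (suc n) = R.trans (R.+-congˡ (·-*-assoc r (tail f) g n))
      (solve 4 (λ r a b p → r :* a :* b :+ r :* p := r :* (a :* b :+ p)) R.refl _ _ _ _)

    -- The recursion with the roles of the two factors exchanged.
    *-sucʳ : ∀ f g n → (f * g) (suc n) R.≈ f (suc n) R.* g 0 R.+ (f * tail g) n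
    *-sucʳ f g zero = solve 4 (λ a b a′ b′ →
      a :* b′ :+ (a′ :* b :+ :# 0) := a′ :* b :+ (a :* b′ :+ :# 0)) R.refl _ _ _ _
    *-sucʳ f g (suc n) = R.trans (R.+-congˡ (*-sucʳ (tail f) g n))
      (solve 3 (λ a b p → a :+ (b :+ p) := b :+ (a :+ p)) R.refl _ _ _)

    *-comm : ∀ f g → f * g ≈ g * f
    *-comm f g zero    = R.+-congʳ (R.*-comm _ _)
    *-comm f g (suc n) = R.trans (*-sucʳ f g n)
      (R.+-cong (R.*-comm _ _) (*-comm f (tail g) n))

    *-assoc : ∀ f g h → (f * g) * h ≈ f * (g * h)
    *-assoc f g h zero = solve 3 (λ a b d →
      (a :* b :+ :# 0) :* d :+ :# 0 := a :* (b :* d :+ :# 0) :+ :# 0) R.refl _ _ _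
    *-assoc f g h (suc n) = begin
      (f 0 R.* g 0 R.+ R.0#) R.* h (suc n) R.+ (((f 0 · tail g) + (tail f * g)) * h) n
        ≈⟨ R.+-congˡ (distribʳ h (f 0 · tail g) (tail f * g) n) ⟩
      _ R.+ (((f 0 · tail g) * h) n R.+ ((tail f * g) * h) n)
        ≈⟨ R.+-congˡ (R.+-cong (·-*-assoc (f 0) (tail g) h n) (*-assoc (tail f) g h n)) ⟩
      _ R.+ (f 0 R.* (tail g * h) n R.+ (tail f * (g * h)) n)
        ≈⟨ solve 5 (λ a b d p q →
             (a :* b :+ :# 0) :* d :+ (a :* p :+ q) := a :* (b :* d :+ p) :+ q)
             R.refl _ _ _ _ _ ⟩
      f 0 R.* (g 0 R.* h (suc n) R.+ (tail g * h) n) R.+ (tail f * (g * h)) n ∎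

    *-zeroˡ : ∀ f g → (∀ n → f n R.≈ R.0#) → ∀ n → (f * g) n R.≈ R.0#
    *-zeroˡ f g f≈0 zero = R.trans (R.+-identityʳ _) (R.trans (R.*-congʳ (f≈0 0)) (R.zeroˡ _))
    *-zeroˡ f g f≈0 (suc n) = R.trans
      (R.+-cong (R.trans (R.*-congʳ (f≈0 0)) (R.zeroˡ _)) (*-zeroˡ (tail f) g (λ m → f≈0 (suc m)) n))
      (R.+-identityʳ _)

    constant-* : ∀ r f → constant r * f ≈ r · f
    constant-* r f zero    = R.+-identityʳ _
    constant-* r f (suc n) = R.trans
      (R.+-congˡ (*-zeroˡ (tail (constant r)) f (λ _ → R.refl) n)) (R.+-identityʳ _)

    *-identityˡ : ∀ f → constant R.1# * f ≈ f
    *-identityˡ f n = R.trans (constant-* R.1# f n) (R.*-identityˡ _)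

    isCommutativeRing : IsCommutativeRing _≈_ _+_ _*_ -_ (constant R.0#) (constant R.1#)
    isCommutativeRing = record
      { isRing = record
        { +-isAbelianGroup = record
          { isGroup = record
            { isMonoid = record
              { isSemigroup = record
                { isMagma = record
                  { isEquivalence = record
                    { refl  = λ _ → R.refl
                    ; sym   = λ p n → R.sym (p n)
                    ; trans = λ p q n → R.trans (p n) (q n)
                    }
                  ; ∙-cong = λ p q n → R.+-cong (p n) (q n)
                  }
                ; assoc = λ f g h n → R.+-assoc _ _ _
                }
              ; identity = +-identityˡ , λ f n → R.trans (R.+-comm _ _) (+-identityˡ f n)
              }
            ; inverse = -‿inverseˡ , λ f n → R.trans (R.+-comm _ _) (-‿inverseˡ f n)
            ; ⁻¹-cong = λ p n → R.-‿cong (p n)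
            }
          ; comm = λ f g n → R.+-comm _ _
          }
        ; *-cong     = *-cong
        ; *-assoc    = *-assoc
        ; *-identity = *-identityˡ , λ f n → R.trans (*-comm f (constant R.1#) n) (*-identityˡ f n)
        ; distrib    = (λ f g h n → R.trans (*-comm f (g + h) n)
                         (R.trans (distribʳ f g h n) (R.+-cong (*-comm g f n) (*-comm h f n))))
                     , distribʳ
        }
      ; *-comm = *-comm
      }
      where
      constant-0 : ∀ n → constant R.0# n R.≈ R.0#
      constant-0 zero    = R.refl
      constant-0 (suc _) = R.refl
      +-identityˡ : ∀ f → constant R.0# + f ≈ f
      +-identityˡ f n = R.trans (R.+-congʳ (constant-0 n)) (R.+-identityˡ _)
      -‿inverseˡ : ∀ f → (- f) + f ≈ constant R.0#
      -‿inverseˡ f n = R.trans (R.-‿inverseˡ (f n)) (R.sym (constant-0 n))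

  ring : CommutativeRing c ℓ
  ring = record { isCommutativeRing = isCommutativeRing }

  open CommutativeRing ring public
    using (0#; 1#; _-_; setoid; refl; sym; trans; +-cong; -‿cong)
    renaming (rawRing to ringRawRing)

  constant-·-at : ∀ r f n → (constant r * f) n R.≈ r R.* f n
  constant-·-at r f = at (constant-* r f)

  constant-cong : ∀ {r s} → r R.≈ s → constant r ≈ constant s
  constant-cong p = ext λ { zero → p ; (suc _) → R.refl }

  constant-isRingHomomorphism : IsRingHomomorphism R.rawRing ringRawRing constant
  constant-isRingHomomorphism = record
    { isSemiringHomomorphism = record
      { isNearSemiringHomomorphism = record
        { +-isMonoidHomomorphism = record
          { isMagmaHomomorphism = record
            { isRelHomomorphism = record { cong = constant-cong }
            ; homo = λ r s → ext λ
              { zero    → R.sym (+-at _ _ zero)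
              ; (suc n) → R.sym (R.trans (+-at _ _ (suc n)) (R.+-identityʳ _)) }
            }
          ; ε-homo = refl
          }
        ; *-homo = λ r s → ext λ
          { zero    → R.sym (constant-·-at r (constant s) zero)
          ; (suc n) → R.sym (R.trans (constant-·-at r (constant s) (suc n)) (R.zeroʳ r)) }
        }
      ; 1#-homo = refl
      }
    ; -‿homo = λ r → ext λ
      { zero    → R.sym (-‿at _ zero)
      ; (suc n) → R.sym (R.trans (-‿at _ (suc n)) -0#≈0#) }
    }
    where open RingProperties R.ring using (-0#≈0#)

  X*-zero : ∀ f → (X * f) 0 R.≈ R.0#
  X*-zero f = R.trans (*-zero X f) (R.zeroˡ _)

  X*-suc : ∀ f n → (X * f) (suc n) R.≈ f n
  X*-suc f n = R.trans (*-suc X f n) (R.trans (R.+-cong (R.zeroˡ _) (tail-X n)) (R.+-identityˡ _))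
    where
    tail-X : ∀ n → (tail X * f) n R.≈ f n
    tail-X n = R.trans (at (*-cong {g = f} (ext λ { zero → R.refl ; (suc _) → R.refl }) refl) n)
      (at (*-identityˡ f) n)

  constant+X*tail : ∀ f → f ≈ constant (f 0) + X * tail f
  constant+X*tail f = ext λ
    { zero    → R.sym (R.trans (+-at _ _ 0) (R.trans (R.+-congˡ (X*-zero _)) (R.+-identityʳ _)))
    ; (suc n) → R.sym (R.trans (+-at _ _ (suc n)) (R.trans (R.+-congˡ (X*-suc _ n)) (R.+-identityˡ _))) }

  zero-at : ∀ {f} → f ≈ 0# → ∀ n → f n R.≈ R.0#
  zero-at p zero    = at p zero
  zero-at p (suc n) = at p (suc n)

  zero-ext : ∀ {f} → (∀ n → f n R.≈ R.0#) → f ≈ 0#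
  zero-ext p = ext λ { zero → p zero ; (suc n) → p (suc n) }

  -- f is not a zero divisor when its constant coefficient is not one.
  regular : ∀ f → Regular R (f 0) → Regular ring f
  regular f f₀-regular g fg≈0 = zero-ext λ n → go n g fg≈0
    where
    go : ∀ n g → f * g ≈ 0# → g n R.≈ R.0#
    go zero g p = f₀-regular (g 0) (R.trans (R.sym (*-zero f g)) (at p 0))
    go (suc n) g p = go n (tail g) (zero-ext λ m → begin
      (f * tail g) m                              ≈⟨ R.+-identityˡ _ ⟨
      R.0# R.+ (f * tail g) m                     ≈⟨ R.+-congʳ (R.zeroʳ _) ⟨
      f (suc m) R.* R.0# R.+ (f * tail g) m       ≈⟨ R.+-congʳ (R.*-congˡ (go zero g p)) ⟨
      f (suc m) R.* g 0 R.+ (f * tail g) m        ≈⟨ *-sucʳ f g m ⟨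
      (f * g) (suc m)                             ≈⟨ zero-at p (suc m) ⟩
      R.0#                                        ∎)

  X-regular : Regular ring X
  X-regular g p = zero-ext λ n → R.trans (R.sym (X*-suc g n)) (zero-at p (suc n))

  -- f and g agree below degree n.
  _≈[_]_ : Series → ℕ → Series → Set ℓ
  f ≈[ n ] g = ∀ k → k ℕ.< n → f k R.≈ g k

  -- Ψ f is determined up to degree n by f up to degree n.
  NonExpansive : (Series → Series) → Set (c ⊔ℓ ℓ)
  NonExpansive Ψ = ∀ {n f g} → f ≈[ n ] g → Ψ f ≈[ n ] Ψ g

  id-nonExpansive : NonExpansive (λ f → f)
  id-nonExpansive p = p

  const-nonExpansive : ∀ a → NonExpansive (λ _ → a)
  const-nonExpansive a p k _ = R.refl

  +-nonExpansive : ∀ {Φ Ψ} → NonExpansive Φ → NonExpansive Ψ → NonExpansive (λ f → Φ f + Ψ f)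
  +-nonExpansive φ ψ p k k<n =
    R.trans (+-at _ _ k) (R.trans (R.+-cong (φ p k k<n) (ψ p k k<n)) (R.sym (+-at _ _ k)))

  *-nonExpansive : ∀ {Φ Ψ} → NonExpansive Φ → NonExpansive Ψ → NonExpansive (λ f → Φ f * Ψ f)
  *-nonExpansive {Φ} {Ψ} φ ψ {n} {f} {g} p k k<n =
    go k (Φ f) (Φ g) (Ψ f) (Ψ g) (λ j j≤k → φ p j (ℕₚ.≤-<-trans j≤k k<n))
      (λ j j≤k → ψ p j (ℕₚ.≤-<-trans j≤k k<n))
    where
    go : ∀ k f f′ g g′ → (∀ j → j ℕ.≤ k → f j R.≈ f′ j) → (∀ j → j ℕ.≤ k → g j R.≈ g′ j) →
         (f * g) k R.≈ (f′ * g′) k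
    go zero f f′ g g′ p q =
      R.trans (*-zero f g) (R.trans (R.*-cong (p 0 z≤n) (q 0 z≤n)) (R.sym (*-zero f′ g′)))
    go (suc k) f f′ g g′ p q = R.trans (*-suc f g k) (R.trans
      (R.+-cong (R.*-cong (p 0 z≤n) (q (suc k) ℕₚ.≤-refl))
        (go k (tail f) (tail f′) g g′ (λ j j≤k → p (suc j) (s≤s j≤k))
          (λ j j≤k → q j (ℕₚ.m≤n⇒m≤1+n j≤k))))
      (R.sym (*-suc f′ g′ k)))

  -- The unique solution of f = a + X Ψ(f). The n-th coefficient of the iterates
  -- of f ↦ a + X Ψ(f) does not change after step n + 1.
  module Fixpoint (a : Series) (Ψ : Series → Series) (ψ : NonExpansive Ψ) where
    private
      Φ : Series → Series
      Φ f = a + X * Ψ f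

      contract : ∀ {n f g} → f ≈[ n ] g → Φ f ≈[ suc n ] Φ g
      contract p zero    _         = R.trans (+-at _ _ 0) (R.trans
        (R.+-congˡ (R.trans (X*-zero _) (R.sym (X*-zero _)))) (R.sym (+-at _ _ 0)))
      contract p (suc k) (s≤s k<n) = R.trans (+-at _ _ (suc k)) (R.trans
        (R.+-congˡ (R.trans (X*-suc _ k) (R.trans (ψ p k k<n) (R.sym (X*-suc _ k)))))
        (R.sym (+-at _ _ (suc k))))

      iterate : ℕ → Series
      iterate zero    = 0#
      iterate (suc n) = Φ (iterate n)

      iterate-≈ : ∀ {m n} → m ℕ.≤ n → iterate m ≈[ m ] iterate n
      iterate-≈ z≤n       k ()
      iterate-≈ (s≤s m≤n) = contract (iterate-≈ m≤n)

    fixpoint : Series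
    fixpoint n = iterate (suc n) n

    isFixpoint : fixpoint ≈ a + X * Ψ fixpoint
    isFixpoint = ext λ n → contract
      (λ k k<n → R.sym (iterate-≈ k<n k ℕₚ.≤-refl)) n ℕₚ.≤-refl

    unique : ∀ {f g} → f ≈ a + X * Ψ f → g ≈ a + X * Ψ g → f ≈ g
    unique {f} {g} p q = ext λ n → go (suc n) n ℕₚ.≤-refl
      where
      go : ∀ n → f ≈[ n ] g
      go zero    k ()
      go (suc n) k k<n = R.trans (at p k) (R.trans (contract (go n) k k<n) (R.sym (at q k)))

-- The homomorphism of power series rings that applies φ to every coefficient.
module Map {c ℓ c′ ℓ′ : Level} (R : CommutativeRing c ℓ) (S : CommutativeRing c′ ℓ′)
           {φ : CommutativeRing.Carrier R → CommutativeRing.Carrier S}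
           (φ-hom : IsRingHomomorphism (CommutativeRing.rawRing R) (CommutativeRing.rawRing S) φ)
           where
  private
    module S = CommutativeRing S
    module RX = SeriesRing R
    module SX = SeriesRing S
    open IsRingHomomorphism φ-hom

  mapSeries : RX.Series → SX.Series
  mapSeries f n = φ (f n)

  map-X : mapSeries RX.X SX.≈ SX.X
  map-X = SX.ext λ { zero → 0#-homo ; (suc zero) → 1#-homo ; (suc (suc _)) → 0#-homo }

  map-constant : ∀ r → mapSeries (RX.constant r) SX.≈ SX.constant (φ r)
  map-constant r = SX.ext λ { zero → S.refl ; (suc _) → 0#-homo }

  map-isRingHomomorphism : IsRingHomomorphism RX.ringRawRing SX.ringRawRing mapSeries
  map-isRingHomomorphism = record
    { isSemiringHomomorphism = record
      { isNearSemiringHomomorphism = record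
        { +-isMonoidHomomorphism = record
          { isMagmaHomomorphism = record
            { isRelHomomorphism = record { cong = λ p → SX.ext λ n → ⟦⟧-cong (RX.at p n) }
            ; homo = λ f g → SX.ext λ n →
                S.trans (⟦⟧-cong (RX.+-at f g n)) (S.trans (+-homo _ _) (S.sym (SX.+-at _ _ n)))
            }
          ; ε-homo = SX.trans (map-constant _) (SX.constant-cong 0#-homo)
          }
        ; *-homo = λ f g → SX.ext (map-* f g)
        }
      ; 1#-homo = SX.trans (map-constant _) (SX.constant-cong 1#-homo)
      }
    ; -‿homo = λ f → SX.ext λ n →
        S.trans (⟦⟧-cong (RX.-‿at f n)) (S.trans (-‿homo _) (S.sym (SX.-‿at _ n)))
    }
    where
    map-* : ∀ f g n → φ ((f RX.* g) n) S.≈ (mapSeries f SX.* mapSeries g) n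
    map-* f g zero = S.trans (⟦⟧-cong (RX.*-zero f g))
      (S.trans (*-homo _ _) (S.sym (SX.*-zero (mapSeries f) (mapSeries g))))
    map-* f g (suc n) = S.trans (⟦⟧-cong (RX.*-suc f g n)) (S.trans (+-homo _ _)
      (S.trans (S.+-cong (*-homo _ _) (map-* (RX.tail f) g n)) (S.sym (SX.*-suc (mapSeries f) (mapSeries g) n))))

-- The algebraic identities of the argument

-- To prove p = q from equations a = b, the difference p - q is exhibited as a
-- linear combination of the differences a - b. The cofactors that occur below
-- come from polynomial division.
module LinearCombination {c ℓ : Level} (R : CommutativeRing c ℓ) where
  open CommutativeRing R
  open GroupProperties +-group using (x≈y⇒x∙y⁻¹≈ε; x∙y⁻¹≈ε⇒x≈y)

  ≈⇒-≈0 : ∀ {a b} → a ≈ b → a - b ≈ 0#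
  ≈⇒-≈0 = x≈y⇒x∙y⁻¹≈ε

  -≈0⇒≈ : ∀ {a b} → a - b ≈ 0# → a ≈ b
  -≈0⇒≈ = x∙y⁻¹≈ε⇒x≈y _ _

  multiple≈0 : ∀ {a b} → a ≈ b → ∀ r → r * (a - b) ≈ 0#
  multiple≈0 a≈b r = trans (*-congˡ (≈⇒-≈0 a≈b)) (zeroʳ r)

  combine₁ : ∀ {a b} → a ≈ b → ∀ r {p q} → p - q ≈ r * (a - b) → p ≈ q
  combine₁ a≈b r e = -≈0⇒≈ (trans e (multiple≈0 a≈b r))

  combine₂ : ∀ {a b a′ b′} → a ≈ b → a′ ≈ b′ →
             ∀ r r′ {p q} → p - q ≈ r * (a - b) + r′ * (a′ - b′) → p ≈ q
  combine₂ a≈b a′≈b′ r r′ e =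
    -≈0⇒≈ (trans e (trans (+-cong (multiple≈0 a≈b r) (multiple≈0 a′≈b′ r′)) (+-identityʳ 0#)))

  regular-cancel : ∀ {r a b} → Regular R r → r * a ≈ r * b → a ≈ b
  regular-cancel {r} {a} {b} r-regular ra≈rb = -≈0⇒≈ (r-regular (a - b)
    (trans (solve 3 (λ r a b → r :* (a :- b) := r :* a :- r :* b) refl r a b) (≈⇒-≈0 ra≈rb)))
    where open IntegerCoefficients R

  regular-* : ∀ {r s} → Regular R r → Regular R s → Regular R (r * s)
  regular-* r-regular s-regular a rsa≈0 =
    s-regular a (r-regular _ (trans (sym (*-assoc _ _ _)) rsa≈0))

  regular-cong : ∀ {r s} → r ≈ s → Regular R r → Regular R s
  regular-cong r≈s r-regular a sa≈0 = r-regular a (trans (*-congʳ r≈s) sa≈0)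

-- Identities between the series of the argument, with all series replaced by
-- indeterminates subject to the equations they satisfy.
module WalkIdentities {c ℓ : Level} (R : CommutativeRing c ℓ) where
  open CommutativeRing R
  open IntegerCoefficients R
  open LinearCombination R

  open RawSemiringDefs (RawRing.rawSemiring rawRing) public using (_^_; sum)

  # : ℕ → Carrier
  # n = fromℤ (+ n)

  two four : Carrier
  two  = 1# + 1#
  four = two + two

  -- W V = 1 + 4 V³, which is V / t. The axis series is R = W Θ, and Θ₀, Θ₁ are the
  -- coefficients of x⁰ and x¹ in Θ.
  W Θ₀ Θ₁ : Carrier → Carrier
  W V  = 1# + four * (V * V * V)
  Θ₀ V = 1# - two * (V * V * V)
  Θ₁ V = V - (four - 1#) * (V * V * V * V) - V * V * V * V * V * V * V

  -- (σ - 1) / x, where σ = 1 + x (V σ + V⁴ σ²).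
  Σ′ : Carrier → Carrier → Carrier
  Σ′ V σ = V * σ + V * V * V * V * (σ * σ)

  -- (Θ - Θ₀) / x.
  Θ′ : Carrier → Carrier → Carrier → Carrier
  Θ′ x V σ = V + V * V * (x * σ - V * Σ′ V σ - two * (V * V) * σ)

  -- The axis series divided by W, explicitly in terms of V and σ.
  Θ : Carrier → Carrier → Carrier → Carrier
  Θ x V σ = Θ₀ V + x * Θ′ x V σ

  private
    :2 :4 : ∀ {n} → Polynomial n
    :2 = :1 :+ :1
    :4 = :2 :+ :2
    :W :Θ₀ :Θ₁ : ∀ {n} → Polynomial n → Polynomial n
    :W V  = :1 :+ :4 :* (V :* V :* V)
    :Θ₀ V = :1 :- :2 :* (V :* V :* V)
    :Θ₁ V = V :- (:4 :- :1) :* (V :* V :* V :* V) :- V :* V :* V :* V :* V :* V :* V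
    :Σ′ : ∀ {n} → Polynomial n → Polynomial n → Polynomial n
    :Σ′ V σ = V :* σ :+ V :* V :* V :* V :* (σ :* σ)
    :Θ′ :Θ : ∀ {n} → Polynomial n → Polynomial n → Polynomial n → Polynomial n
    :Θ′ x V σ = V :+ V :* V :* (x :* σ :- V :* :Σ′ V σ :- :2 :* (V :* V) :* σ)
    :Θ x V σ = :Θ₀ V :+ x :* :Θ′ x V σ

  -- The quadratic equation of Θ, with t eliminated by t W = V. The cofactor is the
  -- quotient of the polynomial division by σ - 1 - x Σ′.
  quadratic-θ : ∀ x V σ → σ ≈ 1# + x * Σ′ V σ →
    (1# + x * V * Θ x V σ) * (W V - V * x - V * V * Θ′ x V σ) ≈ W V - V * V * Θ₁ V
  quadratic-θ x V σ σ-eq = combine₁ σ-eq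
    (x * V ^ 13 * σ ^ 2 - two * V ^ 8 * x ^ 2 * σ + # 5 * (V ^ 10 * x * σ) + V ^ 9 * σ
      + V ^ 3 * x ^ 3 - # 5 * (V ^ 5 * x ^ 2) + # 6 * (V ^ 7 * x) - V ^ 4 * x + V ^ 9 + # 3 * V ^ 6)
    (solve 3 (λ x V σ →
      (:1 :+ x :* V :* :Θ x V σ) :* (:W V :- V :* x :- V :* V :* :Θ′ x V σ) :- (:W V :- V :* V :* :Θ₁ V)
      := (x :* V :^ 13 :* σ :^ 2 :- :2 :* V :^ 8 :* x :^ 2 :* σ :+ :# 5 :* (V :^ 10 :* x :* σ) :+ V :^ 9 :* σ
      :+ V :^ 3 :* x :^ 3 :- :# 5 :* (V :^ 5 :* x :^ 2) :+ :# 6 :* (V :^ 7 :* x) :- V :^ 4 :* x :+ V :^ 9 :+ :# 3 :* V :^ 6)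
        :* (σ :- (:1 :+ x :* :Σ′ V σ)))
      refl x V σ)

  -- The quadratic equation (1 + t x R) (1 - t x - t² R′) = 1 - t² R′(0) of the axis
  -- series R, where R′ = (R - R(0)) / x.
  quadratic : ∀ x t V σ → V ≈ t * W V → Regular R (W V) → σ ≈ 1# + x * Σ′ V σ →
    let r = W V * Θ₀ V ; a′ = W V * Θ′ x V σ ; a = r + x * a′ in
    (1# + t * x * a) * (1# - t * x - t * t * a′) ≈ 1# - t * t * (W V * Θ₁ V)
  quadratic x t V σ V-eq W-regular σ-eq = regular-cancel W-regular (begin
    W V * ((1# + t * x * (W V * Θ₀ V + x * (W V * Θ′ x V σ))) * (1# - t * x - t * t * (W V * Θ′ x V σ)))
      ≈⟨ solve 5 (λ x t w a b →
           w :* ((:1 :+ t :* x :* (w :* a :+ x :* (w :* b))) :* (:1 :- t :* x :- t :* t :* (w :* b)))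
           := (:1 :+ x :* (t :* w) :* (a :+ x :* b)) :* (w :- (t :* w) :* x :- (t :* w) :* (t :* w) :* b)) refl _ _ _ _ _ ⟩
    (1# + x * (t * W V) * Θ x V σ) * (W V - (t * W V) * x - (t * W V) * (t * W V) * Θ′ x V σ)
      ≈⟨ *-cong (+-congˡ (*-congʳ (*-congˡ V-eq)))
           (+-cong (+-congˡ (-‿cong (*-congʳ V-eq))) (-‿cong (*-congʳ (*-cong V-eq V-eq)))) ⟨
    (1# + x * V * Θ x V σ) * (W V - V * x - V * V * Θ′ x V σ)
      ≈⟨ quadratic-θ x V σ σ-eq ⟩
    W V - V * V * Θ₁ V
      ≈⟨ +-congˡ (-‿cong (*-congʳ (*-cong V-eq V-eq))) ⟩
    W V - (t * W V) * (t * W V) * Θ₁ V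
      ≈⟨ solve 3 (λ t w a → w :- (t :* w) :* (t :* w) :* a := w :* (:1 :- t :* t :* (w :* a))) refl _ _ _ ⟩
    W V * (1# - t * t * (W V * Θ₁ V)) ∎)
    where open SetoidReasoning setoid

  -- Here a = R(x), b = R(y), and Δa, Δxa stand for the divided differences
  -- (a - b) / (x - y) and (x a - y b) / (x - y). The series Q = Δxa / (1 - t x y Δa)
  -- solves the functional equation of quarter-plane walks: the difference of the
  -- two sides, times t (x - y) (1 - t x y Δa), is x y times the difference of the
  -- quadratic equations at x and at y.
  functional : ∀ x y t r a′ b′ k Δa Δxa Q →
    let a = r + x * a′ ; b = r + y * b′ in
    (1# + t * x * a) * (1# - t * x - t * t * a′) ≈ k →
    (1# + t * y * b) * (1# - t * y - t * t * b′) ≈ k →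
    (x - y) * Δa ≈ a - b →
    (x - y) * Δxa ≈ x * a - y * b →
    Q ≈ Δxa + t * (x * (y * (Q * Δa))) →
    Regular R t → Regular R (x - y) → Regular R (1# - t * x * y * Δa) →
    x * (y * Q) + t * (a + b) ≈ x * y + t * (x * (x * (y * Q)) + y * (x * (y * Q)) + Q + r)
  functional x y t r a′ b′ k Δa Δxa Q ha hb hΔa hΔxa hQ t-reg xy-reg Δ-reg =
    -≈0⇒≈ (regular-* t-reg (regular-* xy-reg Δ-reg) _ (begin
      _ ≈⟨ solve 8 (λ x y t Q Δa a b r →
             t :* ((x :- y) :* (:1 :- t :* x :* y :* Δa)) :*
               (x :* (y :* Q) :+ t :* (a :+ b)
                 :- (x :* y :+ t :* (x :* (x :* (y :* Q)) :+ y :* (x :* (y :* Q)) :+ Q :+ r)))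
             := t :* ((x :- y) :* (Q :- t :* (x :* (y :* (Q :* Δa))))
                       :* (x :* y :- t :* (x :* x :* y :+ x :* y :* y :+ :1))
                  :- ((x :- y) :- t :* x :* y :* ((x :- y) :* Δa)) :* (x :* y :- t :* (a :+ b :- r))))
             refl x y t Q Δa a b r ⟩
      _ ≈⟨ *-congˡ (+-cong
             (*-congʳ (trans (*-congˡ Q-eq) hΔxa))
             (-‿cong (*-congʳ (+-congˡ (-‿cong (*-congˡ hΔa)))))) ⟩
      _ ≈⟨ solve 6 (λ x y t r a′ b′ →
             let a = r :+ x :* a′ ; b = r :+ y :* b′ in
             t :* ((x :* a :- y :* b) :* (x :* y :- t :* (x :* x :* y :+ x :* y :* y :+ :1))
                  :- ((x :- y) :- t :* x :* y :* (a :- b)) :* (x :* y :- t :* (a :+ b :- r)))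
             := x :* y :* ((:1 :+ t :* x :* a) :* (:1 :- t :* x :- t :* t :* a′)
                            :- (:1 :+ t :* y :* b) :* (:1 :- t :* y :- t :* t :* b′)))
             refl x y t r a′ b′ ⟩
      _ ≈⟨ multiple≈0 (trans ha (sym hb)) (x * y) ⟩
      0# ∎))
    where
    open SetoidReasoning setoid
    a = r + x * a′
    b = r + y * b′
    Q-eq : Q - t * (x * (y * (Q * Δa))) ≈ Δxa
    Q-eq = combine₁ hQ 1# (solve 6 (λ x y t Q Δa Δxa →
      Q :- t :* (x :* (y :* (Q :* Δa))) :- Δxa := :1 :* (Q :- (Δxa :+ t :* (x :* (y :* (Q :* Δa))))))
      refl x y t Q Δa Δxa)

  -- The kernel equation two * (κ * L) of the wedge expresses the axis series a
  -- through D up to a multiple of κ. Substituting into the quadratic equation of a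
  -- gives κ times a series on one side, and x² times a series free of x on the other.
  eliminate : ∀ x u t D L r a′ k →
    let a = r + x * a′
        κ = u * x - t * (x * x * u + u * u + x)
        e = t * (u * u) * D - 1#
        b = t * x * (two * t * a - t * r) + t - x * x + t * (x * x * x)
        c = t + x * x - t * (x * x * x) + t * t * x * r
        g = t * (u * u * u) + u - t + t * t * (u * u) * r
        M = t * u * D + x + two * (t * u * x) * L
        disc = (u - t) * (u - t) - four * (t * t) * (u * u * u)
    in
    two * (κ * L) ≈ (two * (t * x * u) - u + t) * D + u - two * (t * a) + t * r →
    (1# + t * x * a) * (1# - t * x - t * t * a′) ≈ k →
    κ * (u * u * (two * (u * b * M) + κ * (M * M)) - (κ - two * (x * u - t * x)) * (e * e)
         - (1# - u * x) * (u * u * c + x * g))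
      ≈ x * (x * (disc * (e * e) - (g * g - four * (t * (u * u * (u * u)) * k))))
  eliminate x u t D L r a′ k hL ha = sym (combine₂ hL ha _ _
    (solve 8 (λ x u t D L r a′ k →
      let a = r :+ x :* a′
          κ = u :* x :- t :* (x :* x :* u :+ u :* u :+ x)
          e = t :* (u :* u) :* D :- :1
          b = t :* x :* (:2 :* t :* a :- t :* r) :+ t :- x :* x :+ t :* (x :* x :* x)
          c = t :+ x :* x :- t :* (x :* x :* x) :+ t :* t :* x :* r
          g = t :* (u :* u :* u) :+ u :- t :+ t :* t :* (u :* u) :* r
          M = t :* u :* D :+ x :+ :2 :* (t :* u :* x) :* L
          disc = (u :- t) :* (u :- t) :- :4 :* (t :* t) :* (u :* u :* u)
          F = (:2 :* (t :* x :* u) :- u :+ t) :* D :+ u :- :2 :* (t :* a) :+ t :* r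
          X₁ = t :* (x :* x :- u) :* e
          X₂ = u :* b :+ κ :* M
      in
      x :* (x :* (disc :* (e :* e) :- (g :* g :- :4 :* (t :* (u :* u :* (u :* u)) :* k))))
      :- κ :* (u :* u :* (:2 :* (u :* b :* M) :+ κ :* (M :* M)) :- (κ :- :2 :* (x :* u :- t :* x)) :* (e :* e)
         :- (:1 :- u :* x) :* (u :* u :* c :+ x :* g))
      := (:- (u :* u :* (X₁ :+ X₂) :* (x :* t :* u))) :* (:2 :* (κ :* L) :- F)
         :+ (:- (:4 :* (t :* (x :* x) :* (u :* u :* (u :* u))))) :*
             ((:1 :+ t :* x :* a) :* (:1 :- t :* x :- t :* t :* a′) :- k)) refl x u t D L r a′ k))

  -- In terms of V both sides of the quadratic equation of D acquire the common
  -- factor q, and the equation becomes the equality of two squares up to the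
  -- factor 1 - 4 V² u.
  factorise : ∀ t V u D →
    V ≈ t * W V →
    let e = t * (u * u) * D - 1#
        r = W V * Θ₀ V
        k = 1# - t * t * (W V * Θ₁ V)
        g = t * (u * u * u) + u - t + t * t * (u * u) * r
        disc = (u - t) * (u - t) - four * (t * t) * (u * u * u)
        q = V * V - u * (four * (V * V * V * V) + two * V - u)
        g′ = 1# - two * (V * V) * u - V * (u * u)
    in
    disc * (e * e) ≈ g * g - four * (t * (u * u * (u * u)) * k) →
    Regular R q →
    (1# - four * (V * V) * u) * (e * e) ≈ g′ * g′
  factorise t V u D V-eq hyp q-regular = regular-cancel q-regular (begin
    q * ((1# - four * (V * V) * u) * (e * e))
      ≈⟨ *-assoc _ _ _ ⟨
    q * (1# - four * (V * V) * u) * (e * e)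
      ≈⟨ *-congʳ disc-eq ⟨
    W V * W V * disc * (e * e)
      ≈⟨ trans (*-assoc _ _ _) (*-congˡ hyp) ⟩
    W V * W V * (g * g - four * (t * (u * u * (u * u)) * k′))
      ≈⟨ solve 5 (λ w g t u k′ → w :* w :* (g :* g :- :4 :* (t :* (u :* u :* (u :* u)) :* k′))
           := (w :* g) :* (w :* g) :- :4 :* (u :* u :* (u :* u)) :* (t :* w :* (w :* k′))) refl (W V) g t u k′ ⟩
    (W V * g) * (W V * g) - four * (u * u * (u * u)) * (t * W V * (W V * k′))
      ≈⟨ +-cong (*-cong g-eq g-eq) (-‿cong (*-congˡ (*-cong (sym V-eq) k-eq))) ⟩
    ĝ * ĝ - four * (u * u * (u * u)) * (V * (W V - V * V * Θ₁ V))
      ≈⟨ solve 2 (λ u V →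
           let q = V :* V :- u :* (:4 :* (V :* V :* V :* V) :+ :2 :* V :- u)
               g′ = :1 :- :2 :* (V :* V) :* u :- V :* (u :* u)
               ĝ = V :* (u :* u :* u) :+ :W V :* u :- V :+ V :* V :* (u :* u) :* :Θ₀ V
           in ĝ :* ĝ :- :4 :* (u :* u :* (u :* u)) :* (V :* (:W V :- V :* V :* :Θ₁ V))
              := q :* (g′ :* g′)) refl u V ⟩
    q * (g′ * g′) ∎)
    where
    open SetoidReasoning setoid
    e = t * (u * u) * D - 1#
    r = W V * Θ₀ V
    k′ = 1# - t * t * (W V * Θ₁ V)
    g = t * (u * u * u) + u - t + t * t * (u * u) * r
    disc = (u - t) * (u - t) - four * (t * t) * (u * u * u)
    q = V * V - u * (four * (V * V * V * V) + two * V - u)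
    g′ = 1# - two * (V * V) * u - V * (u * u)
    ĝ = V * (u * u * u) + W V * u - V + V * V * (u * u) * Θ₀ V
    g-eq : W V * g ≈ ĝ
    g-eq = combine₁ V-eq (1# - u * u * u - (t * W V + V) * Θ₀ V * (u * u))
      (solve 5 (λ t V u w θ →
        w :* (t :* (u :* u :* u) :+ u :- t :+ t :* t :* (u :* u) :* (w :* θ))
          :- (V :* (u :* u :* u) :+ w :* u :- V :+ V :* V :* (u :* u) :* θ)
        := (:1 :- u :* u :* u :- (t :* w :+ V) :* θ :* (u :* u)) :* (V :- t :* w))
        refl t V u (W V) (Θ₀ V))
    k-eq : W V * k′ ≈ W V - V * V * Θ₁ V
    k-eq = combine₁ V-eq ((t * W V + V) * Θ₁ V)
      (solve 4 (λ t V w θ → w :* (:1 :- t :* t :* (w :* θ)) :- (w :- V :* V :* θ)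
        := ((t :* w :+ V) :* θ) :* (V :- t :* w)) refl t V (W V) (Θ₁ V))
    disc-eq : W V * W V * disc ≈ q * (1# - four * (V * V) * u)
    disc-eq = combine₁ V-eq
      (two * u * W V - (V + t * W V) + four * (u * u * u) * (V + t * W V))
      (solve 3 (λ t V u →
        :W V :* :W V :* ((u :- t) :* (u :- t) :- :4 :* (t :* t) :* (u :* u :* u))
        :- (V :* V :- u :* (:4 :* (V :* V :* V :* V) :+ :2 :* V :- u)) :* (:1 :- :4 :* (V :* V) :* u)
        := (:2 :* u :* :W V :- (V :+ t :* :W V) :+ :4 :* (u :* u :* u) :* (V :+ t :* :W V)) :* (V :- t :* :W V))
        refl t V u)

  -- If d e² = g² and p² d = 1, then e = p g or e = - p g; the first case is
  -- excluded when e - p g is not a zero divisor.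
  root : ∀ {e g d p} → d * (e * e) ≈ g * g → p * p * d ≈ 1# → Regular R (e - p * g) → e ≈ - (p * g)
  root {e} {g} {d} {p} he hp reg = combine₁ (reg (e + p * g) (begin
    (e - p * g) * (e + p * g)
      ≈⟨ solve 3 (λ e p g → (e :- p :* g) :* (e :+ p :* g) := :1 :* (e :* e) :- p :* p :* (g :* g)) refl e p g ⟩
    1# * (e * e) - p * p * (g * g)
      ≈⟨ +-cong (*-congʳ hp) (-‿cong (*-congˡ he)) ⟨
    p * p * d * (e * e) - p * p * (d * (e * e))
      ≈⟨ solve 3 (λ p d e → p :* p :* d :* (e :* e) :- p :* p :* (d :* (e :* e)) := :# 0) refl p d e ⟩
    0# ∎)) 1# (solve 3 (λ e p g → e :- (:- (p :* g)) := :1 :* (e :+ p :* g :- :# 0)) refl e p g)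
    where open SetoidReasoning setoid

  -- Elimination of V. The quadratic equation of D has the form Y = C₁ V + C₂ V² with
  -- Y = Disc (τ D - 1)² - M₀ and coefficients in ℤ[t,u]. Since 4 t V³ = V - t, the norm
  -- of Y - C₁ V - C₂ V² is a cubic polynomial in Y, hence of degree six in D.
  module Cubic (t u : Carrier) where
    H M₀ C₁ C₂ Disc α β γ δ : Carrier
    H  = t * (u * u * u) + u - t
    M₀ = H * H - # 3 * (t * (u * u * (u * u)))
    C₁ = u * u * (# 3 * (t * H) - u * u)
    C₂ = u * u * (# 9 * (t * t * (u * u)) - H)
    Disc = (u - t) * (u - t) - four * (t * t) * (u * u * u)
    α = # 16 * (t * t)
    β = - (# 8 * (t * C₂))
    γ = # 12 * (t * t * (C₁ * C₂)) - four * (t * (C₁ * C₁)) + C₂ * C₂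
    δ = four * (t * t * (C₁ * C₁ * C₁)) - t * (C₁ * (C₂ * C₂)) - t * t * (C₂ * C₂ * C₂)

    reduce : ∀ V D → V ≈ t * W V →
      let e = t * (u * u) * D - 1#
          r = W V * Θ₀ V
          k = 1# - t * t * (W V * Θ₁ V)
          g = t * (u * u * u) + u - t + t * t * (u * u) * r
      in Disc * (e * e) ≈ g * g - four * (t * (u * u * (u * u)) * k) →
      Disc * (e * e) - M₀ ≈ C₁ * V + C₂ * (V * V)
    reduce V D V-eq hyp = combine₂ hyp V-eq 1#
      (# 12 * (t ^ 3 * V ^ 6 * u ^ 4) - # 16 * (t ^ 3 * V ^ 9 * u ^ 4) - t ^ 3 * u ^ 4
        + # 16 * (t ^ 2 * V ^ 4 * u ^ 4) + # 4 * (t ^ 2 * V ^ 3 * u ^ 5) - # 4 * (t ^ 2 * V ^ 3 * u ^ 2)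
        - # 5 * (t ^ 2 * V * u ^ 4) - two * t ^ 2 * u ^ 5 + two * t ^ 2 * u ^ 2 + # 4 * (t * V ^ 3 * u ^ 3)
        + # 4 * (t * V ^ 2 * u ^ 4) + t * V * u ^ 5 - t * V * u ^ 2 - two * t * u ^ 3 + V * u ^ 3 + u ^ 4)
      (solve 4 (λ t V u Z →
        let H  = t :* (u :* u :* u) :+ u :- t
            M₀ = H :* H :- :# 3 :* (t :* (u :* u :* (u :* u)))
            C₁ = u :* u :* (:# 3 :* (t :* H) :- u :* u)
            C₂ = u :* u :* (:# 9 :* (t :* t :* (u :* u)) :- H)
            g = t :* (u :* u :* u) :+ u :- t :+ t :* t :* (u :* u) :* (:W V :* :Θ₀ V)
            k = :1 :- t :* t :* (:W V :* :Θ₁ V)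
        in (Z :- M₀) :- (C₁ :* V :+ C₂ :* (V :* V)) :=
          :1 :* (Z :- (g :* g :- :4 :* (t :* (u :* u :* (u :* u)) :* k)))
          :+ (:# 12 :* (t :^ 3 :* V :^ 6 :* u :^ 4) :- :# 16 :* (t :^ 3 :* V :^ 9 :* u :^ 4) :- t :^ 3 :* u :^ 4
        :+ :# 16 :* (t :^ 2 :* V :^ 4 :* u :^ 4) :+ :# 4 :* (t :^ 2 :* V :^ 3 :* u :^ 5) :- :# 4 :* (t :^ 2 :* V :^ 3 :* u :^ 2)
        :- :# 5 :* (t :^ 2 :* V :* u :^ 4) :- :2 :* t :^ 2 :* u :^ 5 :+ :2 :* t :^ 2 :* u :^ 2 :+ :# 4 :* (t :* V :^ 3 :* u :^ 3)
        :+ :# 4 :* (t :* V :^ 2 :* u :^ 4) :+ t :* V :* u :^ 5 :- t :* V :* u :^ 2 :- :2 :* t :* u :^ 3 :+ V :* u :^ 3 :+ u :^ 4)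
            :* (V :- t :* :W V))
        refl t V u (Disc * ((t * (u * u) * D - 1#) * (t * (u * u) * D - 1#))))

    -- The characteristic equation of C₁ V + C₂ V², multiplied by 16 t².
    cubic : ∀ V Y → V ≈ t * W V → Y ≈ C₁ * V + C₂ * (V * V) →
      α * (Y * (Y * Y)) + β * (Y * Y) + γ * Y + δ ≈ 0#
    cubic V Y V-eq Y-eq = trans
      (+-congʳ (+-cong (+-cong (*-congˡ (*-cong Y-eq (*-cong Y-eq Y-eq))) (*-congˡ (*-cong Y-eq Y-eq))) (*-congˡ Y-eq)))
      (combine₁ V-eq
        (t * b ^ 3 + V * b ^ 3 + a * b ^ 2 - # 4 * (t * V ^ 3 * b ^ 3) - # 12 * (t * V ^ 2 * a * b ^ 2)
          - # 12 * (t * V * a ^ 2 * b) - # 4 * (t * a ^ 3))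
        (solve 4 (λ t V a b →
          let Y = a :* V :+ b :* (V :* V)
              α = :# 16 :* (t :* t)
              β = :- (:# 8 :* (t :* b))
              γ = :# 12 :* (t :* t :* (a :* b)) :- :4 :* (t :* (a :* a)) :+ b :* b
              δ = :4 :* (t :* t :* (a :* a :* a)) :- t :* (a :* (b :* b)) :- t :* t :* (b :* b :* b)
          in (α :* (Y :* (Y :* Y)) :+ β :* (Y :* Y) :+ γ :* Y :+ δ) :- :# 0 :=
            (t :* b :^ 3 :+ V :* b :^ 3 :+ a :* b :^ 2 :- :# 4 :* (t :* V :^ 3 :* b :^ 3) :- :# 12 :* (t :* V :^ 2 :* a :* b :^ 2)
            :- :# 12 :* (t :* V :* a :^ 2 :* b) :- :# 4 :* (t :* a :^ 3)) :* (V :- t :* :W V))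
          refl t V a b))
      where
      a = C₁
      b = C₂

    -- The cubic in Y rewritten as b₃ Z³ + b₂ Z² + b₁ Z + b₀ with Z = (τ D - 1)².
    b₀ b₁ b₂ b₃ τ : Carrier
    τ  = t * (u * u)
    b₃ = α * (Disc * (Disc * Disc))
    b₂ = Disc * Disc * (β - # 3 * (α * M₀))
    b₁ = Disc * (# 3 * (α * (M₀ * M₀)) - two * (β * M₀) + γ)
    b₀ = β * (M₀ * M₀) - α * (M₀ * (M₀ * M₀)) - γ * M₀ + δ

    -- The coefficients of the resulting polynomial in D.
    coefficient : Fin 7 → Carrier
    coefficient zero                                     = b₀ + b₁ + b₂ + b₃
    coefficient (suc zero)                               = - (τ * (two * b₁ + four * b₂ + # 6 * b₃))
    coefficient (suc (suc zero))                         = τ ^ 2 * (b₁ + # 6 * b₂ + # 15 * b₃)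
    coefficient (suc (suc (suc zero)))                   = - (τ ^ 3 * (four * b₂ + # 20 * b₃))
    coefficient (suc (suc (suc (suc zero))))             = τ ^ 4 * (b₂ + # 15 * b₃)
    coefficient (suc (suc (suc (suc (suc zero)))))       = - (τ ^ 5 * (# 6 * b₃))
    coefficient (suc (suc (suc (suc (suc (suc zero)))))) = τ ^ 6 * b₃

    sextic : ∀ D → let e = τ * D - 1# ; Y = Disc * (e * e) - M₀ in
      sum (λ i → coefficient i * D ^ toℕ i) ≈ α * (Y * (Y * Y)) + β * (Y * Y) + γ * Y + δ
    sextic D = trans
      (solve 6 (λ b₀ b₁ b₂ b₃ τ D →
        (b₀ :+ b₁ :+ b₂ :+ b₃) :* :1
        :+ ((:- (τ :* (:2 :* b₁ :+ :4 :* b₂ :+ :# 6 :* b₃))) :* (D :* :1)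
        :+ ((τ :^ 2 :* (b₁ :+ :# 6 :* b₂ :+ :# 15 :* b₃)) :* (D :* (D :* :1))
        :+ ((:- (τ :^ 3 :* (:4 :* b₂ :+ :# 20 :* b₃))) :* (D :* (D :* (D :* :1)))
        :+ ((τ :^ 4 :* (b₂ :+ :# 15 :* b₃)) :* (D :* (D :* (D :* (D :* :1))))
        :+ ((:- (τ :^ 5 :* (:# 6 :* b₃))) :* (D :* (D :* (D :* (D :* (D :* :1)))))
        :+ ((τ :^ 6 :* b₃) :* (D :* (D :* (D :* (D :* (D :* (D :* :1)))))) :+ :# 0))))))
        := b₃ :* (τ :* D :- :1) :^ 6 :+ b₂ :* (τ :* D :- :1) :^ 4 :+ b₁ :* (τ :* D :- :1) :^ 2 :+ b₀)
        refl b₀ b₁ b₂ b₃ τ D)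
      (solve 7 (λ α β γ δ d m e →
        let Y = d :* (e :* e) :- m in
        α :* (d :* (d :* d)) :* e :^ 6 :+ d :* d :* (β :- :# 3 :* (α :* m)) :* e :^ 4
          :+ d :* (:# 3 :* (α :* (m :* m)) :- :2 :* (β :* m) :+ γ) :* e :^ 2
          :+ (β :* (m :* m) :- α :* (m :* (m :* m)) :- γ :* m :+ δ)
        := α :* (Y :* (Y :* Y)) :+ β :* (Y :* Y) :+ γ :* Y :+ δ)
        refl α β γ δ Disc M₀ (τ * D - 1#))

  -- The kernel equation of the wedge follows from the step recurrences on the
  -- diagonal and below it. Here L = L₀ + x L⁺, a = c + x ρ is the axis series and c its
  -- value at x = 0.
  wedge : ∀ {x u t D L L₀ L⁺ a c ρ r} →
    u * D + t * c ≈ u + t * (u * (u * L₀) + u * (u * L₀)) + t * D →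
    u * L + t * ρ ≈ t * (u * (D + x * L) + u * (u * L⁺) + L) →
    L ≈ L₀ + x * L⁺ → a ≈ c + x * ρ → r ≈ c →
    two * ((u * x - t * (x * x * u + u * u + x)) * L)
      ≈ (two * (t * x * u) - u + t) * D + u - two * (t * a) + t * r
  wedge {x} {u} {t} {D} {L} {L₀} {L⁺} {a} {c} {ρ} {r} E₁ E₂ hL ha hr = -≈0⇒≈ (trans
    (solve 11 (λ x u t D L L₀ L⁺ a c ρ r →
      :2 :* ((u :* x :- t :* (x :* x :* u :+ u :* u :+ x)) :* L)
        :- ((:2 :* (t :* x :* u) :- u :+ t) :* D :+ u :- :2 :* (t :* a) :+ t :* r)
      := :1 :* (u :* D :+ t :* c :- (u :+ t :* (u :* (u :* L₀) :+ u :* (u :* L₀)) :+ t :* D))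
        :+ (:2 :* x :* (u :* L :+ t :* ρ :- t :* (u :* (D :+ x :* L) :+ u :* (u :* L⁺) :+ L))
        :+ ((:- (:2 :* (t :* (u :* u)))) :* (L :- (L₀ :+ x :* L⁺))
        :+ (:2 :* t :* (a :- (c :+ x :* ρ))
        :+ (:- t) :* (r :- c)))))
      refl x u t D L L₀ L⁺ a c ρ r)
    (0+0 (multiple≈0 E₁ _) (0+0 (multiple≈0 E₂ _) (0+0 (multiple≈0 hL _) (0+0 (multiple≈0 ha _) (multiple≈0 hr _))))))
    where
    0+0 : ∀ {a b} → a ≈ 0# → b ≈ 0# → a + b ≈ 0#
    0+0 p q = trans (+-cong p q) (+-identityʳ 0#)

-- Counting walks by their last step

-- The number of elements of a list that satisfy a decidable predicate.

count : {a p : Level} {A : Set a} {P : Pred A p} → Decidable P → List A → ℕ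
count P? xs = length (filter P? xs)

count-++ : {a p : Level} {A : Set a} {P : Pred A p} (P? : Decidable P) (xs ys : List A) →
           count P? (xs ++ ys) ≡ count P? xs ℕ.+ count P? ys
count-++ P? xs ys = ≡.trans (≡.cong length (Listₚ.filter-++ P? xs ys)) (Listₚ.length-++ (filter P? xs))

count-map : {a b p q : Level} {A : Set a} {B : Set b} {P : Pred B p} {Q : Pred A q} (P? : Decidable P) (Q? : Decidable Q) (f : A → B) →
            (∀ x → P (f x) ⇔ Q x) → ∀ xs → count P? (map f xs) ≡ count Q? xs
count-map P? Q? f P⇔Q [] = ≡.refl
count-map P? Q? f P⇔Q (x ∷ xs) with P? (f x) | Q? x
... | yes _ | yes _ = ≡.cong suc (count-map P? Q? f P⇔Q xs)
... | no _  | no _  = count-map P? Q? f P⇔Q xs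
... | yes r | no ¬s = contradiction (Equivalence.to (P⇔Q x) r) ¬s
... | no ¬r | yes s = contradiction (Equivalence.from (P⇔Q x) s) ¬r

count-none : {a p : Level} {A : Set a} {P : Pred A p} (P? : Decidable P) → (∀ x → ¬ P x) → ∀ xs → count P? xs ≡ 0
count-none P? ¬P xs = ≡.cong length (Listₚ.filter-none P? (Allₚ.universal ¬P xs))

-- Walks in the quarter plane from s to e, with vertices listed by scanl.

IsWalk : Point → Point → List Step → Set
IsWalk s e w = All InQuadrant (scanl move s w) × foldl move s w ≡ e

isWalk? : ∀ s e → Decidable (IsWalk s e)
isWalk? s e w =
  all? inQuadrant? (scanl move s w) ×-dec ≡-dec ℤ._≟_ ℤ._≟_ (foldl move s w) e

-- The number of walks of length m from s to e.
walks : ℕ → Point → Point → ℕ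
walks m s e = count (isWalk? s e) (words m)

scanl-∷ : {a b : Level} {A : Set a} {B : Set b} (f : A → B → A) (e : A) (x : B) (xs : List B) → scanl f e (x ∷ xs) ≡ e ∷ scanl f (f e x) xs
scanl-∷ f e x xs = ≡.trans (scanl-defn f e (x ∷ xs)) (≡.sym (≡.trans
  (≡.cong (e ∷_) (scanl-defn f (f e x) xs))
  (≡.cong (λ ys → e ∷ f e x ∷ ys) (Listₚ.map-∘ (inits-tail xs)))))
  where
  inits-tail : ∀ {a} {A : Set a} → List A → List (List A)
  inits-tail ys = Data.List.Inits.tail ys

isWalk-∷ : ∀ s e d w → IsWalk s e (d ∷ w) ⇔ (InQuadrant s × IsWalk (move s d) e w)
isWalk-∷ s e d w = mk⇔ to from
  where
  to : IsWalk s e (d ∷ w) → InQuadrant s × IsWalk (move s d) e w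
  to (inside , end) with ≡.subst (All InQuadrant) (scanl-∷ move s d w) inside
  ... | h ∷ t = h , t , end
  from : InQuadrant s × IsWalk (move s d) e w → IsWalk s e (d ∷ w)
  from (h , t , end) = ≡.subst (All InQuadrant) (≡.sym (scanl-∷ move s d w)) (h ∷ t) , end

walks-outside : ∀ m s e → ¬ InQuadrant s → walks m s e ≡ 0
walks-outside m s e outside = count-none (isWalk? s e) none (words m)
  where
  none : ∀ w → ¬ IsWalk s e w
  none []      (h ∷ _ , _) = outside h
  none (_ ∷ _) (h ∷ _ , _) = outside h

walks-suc : ∀ m s e → InQuadrant s →
            walks (suc m) s e ≡ walks m (move s east) e ℕ.+ (walks m (move s north) e ℕ.+ walks m (move s southwest) e)
walks-suc m s e inside = begin
  count P? (map (east ∷_) ws ++ (map (north ∷_) ws ++ (map (southwest ∷_) ws ++ [])))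
    ≡⟨ count-++ P? (map (east ∷_) ws) _ ⟩
  _ ℕ.+ count P? (map (north ∷_) ws ++ (map (southwest ∷_) ws ++ []))
    ≡⟨ ≡.cong₂ ℕ._+_ (first east) (≡.trans (count-++ P? (map (north ∷_) ws) _)
         (≡.cong₂ ℕ._+_ (first north) (≡.trans (≡.cong (count P?) (Listₚ.++-identityʳ (map (southwest ∷_) ws))) (first southwest)))) ⟩
  _ ∎
  where
  open ≡.≡-Reasoning
  ws = words m
  P? = isWalk? s e
  first : ∀ d → count P? (map (d ∷_) ws) ≡ walks m (move s d) e
  first d = count-map P? (isWalk? (move s d) e) (d ∷_)
    (λ w → mk⇔ (λ x → proj₂ (Equivalence.to (isWalk-∷ s e d w) x))
               (λ x → Equivalence.from (isWalk-∷ s e d w) (inside , x))) ws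

-- Kronecker's delta.

δ : ℕ → ℕ → ℕ
δ zero    zero    = 1
δ zero    (suc _) = 0
δ (suc _) zero    = 0
δ (suc m) (suc n) = δ m n

-- The value at the predecessor, and 0 where there is none.
pre : (ℕ → ℕ) → ℕ → ℕ
pre f zero    = 0
pre f (suc n) = f n

-- The same, for both arguments at once.
pre² : (ℕ → ℕ → ℕ) → ℕ → ℕ → ℕ
pre² f (suc m) (suc n) = f m n
pre² f _       _       = 0

-- The number of walks of length m from (i , j) to (a , b) by recursion on the
-- first step.
paths : ℕ → ℕ → ℕ → ℕ → ℕ → ℕ
paths zero    i j a b = δ i a ℕ.* δ j b
paths (suc m) i j a b =
  paths m (suc i) j a b ℕ.+ (paths m i (suc j) a b ℕ.+ pre² (λ i j → paths m i j a b) i j)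

walks≡paths : ∀ m i j a b → walks m (+ i , + j) (+ a , + b) ≡ paths m i j a b
walks≡paths zero i j a b = start (i ℕ.≟ a) (j ℕ.≟ b)
  where
  P? = isWalk? (+ i , + j) (+ a , + b)
  δ-refl : ∀ n → δ n n ≡ 1
  δ-refl zero    = ≡.refl
  δ-refl (suc n) = δ-refl n
  δ-≢ : ∀ m n → m ≢ n → δ m n ≡ 0
  δ-≢ zero    zero    m≢n = contradiction ≡.refl m≢n
  δ-≢ zero    (suc n) m≢n = ≡.refl
  δ-≢ (suc m) zero    m≢n = ≡.refl
  δ-≢ (suc m) (suc n) m≢n = δ-≢ m n (λ m≡n → m≢n (≡.cong suc m≡n))
  here : i ≡ a → j ≡ b → IsWalk (+ i , + j) (+ a , + b) []
  here ≡.refl ≡.refl = ((ℤ.+≤+ ℕ.z≤n , ℤ.+≤+ ℕ.z≤n) ∷ []) , ≡.refl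
  start : Dec (i ≡ a) → Dec (j ≡ b) → count P? ([] ∷ []) ≡ δ i a ℕ.* δ j b
  start (yes ≡.refl) (yes ≡.refl) = ≡.trans
    (≡.cong length (Listₚ.filter-accept P? {x = []} {xs = []} (here ≡.refl ≡.refl)))
    (≡.sym (≡.cong₂ ℕ._*_ (δ-refl i) (δ-refl j)))
  start (no i≢a) _ = ≡.trans
    (≡.cong length (Listₚ.filter-reject P? {x = []} {xs = []} (λ w → i≢a (ℤₚ.+-injective (≡.cong proj₁ (proj₂ w))))))
    (≡.sym (≡.cong (ℕ._* δ j b) (δ-≢ i a i≢a)))
  start _ (no j≢b) = ≡.trans
    (≡.cong length (Listₚ.filter-reject P? {x = []} {xs = []} (λ w → j≢b (ℤₚ.+-injective (≡.cong proj₂ (proj₂ w))))))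
    (≡.sym (≡.trans (≡.cong (δ i a ℕ.*_) (δ-≢ j b j≢b)) (ℕₚ.*-zeroʳ (δ i a))))
walks≡paths (suc m) i j a b = ≡.trans
  (walks-suc m (+ i , + j) (+ a , + b) (ℤ.+≤+ ℕ.z≤n , ℤ.+≤+ ℕ.z≤n))
  (≡.cong₂ ℕ._+_ (≡.trans (≡.cong (λ k → walks m (+ k , + j) (+ a , + b)) (ℕₚ.+-comm i 1)) (walks≡paths m (suc i) j a b))
    (≡.cong₂ ℕ._+_ (≡.trans (≡.cong (λ k → walks m (+ i , + k) (+ a , + b)) (ℕₚ.+-comm j 1)) (walks≡paths m i (suc j) a b))
      (diagonal i j)))
  where
  diagonal : ∀ i j → walks m (+ i ℤ.+ -1ℤ , + j ℤ.+ -1ℤ) (+ a , + b) ≡ pre² (λ i j → paths m i j a b) i j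
  diagonal zero    j       = walks-outside m _ _ λ ()
  diagonal (suc i) zero    = walks-outside m _ _ λ ()
  diagonal (suc i) (suc j) = walks≡paths m i j a b

pre-+ : ∀ {f g h} → (∀ n → f n ≡ g n ℕ.+ h n) → ∀ n → pre f n ≡ pre g n ℕ.+ pre h n
pre-+ p zero    = ≡.refl
pre-+ p (suc n) = p n

-- The contributions of the three possible last steps to a walk ending at (a , b).
last : (ℕ → ℕ → ℕ) → ℕ → ℕ → ℕ
last f a b = pre (λ a → f a b) a ℕ.+ (pre (f a) b ℕ.+ f (suc a) (suc b))

last-+ : ∀ {f g h} → (∀ a b → f a b ≡ g a b ℕ.+ h a b) → ∀ a b → last f a b ≡ last g a b ℕ.+ last h a b
last-+ {f} {g} {h} p a b = ≡.trans
  (≡.cong₂ ℕ._+_ (pre-+ (λ n → p n b) a) (≡.cong₂ ℕ._+_ (pre-+ (p a) b) (p (suc a) (suc b))))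
  (solve 6 (λ a b c d e f → (a :+ b) :+ ((c :+ d) :+ (e :+ f)) := (a :+ (c :+ e)) :+ (b :+ (d :+ f)))
    ≡.refl (pre (λ a → g a b) a) (pre (λ a → h a b) a) (pre (g a) b) (pre (h a) b) (g (suc a) (suc b)) _)
  where open +-*-Solver

-- First and last steps can be exchanged, so that walks from the origin may be
-- counted by their last step.
paths-last : ∀ m i j a b → paths (suc m) i j a b ≡ last (paths m i j) a b
paths-last zero i j a b = ≡.cong₂ ℕ._+_ (eastward a) (≡.cong₂ ℕ._+_ (northward b) (diagonal i j))
  where
  eastward : ∀ a → δ (suc i) a ℕ.* δ j b ≡ pre (λ a → δ i a ℕ.* δ j b) a
  eastward zero    = ≡.refl
  eastward (suc a) = ≡.refl
  northward : ∀ b → δ i a ℕ.* δ (suc j) b ≡ pre (λ b → δ i a ℕ.* δ j b) b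
  northward zero    = ℕₚ.*-zeroʳ (δ i a)
  northward (suc b) = ≡.refl
  diagonal : ∀ i j → pre² (λ i j → δ i a ℕ.* δ j b) i j ≡ δ i (suc a) ℕ.* δ j (suc b)
  diagonal zero    j       = ≡.refl
  diagonal (suc i) zero    = ≡.sym (ℕₚ.*-zeroʳ (δ i a))
  diagonal (suc i) (suc j) = ≡.refl
paths-last (suc m) i j a b = ≡.trans
  (≡.cong₂ ℕ._+_ (paths-last m (suc i) j a b) (≡.trans
    (≡.cong₂ ℕ._+_ (paths-last m i (suc j) a b) (diagonal i j))
    (≡.sym (last-+ {g = paths m i (suc j)} {h = λ a b → pre² (λ i j → paths m i j a b) i j} (λ _ _ → ≡.refl) a b))))
  (≡.sym (last-+ {g = paths m (suc i) j} (λ _ _ → ≡.refl) a b))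
  where
  diagonal : ∀ i j → pre² (λ i j → paths (suc m) i j a b) i j
                     ≡ last (λ a b → pre² (λ i j → paths m i j a b) i j) a b
  last-0 : ∀ a b → last (λ _ _ → 0) a b ≡ 0
  last-0 zero    zero    = ≡.refl
  last-0 zero    (suc b) = ≡.refl
  last-0 (suc a) zero    = ≡.refl
  last-0 (suc a) (suc b) = ≡.refl
  diagonal zero    j       = ≡.sym (last-0 a b)
  diagonal (suc i) zero    = ≡.sym (last-0 a b)
  diagonal (suc i) (suc j) = paths-last m i j a b

k-zero : ∀ i j → k 0 i j ≡ δ 0 i ℕ.* δ 0 j
k-zero = walks≡paths 0 0 0

k-suc : ∀ m i j → k (suc m) i j ≡ last (k m) i j
k-suc m i j = ≡.trans (walks≡paths (suc m) 0 0 i j) (≡.trans (paths-last m 0 0 i j)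
  (≡.sym (≡.cong₂ ℕ._+_ (lemma₁ i) (≡.cong₂ ℕ._+_ (lemma₂ j) (walks≡paths m 0 0 _ _)))))
  where
  lemma₁ : ∀ i → pre (λ a → k m a j) i ≡ pre (λ a → paths m 0 0 a j) i
  lemma₁ zero    = ≡.refl
  lemma₁ (suc i) = walks≡paths m 0 0 i j
  lemma₂ : ∀ j → pre (k m i) j ≡ pre (paths m 0 0 i) j
  lemma₂ zero    = ≡.refl
  lemma₂ (suc j) = walks≡paths m 0 0 i j

k-sym : ∀ m i j → k m i j ≡ k m j i
k-sym zero i j = ≡.trans (k-zero i j) (≡.trans (ℕₚ.*-comm (δ 0 i) (δ 0 j)) (≡.sym (k-zero j i)))
k-sym (suc m) i j = ≡.trans (k-suc m i j) (≡.trans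
  (≡.cong₂ ℕ._+_ (lemma i j) (≡.cong₂ ℕ._+_ (≡.sym (lemma j i)) (k-sym m (suc i) (suc j))))
  (≡.trans
    (solve 3 (λ a b c → a :+ (b :+ c) := b :+ (a :+ c)) ≡.refl (pre (k m j) i) (pre (λ a → k m a i) j) (k m (suc j) (suc i)))
    (≡.sym (k-suc m j i))))
  where
  open +-*-Solver
  lemma : ∀ i j → pre (λ a → k m a j) i ≡ pre (k m j) i
  lemma zero    j = ≡.refl
  lemma (suc i) j = k-sym m i j

-- Natural numbers as rational numbers

ℚ-ring : CommutativeRing _ _
ℚ-ring = ℚₚ.+-*-commutativeRing

module ℚ-Solver = IntegerCoefficients ℚ-ring
module LQ = LinearCombination ℚ-ring

toℚᵘ-fraction : ∀ i n → toℚᵘ (i / suc n) ℚᵘ.≃ mkℚᵘ i n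
toℚᵘ-fraction i n = ℚₚ.toℚᵘ-fromℚᵘ (mkℚᵘ i n)

fromℕ-+ : ∀ m n → fromℕ (m ℕ.+ n) ≡ fromℕ m ℚ.+ fromℕ n
fromℕ-+ m n = ℚₚ.toℚᵘ-injective (ℚᵘₚ.≃-trans (toℚᵘ-fraction (+ (m ℕ.+ n)) 0)
  (ℚᵘₚ.≃-sym (ℚᵘₚ.≃-trans (ℚₚ.toℚᵘ-homo-+ (fromℕ m) (fromℕ n)) (ℚᵘₚ.≃-trans
    (ℚᵘₚ.+-cong (toℚᵘ-fraction (+ m) 0) (toℚᵘ-fraction (+ n) 0))
    (*≡* (≡.cong (ℤ._* 1ℤ) (≡.cong₂ ℤ._+_ (ℤₚ.*-identityʳ (+ m)) (ℤₚ.*-identityʳ (+ n)))))))))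

fromℕ-* : ∀ m n → fromℕ (m ℕ.* n) ≡ fromℕ m ℚ.* fromℕ n
fromℕ-* m n = ℚₚ.toℚᵘ-injective (ℚᵘₚ.≃-trans (toℚᵘ-fraction (+ (m ℕ.* n)) 0)
  (ℚᵘₚ.≃-sym (ℚᵘₚ.≃-trans (ℚₚ.toℚᵘ-homo-* (fromℕ m) (fromℕ n)) (ℚᵘₚ.≃-trans
    (ℚᵘₚ.*-cong (toℚᵘ-fraction (+ m) 0) (toℚᵘ-fraction (+ n) 0))
    (*≡* (≡.cong (ℤ._* 1ℤ) (≡.sym (ℤₚ.pos-* m n))))))))

fromℕ-suc : ∀ n → fromℕ (suc n) ≡ 1ℚ ℚ.+ fromℕ n
fromℕ-suc = fromℕ-+ 1

-- The characteristic property of the fraction m / n.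
fraction-* : ∀ m n .{{_ : ℕ.NonZero n}} → (+ m / n) ℚ.* fromℕ n ≡ fromℕ m
fraction-* m (suc n) = ℚₚ.toℚᵘ-injective (ℚᵘₚ.≃-trans (ℚₚ.toℚᵘ-homo-* (+ m / suc n) (fromℕ (suc n)))
  (ℚᵘₚ.≃-trans (ℚᵘₚ.*-cong (toℚᵘ-fraction (+ m) n) (toℚᵘ-fraction (+ suc n) 0)) (ℚᵘₚ.≃-trans
    (*≡* (≡.trans (ℤₚ.*-identityʳ _) (≡.cong (λ k → + m ℤ.* + k) (≡.sym (ℕₚ.*-identityʳ (suc n))))))
    (ℚᵘₚ.≃-sym (toℚᵘ-fraction (+ m) 0)))))

fromℕ-nonZero : ∀ n .{{_ : ℕ.NonZero n}} → fromℕ n ≢ 0ℚ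
fromℕ-nonZero (suc n) p with ℚₚ./-injective-≃ (mkℚᵘ (+ suc n) 0) (mkℚᵘ 0ℤ 0) p
... | *≡* ()

-- A nonzero rational is not a zero divisor.
≢0-regular : ∀ {p} → p ≢ 0ℚ → Regular ℚ-ring p
≢0-regular {p} p≢0 q pq≡0 = begin
  q                       ≡⟨ ℚₚ.*-identityˡ q ⟨
  1ℚ ℚ.* q                ≡⟨ ≡.cong (ℚ._* q) (ℚₚ.*-inverseˡ p) ⟨
  (ℚ.1/ p ℚ.* p) ℚ.* q    ≡⟨ ℚₚ.*-assoc (ℚ.1/ p) p q ⟩
  ℚ.1/ p ℚ.* (p ℚ.* q)    ≡⟨ ≡.cong (ℚ.1/ p ℚ.*_) pq≡0 ⟩
  ℚ.1/ p ℚ.* 0ℚ           ≡⟨ ℚₚ.*-zeroʳ (ℚ.1/ p) ⟩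
  0ℚ                      ∎
  where
  open ≡.≡-Reasoning
  instance _ = ℚ.≢-nonZero p≢0

-- The axis series and the functional equation

-- A = ℚ[[t]], B = A[[u]] and C = B[[x]]. In C the inner variable u is called x₁ and
-- the outer variable x is called x₂.
module A = SeriesRing ℚ-ring
module B = SeriesRing A.ring
module C = SeriesRing B.ring
module PA = WalkIdentities A.ring
module PB = WalkIdentities B.ring
module PC = WalkIdentities C.ring
module LA = LinearCombination A.ring
module LB = LinearCombination B.ring
module LC = LinearCombination C.ring
module RA = CommutativeRing A.ring
module RB = CommutativeRing B.ring
module RC = CommutativeRing C.ring

module SA = IntegerCoefficients A.ring
module SB = IntegerCoefficients B.ring
module SC = IntegerCoefficients C.ring

module AB = Naturality A.ring B.ring B.constant-isRingHomomorphism
module BC = Naturality B.ring C.ring C.constant-isRingHomomorphism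

-- For f in B, inner f and outer f are f(x₁) and f(x₂).
module Outer = Map A.ring B.ring B.constant-isRingHomomorphism
open Outer using () renaming (mapSeries to outer) public
module OuterNat = Naturality B.ring C.ring Outer.map-isRingHomomorphism

inner : B.Series → C.Series
inner = C.constant

tA : A.Series
tA = A.X

tB u : B.Series
tB = B.constant tA
u  = B.X

tC x₁ x₂ : C.Series
tC  = inner tB
x₁ = inner u
x₂ = C.X

-- V is half of the series U: V = t (1 + 4 V³).
module V-fixpoint = A.Fixpoint A.0# PA.W
  (A.+-nonExpansive (A.const-nonExpansive A.1#)
    (A.*-nonExpansive (A.const-nonExpansive PA.four)
      (A.*-nonExpansive (A.*-nonExpansive A.id-nonExpansive A.id-nonExpansive) A.id-nonExpansive)))

V : A.Series
V = V-fixpoint.fixpoint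

V-eq : V A.≈ tA A.* PA.W V
V-eq = A.trans V-fixpoint.isFixpoint (RA.+-identityˡ _)

VB : B.Series
VB = B.constant V

VC : C.Series
VC = inner VB

W-constant : B.constant (PA.W V) B.≈ PB.W VB
W-constant = AB.natural (:1 :+ ((:1 :+ :1) :+ (:1 :+ :1)) :* (v :* v :* v)) (V ∷ [])
  where
  open SA
  v : Polynomial 1
  v = var zero

VB-eq : VB B.≈ tB B.* PB.W VB
VB-eq = B.trans (B.constant-cong V-eq) (B.trans (*-homo _ _) (RB.*-congˡ W-constant))
  where open IsRingHomomorphism B.constant-isRingHomomorphism

V₀ : V 0 ≡ 0ℚ
V₀ = ≡.trans (A.at V-eq 0) (A.X*-zero _)

regular-1 : ∀ {c ℓ} (R : CommutativeRing c ℓ) → Regular R (CommutativeRing.1# R)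
regular-1 R s p = CommutativeRing.trans R (CommutativeRing.sym R (CommutativeRing.*-identityˡ R s)) p

W-regularA : Regular A.ring (PA.W V)
W-regularA = A.regular _ (LQ.regular-cong (≡.sym W₀) (regular-1 ℚ-ring))
  where
  W₀ : PA.W V 0 ≡ 1ℚ
  W₀ = ≡.trans (A.+-at A.1# (PA.four A.* V³) 0) (≡.trans (≡.cong (1ℚ ℚ.+_) V³₀) (ℚₚ.+-identityʳ 1ℚ))
    where
    V³ = V A.* V A.* V
    V³₀ : (PA.four A.* V³) 0 ≡ 0ℚ
    V³₀ = ≡.trans (A.*-zero PA.four V³) (≡.trans (≡.cong (PA.four 0 ℚ.*_)
      (≡.trans (A.*-zero (V A.* V) V) (≡.trans (≡.cong ((V A.* V) 0 ℚ.*_) V₀) (ℚₚ.*-zeroʳ ((V A.* V) 0)))))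
      (ℚₚ.*-zeroʳ (PA.four 0)))

W-regularB : Regular B.ring (PB.W VB)
W-regularB = LB.regular-cong W-constant (B.regular _ W-regularA)

-- The axis series R = W Θ, with R′ = (R - R(0)) / u, r₀ = R(0) and κ₀ the right-hand
-- side of the quadratic equation.
module σ-fixpoint = B.Fixpoint B.1# (PB.Σ′ VB)
  (B.+-nonExpansive (B.*-nonExpansive (B.const-nonExpansive _) B.id-nonExpansive)
    (B.*-nonExpansive (B.const-nonExpansive _) (B.*-nonExpansive B.id-nonExpansive B.id-nonExpansive)))

σ R′ R : B.Series
σ  = σ-fixpoint.fixpoint
R′ = PB.W VB B.* PB.Θ′ u VB σ

r₀ κ₀ : B.Series
r₀ = PB.W VB B.* PB.Θ₀ VB
κ₀ = B.1# B.- tB B.* tB B.* (PB.W VB B.* PB.Θ₁ VB)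

R  = r₀ B.+ u B.* R′

r₀A : A.Series
r₀A = PA.W V A.* PA.Θ₀ V

r₀-constant : B.constant r₀A B.≈ r₀
r₀-constant = AB.natural ((:1 :+ :4 :* (v :* v :* v)) :* (:1 :- (:1 :+ :1) :* (v :* v :* v))) (V ∷ [])
  where
  open SA
  v :4 : Polynomial 1
  v = var zero
  :4 = (:1 :+ :1) :+ (:1 :+ :1)

R-quadratic : (B.1# B.+ tB B.* u B.* R) B.* (B.1# B.- tB B.* u B.- tB B.* tB B.* R′) B.≈ κ₀
R-quadratic = PB.quadratic u tB VB σ VB-eq W-regularB σ-fixpoint.isFixpoint

-- The right-hand side of the quadratic equation does not depend on u, hence
-- inner κ₀ and outer κ₀ agree.
κC : C.Series
κC = C.1# C.- tC C.* tC C.* (PC.W VC C.* PC.Θ₁ VC)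

outer-constant : ∀ f → outer (B.constant f) C.≈ inner (B.constant f)
outer-constant = Outer.map-constant

module _ where
  open SB
  private
    :2 :4 : ∀ {n} → Polynomial n
    :2 = :1 :+ :1
    :4 = :2 :+ :2
    K-poly : Polynomial 2
    K-poly = :1 :- t′ :* t′ :* ((:1 :+ :4 :* (v :* v :* v)) :*
      (v :- (:4 :- :1) :* (v :* v :* v :* v) :- v :* v :* v :* v :* v :* v :* v))
      where
      t′ v : Polynomial 2
      v  = var zero
      t′ = var (suc zero)
    quadratic-poly : Polynomial 4
    quadratic-poly = (:1 :+ t′ :* x′ :* (r′ :+ x′ :* a′)) :* (:1 :- t′ :* x′ :- t′ :* t′ :* a′)
      where
      t′ x′ r′ a′ : Polynomial 4
      t′ = var zero
      x′ = var (suc zero)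
      r′ = var (suc (suc zero))
      a′ = var (suc (suc (suc zero)))
  inner-κ : inner κ₀ C.≈ κC
  inner-κ = BC.natural K-poly (VB ∷ tB ∷ [])

  outer-κ : outer κ₀ C.≈ inner κ₀
  outer-κ = C.trans (OuterNat.natural K-poly (VB ∷ tB ∷ []))
    (C.trans (RC.+-congˡ (C.-‿cong (RC.*-cong (RC.*-cong t≈ t≈)
      (RC.*-cong (RC.+-congˡ (RC.*-congˡ V³)) (RC.+-cong (RC.+-cong V≈ (C.-‿cong (RC.*-congˡ V⁴)))
        (C.-‿cong (RC.*-cong (RC.*-cong (RC.*-cong V⁴ V≈) V≈) V≈)))))))
      (C.sym inner-κ))
    where
    t≈ = outer-constant tA
    V≈ = outer-constant V
    V³ = RC.*-cong (RC.*-cong V≈ V≈) V≈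
    V⁴ = RC.*-cong V³ V≈

  inner-quadratic :
    (C.1# C.+ tC C.* x₁ C.* (inner r₀ C.+ x₁ C.* inner R′)) C.* (C.1# C.- tC C.* x₁ C.- tC C.* tC C.* inner R′)
    C.≈ inner κ₀
  inner-quadratic = C.trans (C.sym (BC.natural quadratic-poly (tB ∷ u ∷ r₀ ∷ R′ ∷ [])))
    (C.constant-cong R-quadratic)

  outer-quadratic :
    (C.1# C.+ tC C.* x₂ C.* (inner r₀ C.+ x₂ C.* outer R′)) C.* (C.1# C.- tC C.* x₂ C.- tC C.* tC C.* outer R′)
    C.≈ inner κ₀
  outer-quadratic = C.trans (C.sym (C.trans (OuterNat.natural quadratic-poly (tB ∷ u ∷ r₀ ∷ R′ ∷ []))
    (RC.*-cong (RC.+-congˡ (RC.*-cong (RC.*-cong t≈ x≈) (RC.+-cong r≈ (RC.*-congʳ x≈))))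
      (RC.+-cong (RC.+-congˡ (C.-‿cong (RC.*-cong t≈ x≈))) (C.-‿cong (RC.*-congʳ (RC.*-cong t≈ t≈)))))))
    (C.trans (IsRingHomomorphism.⟦⟧-cong Outer.map-isRingHomomorphism R-quadratic) outer-κ)
    where
    t≈ = outer-constant tA
    x≈ = Outer.map-X
    r≈ : outer r₀ C.≈ inner r₀
    r≈ = C.trans (IsRingHomomorphism.⟦⟧-cong Outer.map-isRingHomomorphism (B.sym r₀-constant))
      (C.trans (outer-constant r₀A) (C.constant-cong r₀-constant))

-- The divided difference (f(x₁) - f(x₂)) / (x₁ - x₂).
Δ : B.Series → C.Series
Δ f j i = f (suc (i ℕ.+ j))

Δ-zero : ∀ f → Δ f 0 B.≈ B.tail f
Δ-zero f = B.ext λ i → RA.reflexive (≡.cong (λ n → f (suc n)) (ℕₚ.+-identityʳ i))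

Δ-property : ∀ f → (x₁ C.- x₂) C.* Δ f C.≈ inner f C.- outer f
Δ-property f = LC.combine₁ lemma C.1# (solve 5 (λ x y d a b →
    (x :- y) :* d :- (a :- b) := :1 :* (x :* d :+ b :- (y :* d :+ a))) C.refl x₁ x₂ (Δ f) (inner f) (outer f))
  where
  open SC
  open SetoidReasoning B.setoid
  lemma : x₁ C.* Δ f C.+ outer f C.≈ x₂ C.* Δ f C.+ inner f
  lemma = C.ext λ
    { zero → begin
      (x₁ C.* Δ f C.+ outer f) 0                 ≈⟨ C.+-at _ _ 0 ⟩
      (x₁ C.* Δ f) 0 B.+ B.constant (f 0)        ≈⟨ RB.+-congʳ (C.constant-·-at u (Δ f) 0) ⟩
      u B.* Δ f 0 B.+ B.constant (f 0)           ≈⟨ RB.+-congʳ (RB.*-congˡ (Δ-zero f)) ⟩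
      u B.* B.tail f B.+ B.constant (f 0)        ≈⟨ RB.+-comm _ _ ⟩
      B.constant (f 0) B.+ u B.* B.tail f        ≈⟨ B.constant+X*tail f ⟨
      f                                          ≈⟨ RB.+-identityˡ f ⟨
      B.0# B.+ f                                 ≈⟨ RB.+-congʳ (C.X*-zero (Δ f)) ⟨
      (x₂ C.* Δ f) 0 B.+ f                       ≈⟨ C.+-at _ _ 0 ⟨
      (x₂ C.* Δ f C.+ inner f) 0                 ∎
    ; (suc j) → begin
      (x₁ C.* Δ f C.+ outer f) (suc j)                   ≈⟨ C.+-at _ _ (suc j) ⟩
      (x₁ C.* Δ f) (suc j) B.+ B.constant (f (suc j))    ≈⟨ RB.+-congʳ (C.constant-·-at u (Δ f) (suc j)) ⟩
      u B.* Δ f (suc j) B.+ B.constant (f (suc j))       ≈⟨ RB.+-congʳ (RB.*-congˡ (B.ext λ i →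
        RA.reflexive (≡.cong (λ n → f (suc n)) (ℕₚ.+-suc i j)))) ⟩
      u B.* B.tail (Δ f j) B.+ B.constant (f (suc j))    ≈⟨ RB.+-comm _ _ ⟩
      B.constant (f (suc j)) B.+ u B.* B.tail (Δ f j)    ≈⟨ B.constant+X*tail (Δ f j) ⟨
      Δ f j                                              ≈⟨ RB.+-identityʳ _ ⟨
      Δ f j B.+ B.0#                                     ≈⟨ RB.+-congʳ (C.X*-suc (Δ f) j) ⟨
      (x₂ C.* Δ f) (suc j) B.+ B.0#                      ≈⟨ C.+-at _ _ (suc j) ⟨
      (x₂ C.* Δ f C.+ inner f) (suc j)                   ∎
    }

-- Q = Δ(u R) + t x₁ x₂ Q Δ(R), the series of all walks in the quarter plane.
module Q-fixpoint = C.Fixpoint (Δ (u B.* R)) (λ Q → tC C.* (x₁ C.* (Q C.* Δ R)))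
  (C.*-nonExpansive (C.const-nonExpansive tC) (C.*-nonExpansive (C.const-nonExpansive x₁)
    (C.*-nonExpansive C.id-nonExpansive (C.const-nonExpansive (Δ R)))))

Q : C.Series
Q = Q-fixpoint.fixpoint

module HI = IsRingHomomorphism C.constant-isRingHomomorphism
module HO = IsRingHomomorphism Outer.map-isRingHomomorphism

outer-r₀ : outer r₀ C.≈ inner r₀
outer-r₀ = C.trans (HO.⟦⟧-cong (B.sym r₀-constant))
  (C.trans (outer-constant r₀A) (C.constant-cong r₀-constant))

inner-R : inner R C.≈ inner r₀ C.+ x₁ C.* inner R′
inner-R = C.trans (HI.+-homo _ _) (RC.+-congˡ (HI.*-homo _ _))

outer-R : outer R C.≈ inner r₀ C.+ x₂ C.* outer R′
outer-R = C.trans (HO.+-homo _ _) (C.+-cong outer-r₀ (C.trans (HO.*-homo _ _) (RC.*-congʳ Outer.map-X)))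

t-regular : Regular C.ring tC
t-regular = C.regular _ (B.regular _ A.X-regular)

functional-equation :
  x₁ C.* (x₂ C.* Q) C.+ tC C.* (inner R C.+ outer R)
  C.≈ x₁ C.* x₂ C.+ tC C.* (x₁ C.* (x₁ C.* (x₂ C.* Q)) C.+ x₂ C.* (x₁ C.* (x₂ C.* Q)) C.+ Q C.+ inner r₀)
functional-equation = C.trans (RC.+-congˡ (RC.*-congˡ (C.+-cong inner-R outer-R)))
  (PC.functional x₁ x₂ tC (inner r₀) (inner R′) (outer R′) (inner κ₀) (Δ R) (Δ (u B.* R)) Q
    inner-quadratic outer-quadratic
    (C.trans (Δ-property R) (C.+-cong inner-R (C.-‿cong outer-R)))
    (C.trans (Δ-property (u B.* R)) (C.+-cong
      (C.trans (HI.*-homo _ _) (RC.*-congˡ inner-R))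
      (C.-‿cong (C.trans (HO.*-homo _ _) (RC.*-cong Outer.map-X outer-R)))))
    (C.trans Q-fixpoint.isFixpoint (RC.+-congˡ (solve 5 (λ x y t Q d →
      y :* (t :* (x :* (Q :* d))) := t :* (x :* (y :* (Q :* d)))) C.refl x₁ x₂ tC Q (Δ R))))
    t-regular
    (C.regular _ (LB.regular-cong (B.sym (B.trans (C.+-at x₁ (C.- x₂) 0)
      (B.trans (RB.+-congˡ (B.trans (C.-‿at x₂ 0) -0#≈0#)) (RB.+-identityʳ u)))) B.X-regular))
    (C.regular _ (LB.regular-cong (B.sym (B.trans (C.+-at _ _ 0) (B.trans (RB.+-congˡ
      (B.trans (C.-‿at _ 0) (B.trans (B.-‿cong (B.trans (C.*-zero _ _)
        (B.trans (RB.*-congʳ (B.trans (C.*-zero _ _) (RB.zeroʳ _))) (RB.zeroˡ _)))) -0#≈0#)))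
        (RB.+-identityʳ B.1#)))) (regular-1 B.ring))))
  where
  open SC
  open RingProperties RB.ring using (-0#≈0#)

-- Identification with the counting sequences

-- The coefficients of sums and of multiples of t, u, x₁ and x₂.
A-zero : ∀ m → A.0# m ≡ 0ℚ
A-zero zero    = ≡.refl
A-zero (suc _) = ≡.refl

B-zero : ∀ i m → B.0# i m ≡ 0ℚ
B-zero zero    m = A-zero m
B-zero (suc _) m = A-zero m

B-+ : ∀ f g i m → (f B.+ g) i m ≡ f i m ℚ.+ g i m
B-+ f g i m = ≡.trans (A.at (B.+-at f g i) m) (A.+-at (f i) (g i) m)

B-t-zero : ∀ f i → (tB B.* f) i 0 ≡ 0ℚ
B-t-zero f i = ≡.trans (A.at (B.constant-·-at tA f i) 0) (A.X*-zero (f i))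

B-t-suc : ∀ f i m → (tB B.* f) i (suc m) ≡ f i m
B-t-suc f i m = ≡.trans (A.at (B.constant-·-at tA f i) (suc m)) (A.X*-suc (f i) m)

B-u-zero : ∀ f m → (u B.* f) 0 m ≡ 0ℚ
B-u-zero f m = ≡.trans (A.at (B.X*-zero f) m) (A-zero m)

B-u-suc : ∀ f i m → (u B.* f) (suc i) m ≡ f i m
B-u-suc f i m = A.at (B.X*-suc f i) m

C-+ : ∀ f g j i m → (f C.+ g) j i m ≡ f j i m ℚ.+ g j i m
C-+ f g j i m = ≡.trans (A.at (B.at (C.+-at f g j) i) m) (B-+ (f j) (g j) i m)

C-t-zero : ∀ f j i → (tC C.* f) j i 0 ≡ 0ℚ
C-t-zero f j i = ≡.trans (A.at (B.at (C.constant-·-at tB f j) i) 0) (B-t-zero (f j) i)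

C-t-suc : ∀ f j i m → (tC C.* f) j i (suc m) ≡ f j i m
C-t-suc f j i m = ≡.trans (A.at (B.at (C.constant-·-at tB f j) i) (suc m)) (B-t-suc (f j) i m)

C-x₁-zero : ∀ f j m → (x₁ C.* f) j 0 m ≡ 0ℚ
C-x₁-zero f j m = ≡.trans (A.at (B.at (C.constant-·-at u f j) 0) m) (B-u-zero (f j) m)

C-x₁-suc : ∀ f j i m → (x₁ C.* f) j (suc i) m ≡ f j i m
C-x₁-suc f j i m = ≡.trans (A.at (B.at (C.constant-·-at u f j) (suc i)) m) (B-u-suc (f j) i m)

C-x₂-zero : ∀ f i m → (x₂ C.* f) 0 i m ≡ 0ℚ
C-x₂-zero f i m = ≡.trans (A.at (B.at (C.X*-zero f) i) m) (B-zero i m)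

C-x₂-suc : ∀ f j i m → (x₂ C.* f) (suc j) i m ≡ f j i m
C-x₂-suc f j i m = A.at (B.at (C.X*-suc f j) i) m

fromℕ-k-suc : ∀ m i j → fromℕ (k (suc m) i j) ≡
  fromℕ (pre (λ a → k m a j) i) ℚ.+ fromℕ (pre (k m i) j) ℚ.+ fromℕ (k m (suc i) (suc j))
fromℕ-k-suc m i j = ≡.trans (≡.cong fromℕ (k-suc m i j)) (≡.trans (fromℕ-+ a (b ℕ.+ c))
  (≡.trans (≡.cong (fromℕ a ℚ.+_) (fromℕ-+ b c)) (≡.sym (ℚₚ.+-assoc (fromℕ a) (fromℕ b) (fromℕ c)))))
  where
  a b c : ℕ
  a = pre (λ a → k m a j) i
  b = pre (k m i) j
  c = k m (suc i) (suc j)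

-- The coefficient of x₁^(i+1) x₂^(j+1) in the functional equation is the recurrence
-- by the last step; the axis terms do not contribute to it.
Q-coefficient : ∀ m j i → Q j i m ≡ fromℕ (k m i j)
Q-coefficient m j i = ≡.trans (≡.sym left) (≡.trans (A.at (B.at (C.at functional-equation (suc j)) (suc i)) m) (right m))
  where
  open ≡.≡-Reasoning
  E = x₁ C.* (x₁ C.* (x₂ C.* Q))
  N = x₂ C.* (x₁ C.* (x₂ C.* Q))
  F = E C.+ N C.+ Q C.+ inner r₀
  no-t : ∀ m → (tC C.* (inner R C.+ outer R)) (suc j) (suc i) m ≡ 0ℚ
  no-t zero    = C-t-zero _ (suc j) (suc i)
  no-t (suc m) = ≡.trans (C-t-suc _ (suc j) (suc i) m) (≡.trans (C-+ _ _ (suc j) (suc i) m)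
    (≡.cong₂ ℚ._+_ (B-zero (suc i) m) (A-zero m)))
  left : (x₁ C.* (x₂ C.* Q) C.+ tC C.* (inner R C.+ outer R)) (suc j) (suc i) m ≡ Q j i m
  left = ≡.trans (C-+ _ _ (suc j) (suc i) m) (≡.trans (≡.cong₂ ℚ._+_
    (≡.trans (C-x₁-suc _ (suc j) i m) (C-x₂-suc Q j i m)) (no-t m)) (ℚₚ.+-identityʳ _))
  one : ∀ j i m → x₂ (suc j) i m ≡ fromℕ (δ 0 i ℕ.* δ 0 j ℕ.* δ 0 m)
  one zero    zero    zero    = ≡.refl
  one zero    zero    (suc m) = ≡.refl
  one zero    (suc i) m       = A-zero m
  one (suc j) zero    m       = A-zero m
  one (suc j) (suc i) m       = A-zero m
  east-step : ∀ i m → (x₁ C.* (x₁ C.* (x₂ C.* Q))) (suc j) (suc i) m ≡ fromℕ (pre (λ a → k m a j) i)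
  east-step zero    m = ≡.trans (C-x₁-suc _ (suc j) zero m) (C-x₁-zero _ (suc j) m)
  east-step (suc i) m = ≡.trans (C-x₁-suc _ (suc j) (suc i) m) (≡.trans (C-x₁-suc _ (suc j) i m)
    (≡.trans (C-x₂-suc Q j i m) (Q-coefficient m j i)))
  north-step : ∀ j m → (x₂ C.* (x₁ C.* (x₂ C.* Q))) (suc j) (suc i) m ≡ fromℕ (pre (k m i) j)
  north-step j m = ≡.trans (C-x₂-suc _ j (suc i) m) (≡.trans (C-x₁-suc _ j i m) (go j))
    where
    go : ∀ j → (x₂ C.* Q) j i m ≡ fromℕ (pre (k m i) j)
    go zero    = C-x₂-zero Q i m
    go (suc j) = ≡.trans (C-x₂-suc Q j i m) (Q-coefficient m j i)
  right : ∀ m → (x₁ C.* x₂ C.+ tC C.* F) (suc j) (suc i) m ≡ fromℕ (k m i j)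
  right zero = ≡.trans (C-+ _ _ (suc j) (suc i) 0) (≡.trans (≡.cong₂ ℚ._+_
    (≡.trans (C-x₁-suc x₂ (suc j) i 0) (one j i 0)) (C-t-zero F (suc j) (suc i)))
    (≡.trans (ℚₚ.+-identityʳ _) (≡.cong fromℕ (≡.trans (ℕₚ.*-identityʳ _) (≡.sym (k-zero i j))))))
  right (suc m) = begin
    (x₁ C.* x₂ C.+ tC C.* F) (suc j) (suc i) (suc m)
      ≡⟨ C-+ _ _ (suc j) (suc i) (suc m) ⟩
    (x₁ C.* x₂) (suc j) (suc i) (suc m) ℚ.+ (tC C.* F) (suc j) (suc i) (suc m)
      ≡⟨ ≡.cong₂ ℚ._+_ (≡.trans (C-x₁-suc x₂ (suc j) i (suc m)) (≡.trans (one j i (suc m))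
           (≡.cong fromℕ (ℕₚ.*-zeroʳ (δ 0 i ℕ.* δ 0 j))))) (C-t-suc F (suc j) (suc i) m) ⟩
    0ℚ ℚ.+ F (suc j) (suc i) m
      ≡⟨ ℚₚ.+-identityˡ _ ⟩
    F (suc j) (suc i) m
      ≡⟨ C-+ (E C.+ N C.+ Q) (inner r₀) (suc j) (suc i) m ⟩
    (E C.+ N C.+ Q) (suc j) (suc i) m ℚ.+ B.0# (suc i) m
      ≡⟨ ≡.cong₂ ℚ._+_ (C-+ (E C.+ N) Q (suc j) (suc i) m) (B-zero (suc i) m) ⟩
    (E C.+ N) (suc j) (suc i) m ℚ.+ Q (suc j) (suc i) m ℚ.+ 0ℚ
      ≡⟨ ℚₚ.+-identityʳ _ ⟩
    (E C.+ N) (suc j) (suc i) m ℚ.+ Q (suc j) (suc i) m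
      ≡⟨ ≡.cong₂ ℚ._+_ (≡.trans (C-+ E N (suc j) (suc i) m) (≡.cong₂ ℚ._+_ (east-step i m) (north-step j m)))
           (Q-coefficient m (suc j) (suc i)) ⟩
    fromℕ (pre (λ a → k m a j) i) ℚ.+ fromℕ (pre (k m i) j) ℚ.+ fromℕ (k m (suc i) (suc j))
      ≡⟨ fromℕ-k-suc m i j ⟨
    fromℕ (k (suc m) i j) ∎

-- At x₂ = 0 the equation of Q reads Q = R.
R-coefficient : ∀ i m → R i m ≡ fromℕ (k m i 0)
R-coefficient i m = begin
  R i m                                      ≡⟨ B-u-suc R i m ⟨
  B.tail (u B.* R) i m                       ≡⟨ A.at (B.at (Δ-zero (u B.* R)) i) m ⟨
  Δ (u B.* R) 0 i m                          ≡⟨ ℚₚ.+-identityʳ _ ⟨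
  Δ (u B.* R) 0 i m ℚ.+ 0ℚ                   ≡⟨ ≡.cong (Δ (u B.* R) 0 i m ℚ.+_) (C-x₂-zero _ i m) ⟨
  Δ (u B.* R) 0 i m ℚ.+ (x₂ C.* _) 0 i m     ≡⟨ C-+ _ _ 0 i m ⟨
  (Δ (u B.* R) C.+ x₂ C.* _) 0 i m           ≡⟨ A.at (B.at (C.at Q-fixpoint.isFixpoint 0) i) m ⟨
  Q 0 i m                                    ≡⟨ Q-coefficient m 0 i ⟩
  fromℕ (k m i 0)                            ∎
  where open ≡.≡-Reasoning

-- Walks ending on the diagonal, marked by u according to the endpoint (j , j).
D : B.Series
D j m = fromℕ (k m j j)

-- Walks ending at (d + 1 + j , j), below the diagonal, marked by x₁^j x₂^d.
L : C.Series
L d j m = fromℕ (k m (suc d ℕ.+ j) j)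

-- The last step of a walk to the diagonal; the two steps from either side of the
-- diagonal contribute equally by symmetry.
D-equation : u B.* D B.+ tB B.* B.constant (R 0)
             B.≈ u B.+ tB B.* (u B.* (u B.* L 0) B.+ u B.* (u B.* L 0)) B.+ tB B.* D
D-equation = B.ext λ j → A.ext λ m → ≡.trans (B-+ _ _ j m) (≡.trans (go j m) (≡.sym
  (≡.trans (B-+ _ _ j m) (≡.cong (ℚ._+ (tB B.* D) j m) (B-+ _ _ j m)))))
  where
  open ≡.≡-Reasoning
  F = u B.* (u B.* L 0) B.+ u B.* (u B.* L 0)
  uu : ∀ j m → (u B.* (u B.* L 0)) (suc j) m ≡ fromℕ (pre (k m j) j)
  uu zero    m = ≡.trans (B-u-suc _ 0 m) (B-u-zero (L 0) m)
  uu (suc j) m = ≡.trans (B-u-suc _ (suc j) m) (B-u-suc (L 0) j m)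
  pre-sym : ∀ m j → pre (λ a → k m a j) j ≡ pre (k m j) j
  pre-sym m zero    = ≡.refl
  pre-sym m (suc j) = k-sym m j (suc j)
  u-at : ∀ j m → u (suc j) m ≡ fromℕ (δ 0 j ℕ.* δ 0 m)
  u-at zero    zero    = ≡.refl
  u-at zero    (suc m) = ≡.refl
  u-at (suc j) m       = A-zero m
  go : ∀ j m → (u B.* D) j m ℚ.+ (tB B.* B.constant (R 0)) j m
       ≡ u j m ℚ.+ (tB B.* F) j m ℚ.+ (tB B.* D) j m
  go zero zero = ≡.cong₂ ℚ._+_ (B-u-zero D 0) (B-t-zero _ 0) ⟨ ≡.trans ⟩ ≡.sym
    (≡.cong₂ ℚ._+_ (≡.cong₂ ℚ._+_ (≡.refl {x = 0ℚ}) (B-t-zero F 0)) (B-t-zero D 0))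
  go zero (suc m) = begin
    (u B.* D) 0 (suc m) ℚ.+ (tB B.* B.constant (R 0)) 0 (suc m)
      ≡⟨ ≡.cong₂ ℚ._+_ (B-u-zero D (suc m)) (≡.trans (B-t-suc _ 0 m) (R-coefficient 0 m)) ⟩
    0ℚ ℚ.+ D 0 m
      ≡⟨ ≡.cong₂ ℚ._+_ (≡.cong (0ℚ ℚ.+_) (≡.trans (B-t-suc F 0 m) (≡.trans (B-+ _ _ 0 m)
           (≡.cong₂ ℚ._+_ (B-u-zero _ m) (B-u-zero _ m))))) (B-t-suc D 0 m) ⟨
    0ℚ ℚ.+ (tB B.* F) 0 (suc m) ℚ.+ (tB B.* D) 0 (suc m) ∎
  go (suc j) zero = begin
    (u B.* D) (suc j) 0 ℚ.+ (tB B.* B.constant (R 0)) (suc j) 0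
      ≡⟨ ≡.cong₂ ℚ._+_ (≡.trans (B-u-suc D j 0) (≡.cong fromℕ (k-zero j j))) (B-t-zero _ (suc j)) ⟩
    fromℕ (δ 0 j ℕ.* δ 0 j) ℚ.+ 0ℚ
      ≡⟨ ≡.cong (ℚ._+ 0ℚ) (≡.trans (≡.cong fromℕ (δ² j)) (≡.sym (ℚₚ.+-identityʳ _))) ⟩
    fromℕ (δ 0 j ℕ.* 1) ℚ.+ 0ℚ ℚ.+ 0ℚ
      ≡⟨ ≡.cong₂ ℚ._+_ (≡.cong₂ ℚ._+_ (u-at j 0) (B-t-zero F (suc j))) (B-t-zero D (suc j)) ⟨
    u (suc j) 0 ℚ.+ (tB B.* F) (suc j) 0 ℚ.+ (tB B.* D) (suc j) 0 ∎
    where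
    δ² : ∀ j → δ 0 j ℕ.* δ 0 j ≡ δ 0 j ℕ.* 1
    δ² zero    = ≡.refl
    δ² (suc j) = ≡.refl
  go (suc j) (suc m) = begin
    (u B.* D) (suc j) (suc m) ℚ.+ (tB B.* B.constant (R 0)) (suc j) (suc m)
      ≡⟨ ≡.cong₂ ℚ._+_ (B-u-suc D j (suc m)) (≡.trans (B-t-suc _ (suc j) m) (A-zero m)) ⟩
    D j (suc m) ℚ.+ 0ℚ
      ≡⟨ ≡.trans (ℚₚ.+-identityʳ _) (fromℕ-k-suc m j j) ⟩
    fromℕ (pre (λ a → k m a j) j) ℚ.+ fromℕ (pre (k m j) j) ℚ.+ D (suc j) m
      ≡⟨ ≡.cong (ℚ._+ D (suc j) m) (≡.trans (≡.cong (ℚ._+ fromℕ (pre (k m j) j)) (≡.cong fromℕ (pre-sym m j)))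
           (≡.sym (ℚₚ.+-identityˡ _))) ⟩
    0ℚ ℚ.+ (fromℕ (pre (k m j) j) ℚ.+ fromℕ (pre (k m j) j)) ℚ.+ D (suc j) m
      ≡⟨ ≡.cong₂ ℚ._+_ (≡.cong₂ ℚ._+_ (≡.trans (u-at j (suc m)) (≡.cong fromℕ (ℕₚ.*-zeroʳ (δ 0 j))))
           (≡.trans (B-t-suc F (suc j) m) (≡.trans (B-+ _ _ (suc j) m) (≡.cong₂ ℚ._+_ (uu j m) (uu j m)))))
           (B-t-suc D (suc j) m) ⟨
    u (suc j) (suc m) ℚ.+ (tB B.* F) (suc j) (suc m) ℚ.+ (tB B.* D) (suc j) (suc m) ∎

-- The last step of a walk to a point below the diagonal.
L-equation : x₁ C.* L C.+ tC C.* outer (B.tail R)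
             C.≈ tC C.* (x₁ C.* (inner D C.+ x₂ C.* L) C.+ x₁ C.* (x₁ C.* C.tail L) C.+ L)
L-equation = C.ext λ d → B.ext λ j → A.ext λ m → ≡.trans (C-+ _ _ d j m) (go d j m)
  where
  open ≡.≡-Reasoning
  Y = inner D C.+ x₂ C.* L
  F = x₁ C.* Y C.+ x₁ C.* (x₁ C.* C.tail L) C.+ L
  Y-at : ∀ d j m → Y d j m ≡ fromℕ (k m (d ℕ.+ j) j)
  Y-at zero    j m = ≡.trans (C-+ _ _ 0 j m) (≡.trans (≡.cong (D j m ℚ.+_) (C-x₂-zero L j m)) (ℚₚ.+-identityʳ _))
  Y-at (suc d) j m = ≡.trans (C-+ _ _ (suc d) j m) (≡.trans (≡.cong₂ ℚ._+_ (B-zero j m) (C-x₂-suc L d j m)) (ℚₚ.+-identityˡ _))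
  F-at : ∀ d j m → F d j m ≡ (x₁ C.* Y) d j m ℚ.+ (x₁ C.* (x₁ C.* C.tail L)) d j m ℚ.+ L d j m
  F-at d j m = ≡.trans (C-+ _ _ d j m) (≡.cong (ℚ._+ L d j m) (C-+ _ _ d j m))
  tail-at : ∀ d j m → (x₁ C.* (x₁ C.* C.tail L)) d (suc j) m ≡ fromℕ (pre (k m (suc d ℕ.+ j)) j)
  tail-at d zero    m = ≡.trans (C-x₁-suc _ d 0 m) (C-x₁-zero _ d m)
  tail-at d (suc j) m = ≡.trans (C-x₁-suc _ d (suc j) m) (≡.trans (C-x₁-suc _ d j m)
    (≡.cong (λ i → fromℕ (k m (suc i) j)) (≡.sym (ℕₚ.+-suc d j))))
  go : ∀ d j m → (x₁ C.* L) d j m ℚ.+ (tC C.* outer (B.tail R)) d j m ≡ (tC C.* F) d j m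
  go d zero zero = ≡.trans (≡.cong₂ ℚ._+_ (C-x₁-zero L d 0) (C-t-zero _ d 0)) (≡.sym (C-t-zero F d 0))
  go d zero (suc m) = begin
    (x₁ C.* L) d 0 (suc m) ℚ.+ (tC C.* outer (B.tail R)) d 0 (suc m)
      ≡⟨ ≡.cong₂ ℚ._+_ (C-x₁-zero L d (suc m)) (≡.trans (C-t-suc _ d 0 m) (≡.trans (R-coefficient (suc d) m)
           (≡.cong (λ i → fromℕ (k m (suc i) 0)) (≡.sym (ℕₚ.+-identityʳ d))))) ⟩
    0ℚ ℚ.+ L d 0 m
      ≡⟨ ≡.cong (ℚ._+ L d 0 m) (≡.cong₂ ℚ._+_ (C-x₁-zero Y d m) (C-x₁-zero _ d m)) ⟨
    (x₁ C.* Y) d 0 m ℚ.+ (x₁ C.* (x₁ C.* C.tail L)) d 0 m ℚ.+ L d 0 m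
      ≡⟨ F-at d 0 m ⟨
    F d 0 m
      ≡⟨ C-t-suc F d 0 m ⟨
    (tC C.* F) d 0 (suc m) ∎
  go d (suc j) zero = ≡.trans (≡.cong₂ ℚ._+_
    (≡.trans (C-x₁-suc L d j 0) (≡.cong fromℕ (k-zero (suc d ℕ.+ j) j))) (C-t-zero _ d (suc j)))
    (≡.sym (C-t-zero F d (suc j)))
  go d (suc j) (suc m) = begin
    (x₁ C.* L) d (suc j) (suc m) ℚ.+ (tC C.* outer (B.tail R)) d (suc j) (suc m)
      ≡⟨ ≡.cong₂ ℚ._+_ (C-x₁-suc L d j (suc m)) (≡.trans (C-t-suc _ d (suc j) m) (A-zero m)) ⟩
    L d j (suc m) ℚ.+ 0ℚ
      ≡⟨ ≡.trans (ℚₚ.+-identityʳ _) (fromℕ-k-suc m (suc d ℕ.+ j) j) ⟩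
    fromℕ (k m (d ℕ.+ j) j) ℚ.+ fromℕ (pre (k m (suc d ℕ.+ j)) j) ℚ.+ fromℕ (k m (suc (suc d ℕ.+ j)) (suc j))
      ≡⟨ ≡.cong₂ ℚ._+_ (≡.cong₂ ℚ._+_ (≡.trans (C-x₁-suc Y d j m) (Y-at d j m)) (tail-at d j m))
           (≡.cong (λ i → fromℕ (k m (suc i) (suc j))) (ℕₚ.+-suc d j)) ⟨
    (x₁ C.* Y) d (suc j) m ℚ.+ (x₁ C.* (x₁ C.* C.tail L)) d (suc j) m ℚ.+ L d (suc j) m
      ≡⟨ F-at d (suc j) m ⟨
    F d (suc j) m
      ≡⟨ C-t-suc F d (suc j) m ⟨
    (tC C.* F) d (suc j) (suc m) ∎

-- The kernel method for the diagonal

-- The kernel of the wedge equation.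
κ : C.Series
κ = x₁ C.* x₂ C.- tC C.* (x₂ C.* x₂ C.* x₁ C.+ x₁ C.* x₁ C.+ x₂)

-- If x₂² f is divisible by the kernel and f does not involve x₂, then f = 0. The
-- equation expresses x₁ times each coefficient of N of degree at least 2 in x₂
-- through t times such coefficients and those of degrees 0 and 1, which vanish by
-- the term t x₁² of the kernel. Hence all coefficients of N vanish, by induction
-- on the degree in t.
kernel-method : ∀ N f → κ C.* N C.≈ x₂ C.* (x₂ C.* inner f) → f B.≈ B.0#
kernel-method N f hyp = B.zero-ext λ j → A.zero-ext λ m → f≡0 j m
  where
  open ≡.≡-Reasoning
  G = x₂ C.* (x₂ C.* (x₁ C.* N)) C.+ x₁ C.* (x₁ C.* N) C.+ x₂ C.* N
  positive : x₂ C.* (x₁ C.* N) C.≈ x₂ C.* (x₂ C.* inner f) C.+ tC C.* G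
  positive = LC.combine₁ hyp C.1# (solve 5 (λ x u t N f →
    x :* (u :* N) :- (x :* (x :* f) :+ t :* (x :* (x :* (u :* N)) :+ u :* (u :* N) :+ x :* N))
    := :1 :* ((u :* x :- t :* (x :* x :* u :+ u :* u :+ x)) :* N :- x :* (x :* f)))
    C.refl x₂ x₁ tC N (inner f))
    where open SC
  coefficient : ∀ d j m → (x₂ C.* (x₁ C.* N)) d j m ≡ (x₂ C.* (x₂ C.* inner f)) d j m ℚ.+ (tC C.* G) d j m
  coefficient d j m = ≡.trans (A.at (B.at (C.at positive d) j) m) (C-+ _ _ d j m)
  G-at : ∀ d j m → G d j m ≡ (x₂ C.* (x₂ C.* (x₁ C.* N))) d j m ℚ.+ (x₁ C.* (x₁ C.* N)) d j m ℚ.+ (x₂ C.* N) d j m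
  G-at d j m = ≡.trans (C-+ _ _ d j m) (≡.cong (ℚ._+ (x₂ C.* N) d j m) (C-+ _ _ d j m))
  x₁-vanish : ∀ {g : C.Series} {d m} → (∀ j → g d j m ≡ 0ℚ) → ∀ j → (x₁ C.* g) d j m ≡ 0ℚ
  x₁-vanish {g} {d} {m} p zero    = C-x₁-zero g d m
  x₁-vanish {g} {d} {m} p (suc j) = ≡.trans (C-x₁-suc g d j m) (p j)
  N₀≡0 : ∀ j m → N 0 j m ≡ 0ℚ
  N₀≡0 j m = begin
    N 0 j m
      ≡⟨ ≡.trans (≡.sym (C-x₁-suc N 0 j m)) (≡.sym (C-x₁-suc _ 0 (suc j) m)) ⟩
    (x₁ C.* (x₁ C.* N)) 0 (2 ℕ.+ j) m
      ≡⟨ ≡.trans (≡.sym (ℚₚ.+-identityˡ _)) (≡.sym (ℚₚ.+-identityʳ _)) ⟩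
    0ℚ ℚ.+ (x₁ C.* (x₁ C.* N)) 0 (2 ℕ.+ j) m ℚ.+ 0ℚ
      ≡⟨ ≡.cong₂ (λ a b → a ℚ.+ (x₁ C.* (x₁ C.* N)) 0 (2 ℕ.+ j) m ℚ.+ b) (C-x₂-zero _ (2 ℕ.+ j) m) (C-x₂-zero N (2 ℕ.+ j) m) ⟨
    _ ≡⟨ G-at 0 (2 ℕ.+ j) m ⟨
    G 0 (2 ℕ.+ j) m
      ≡⟨ ≡.trans (≡.sym (C-t-suc G 0 (2 ℕ.+ j) m)) (≡.sym (ℚₚ.+-identityˡ _)) ⟩
    0ℚ ℚ.+ (tC C.* G) 0 (2 ℕ.+ j) (suc m)
      ≡⟨ ≡.cong (ℚ._+ (tC C.* G) 0 (2 ℕ.+ j) (suc m)) (C-x₂-zero _ (2 ℕ.+ j) (suc m)) ⟨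
    _ ≡⟨ coefficient 0 (2 ℕ.+ j) (suc m) ⟨
    (x₂ C.* (x₁ C.* N)) 0 (2 ℕ.+ j) (suc m)
      ≡⟨ C-x₂-zero _ (2 ℕ.+ j) (suc m) ⟩
    0ℚ ∎
  N₁≡0 : ∀ j m → N 1 j m ≡ 0ℚ
  N₁≡0 j m = begin
    N 1 j m
      ≡⟨ ≡.trans (≡.sym (C-x₁-suc N 1 j m)) (≡.sym (C-x₁-suc _ 1 (suc j) m)) ⟩
    (x₁ C.* (x₁ C.* N)) 1 (2 ℕ.+ j) m
      ≡⟨ ≡.trans (≡.sym (ℚₚ.+-identityˡ _)) (≡.sym (ℚₚ.+-identityʳ _)) ⟩
    0ℚ ℚ.+ (x₁ C.* (x₁ C.* N)) 1 (2 ℕ.+ j) m ℚ.+ 0ℚ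
      ≡⟨ ≡.cong₂ (λ a b → a ℚ.+ (x₁ C.* (x₁ C.* N)) 1 (2 ℕ.+ j) m ℚ.+ b)
           (≡.trans (C-x₂-suc _ 0 (2 ℕ.+ j) m) (C-x₂-zero _ (2 ℕ.+ j) m))
           (≡.trans (C-x₂-suc N 0 (2 ℕ.+ j) m) (N₀≡0 (2 ℕ.+ j) m)) ⟨
    _ ≡⟨ G-at 1 (2 ℕ.+ j) m ⟨
    G 1 (2 ℕ.+ j) m
      ≡⟨ ≡.trans (≡.sym (C-t-suc G 1 (2 ℕ.+ j) m)) (≡.sym (ℚₚ.+-identityˡ _)) ⟩
    0ℚ ℚ.+ (tC C.* G) 1 (2 ℕ.+ j) (suc m)
      ≡⟨ ≡.cong (ℚ._+ (tC C.* G) 1 (2 ℕ.+ j) (suc m))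
           (≡.trans (C-x₂-suc _ 0 (2 ℕ.+ j) (suc m)) (C-x₂-zero _ (2 ℕ.+ j) (suc m))) ⟨
    _ ≡⟨ coefficient 1 (2 ℕ.+ j) (suc m) ⟨
    (x₂ C.* (x₁ C.* N)) 1 (2 ℕ.+ j) (suc m)
      ≡⟨ C-x₂-suc _ 0 (2 ℕ.+ j) (suc m) ⟩
    (x₁ C.* N) 0 (2 ℕ.+ j) (suc m)
      ≡⟨ x₁-vanish (λ j → N₀≡0 j (suc m)) (2 ℕ.+ j) ⟩
    0ℚ ∎
  N≡0 : ∀ m d j → N d j m ≡ 0ℚ
  G≡0 : ∀ m d j → G d j m ≡ 0ℚ
  tG≡0 : ∀ m d j → (tC C.* G) d j m ≡ 0ℚ
  G≡0 m d j = ≡.trans (G-at d j m) (≡.cong₂ ℚ._+_ (≡.cong₂ ℚ._+_ (xx d)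
    (x₁-vanish (x₁-vanish (N≡0 m d)) j)) (x d))
    where
    xx : ∀ d → (x₂ C.* (x₂ C.* (x₁ C.* N))) d j m ≡ 0ℚ
    xx zero          = C-x₂-zero _ j m
    xx (suc zero)    = ≡.trans (C-x₂-suc _ 0 j m) (C-x₂-zero _ j m)
    xx (suc (suc d)) = ≡.trans (C-x₂-suc _ (suc d) j m) (≡.trans (C-x₂-suc _ d j m)
      (x₁-vanish (N≡0 m d) j))
    x : ∀ d → (x₂ C.* N) d j m ≡ 0ℚ
    x zero    = C-x₂-zero N j m
    x (suc d) = ≡.trans (C-x₂-suc N d j m) (N≡0 m d j)
  tG≡0 zero    d j = C-t-zero G d j
  tG≡0 (suc m) d j = ≡.trans (C-t-suc G d j m) (G≡0 m d j)
  N≡0 m zero          j = N₀≡0 j m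
  N≡0 m (suc zero)    j = N₁≡0 j m
  N≡0 m (suc (suc d)) j = begin
    N (2 ℕ.+ d) j m
      ≡⟨ ≡.trans (≡.sym (C-x₁-suc N (2 ℕ.+ d) j m)) (≡.sym (C-x₂-suc _ (2 ℕ.+ d) (suc j) m)) ⟩
    (x₂ C.* (x₁ C.* N)) (3 ℕ.+ d) (suc j) m
      ≡⟨ coefficient (3 ℕ.+ d) (suc j) m ⟩
    (x₂ C.* (x₂ C.* inner f)) (3 ℕ.+ d) (suc j) m ℚ.+ (tC C.* G) (3 ℕ.+ d) (suc j) m
      ≡⟨ ≡.cong₂ ℚ._+_ (≡.trans (C-x₂-suc _ (2 ℕ.+ d) (suc j) m) (≡.trans (C-x₂-suc _ (1 ℕ.+ d) (suc j) m) (A-zero m)))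
           (tG≡0 m (3 ℕ.+ d) (suc j)) ⟩
    0ℚ ∎
  f≡0 : ∀ j m → f j m ≡ 0ℚ
  f≡0 j m = begin
    f j m
      ≡⟨ ≡.trans (≡.sym (C-x₂-suc _ 0 j m)) (≡.sym (C-x₂-suc _ 1 j m)) ⟩
    (x₂ C.* (x₂ C.* inner f)) 2 j m
      ≡⟨ ℚₚ.+-identityʳ _ ⟨
    (x₂ C.* (x₂ C.* inner f)) 2 j m ℚ.+ 0ℚ
      ≡⟨ ≡.cong ((x₂ C.* (x₂ C.* inner f)) 2 j m ℚ.+_) (tG≡0 m 2 j) ⟨
    _ ≡⟨ coefficient 2 j m ⟨
    (x₂ C.* (x₁ C.* N)) 2 j m
      ≡⟨ C-x₂-suc _ 1 j m ⟩
    (x₁ C.* N) 1 j m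
      ≡⟨ x₁-vanish (N≡0 m 1) j ⟩
    0ℚ ∎

-- e = t u² D - 1, and disc, g are the polynomials in t, u and r₀ that occur in the
-- quadratic equation disc e² = g² - 4 t u⁴ κ₀ of the diagonal series.
e g disc : B.Series
e    = tB B.* (u B.* u) B.* D B.- B.1#
g    = tB B.* (u B.* u B.* u) B.+ u B.- tB B.+ tB B.* tB B.* (u B.* u) B.* r₀
disc = (u B.- tB) B.* (u B.- tB) B.- PB.four B.* (tB B.* tB) B.* (u B.* u B.* u)

constant-R₀ : B.constant (R 0) B.≈ r₀
constant-R₀ = B.trans (B.constant-cong (A.trans (B.+-at _ _ 0) (A.trans (RA.+-congˡ (B.X*-zero _))
  (A.trans (RA.+-identityʳ _) (B.at (B.sym r₀-constant) 0))))) r₀-constant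

wedge-equation :
  PC.two C.* (κ C.* L) C.≈ (PC.two C.* (tC C.* x₂ C.* x₁) C.- x₁ C.+ tC) C.* inner D C.+ x₁
     C.- PC.two C.* (tC C.* (inner r₀ C.+ x₂ C.* outer R′)) C.+ tC C.* inner r₀
wedge-equation = PC.wedge D-equationC L-equation (C.constant+X*tail L)
  (C.trans (C.sym outer-R) (C.constant+X*tail (outer R))) (C.constant-cong (B.sym constant-R₀))
  where
  D-equationC : x₁ C.* inner D C.+ tC C.* inner (B.constant (R 0))
    C.≈ x₁ C.+ tC C.* (x₁ C.* (x₁ C.* inner (L 0)) C.+ x₁ C.* (x₁ C.* inner (L 0))) C.+ tC C.* inner D
  D-equationC = C.trans (C.sym (BC.natural (u′ :* d′ :+ t′ :* c′) ρ)) (C.trans (C.constant-cong D-equation)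
    (BC.natural (u′ :+ t′ :* (u′ :* (u′ :* l′) :+ u′ :* (u′ :* l′)) :+ t′ :* d′) ρ))
    where
    open SB
    ρ : Vec B.Series 5
    ρ = u ∷ tB ∷ D ∷ B.constant (R 0) ∷ L 0 ∷ []
    u′ t′ d′ c′ l′ : Polynomial 5
    u′ = var zero
    t′ = var (suc zero)
    d′ = var (suc (suc zero))
    c′ = var (suc (suc (suc zero)))
    l′ = var (suc (suc (suc (suc zero))))

D-quadratic : disc B.* (e B.* e) B.≈ g B.* g B.- PB.four B.* (tB B.* (u B.* u B.* (u B.* u)) B.* κ₀)
D-quadratic = LB.-≈0⇒≈ (kernel-method _ _ (C.trans
  (PC.eliminate x₂ x₁ tC (inner D) L (inner r₀) (outer R′) (inner κ₀) wedge-equation outer-quadratic)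
  (RC.*-congˡ (RC.*-congˡ (C.sym (BC.natural poly (tB ∷ u ∷ D ∷ r₀ ∷ κ₀ ∷ [])))))))
  where
  open SB
  poly : Polynomial 5
  poly = disc′ :* (e′ :* e′) :- (g′ :* g′ :- :4 :* (t′ :* (u′ :* u′ :* (u′ :* u′)) :* k′))
    where
    t′ u′ d′ r′ k′ e′ g′ disc′ :4 : Polynomial 5
    t′ = var zero
    u′ = var (suc zero)
    d′ = var (suc (suc zero))
    r′ = var (suc (suc (suc zero)))
    k′ = var (suc (suc (suc (suc zero))))
    :4 = (:1 :+ :1) :+ (:1 :+ :1)
    e′ = t′ :* (u′ :* u′) :* d′ :- :1
    g′ = t′ :* (u′ :* u′ :* u′) :+ u′ :- t′ :+ t′ :* t′ :* (u′ :* u′) :* r′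
    disc′ = (u′ :- t′) :* (u′ :- t′) :- :4 :* (t′ :* t′) :* (u′ :* u′ :* u′)

V-regularA : Regular A.ring V
V-regularA = LA.regular-cong (A.sym V-eq) (LA.regular-* A.X-regular W-regularA)

-- 1 - U² u / 2 - U u² / 2.
h : B.Series
h = B.1# B.- PB.two B.* (VB B.* VB) B.* u B.- VB B.* (u B.* u)

D-square : (B.1# B.- PB.four B.* (VB B.* VB) B.* u) B.* (e B.* e) B.≈ h B.* h
D-square = PB.factorise tB VB u D VB-eq D-quadratic (B.regular _ (LA.regular-cong (A.sym
  (A.trans (B.+-at _ _ 0) (A.trans (RA.+-cong (B.*-zero VB VB) (A.trans (B.-‿at _ 0)
    (A.trans (A.-‿cong (B.X*-zero _)) -0#≈0#))) (RA.+-identityʳ _)))) (LA.regular-* V-regularA V-regularA)))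
  where open RingProperties RA.ring using (-0#≈0#)

-- The inverse square root

-- The Euler operator θ = X d/dX, a derivation whose kernel consists of the
-- constants.
module Euler {c ℓ : Level} (R : CommutativeRing c ℓ) where
  private
    module R = CommutativeRing R
    module S = SeriesRing R
    module SX = CommutativeRing S.ring
    module PX = WalkIdentities S.ring
    module LX = LinearCombination S.ring
    open S using (_≈_; _+_; _*_; _-_; tail; X; constant)
  open SemiringMultiple R.semiring using () renaming (_×_ to _⋆_)

  # : ℕ → R.Carrier
  # n = n ⋆ R.1#

  θ : S.Series → S.Series
  θ f n = # n R.* f n

  θ-cong : ∀ {f g} → f ≈ g → θ f ≈ θ g
  θ-cong p = S.ext λ n → R.*-congˡ (S.at p n)

  tail-θ : ∀ f → tail (θ f) ≈ θ (tail f) + tail f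
  tail-θ f = S.ext λ n → R.trans
    (solve 2 (λ m a → (:1 :+ m) :* a := m :* a :+ a) R.refl (# n) (f (suc n)))
    (R.sym (S.+-at _ _ n))
    where open IntegerCoefficients R

  θ-* : ∀ f g → θ (f * g) ≈ θ f * g + f * θ g
  θ-* f g = S.ext λ n → go n f g
    where
    open SetoidReasoning R.setoid
    open IntegerCoefficients R
    go : ∀ n f g → θ (f * g) n R.≈ (θ f * g + f * θ g) n
    go zero f g = begin
      R.0# R.* (f * g) 0
        ≈⟨ solve 3 (λ a b p → :# 0 :* p := :# 0 :* a :* b :+ a :* (:# 0 :* b)) R.refl (f 0) (g 0) ((f * g) 0) ⟩
      R.0# R.* f 0 R.* g 0 R.+ f 0 R.* (R.0# R.* g 0)
        ≈⟨ R.+-cong (S.*-zero _ _) (S.*-zero _ _) ⟨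
      (θ f * g) 0 R.+ (f * θ g) 0
        ≈⟨ S.+-at _ _ 0 ⟨
      (θ f * g + f * θ g) 0 ∎
    go (suc n) f g = begin
      # (suc n) R.* (f * g) (suc n)
        ≈⟨ R.*-congˡ (S.*-suc f g n) ⟩
      (R.1# R.+ # n) R.* (f 0 R.* g (suc n) R.+ (tail f * g) n)
        ≈⟨ solve 4 (λ m a b p → (:1 :+ m) :* (a :* b :+ p) := a :* ((:1 :+ m) :* b) :+ (p :+ m :* p))
             R.refl (# n) (f 0) (g (suc n)) ((tail f * g) n) ⟩
      f 0 R.* θ g (suc n) R.+ ((tail f * g) n R.+ θ (tail f * g) n)
        ≈⟨ R.+-congˡ (R.+-congˡ (R.trans (go n (tail f) g) (S.+-at _ _ n))) ⟩
      f 0 R.* θ g (suc n) R.+ ((tail f * g) n R.+ ((θ (tail f) * g) n R.+ (tail f * θ g) n))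
        ≈⟨ solve 5 (λ a b p q r → a :+ (p :+ (q :+ r)) := (:# 0 :* b :* :1 :+ (q :+ p)) :+ (a :+ r))
             R.refl _ (f 0) _ _ _ ⟩
      (R.0# R.* f 0 R.* R.1# R.+ ((θ (tail f) * g) n R.+ (tail f * g) n)) R.+ (f 0 R.* θ g (suc n) R.+ (tail f * θ g) n)
        ≈⟨ R.+-cong (R.+-cong (R.trans (R.*-identityʳ _) (R.trans (R.zeroˡ _) (R.sym (R.trans (R.*-congʳ (R.zeroˡ _)) (R.zeroˡ _)))))
             (R.trans (R.sym (S.+-at _ _ n)) (S.at (S.trans (S.sym (SX.distribʳ g (θ (tail f)) (tail f)))
               (SX.*-congʳ (S.sym (tail-θ f)))) n))) (R.sym (S.*-suc f (θ g) n)) ⟩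
      (θ f 0 R.* g (suc n) R.+ (tail (θ f) * g) n) R.+ (f * θ g) (suc n)
        ≈⟨ R.+-congʳ (S.*-suc (θ f) g n) ⟨
      (θ f * g) (suc n) R.+ (f * θ g) (suc n)
        ≈⟨ S.+-at _ _ (suc n) ⟨
      (θ f * g + f * θ g) (suc n) ∎

  module _ (torsion-free : ∀ n → Regular R (# (suc n))) where

    θ-kernel : ∀ f → θ f ≈ S.0# → f ≈ constant (f 0)
    θ-kernel f p = S.ext λ { zero → R.refl ; (suc n) → torsion-free n _ (S.zero-at p (suc n)) }

    -- When θy = y and 2 (1 - y) θp = y p, the derivative of p² (1 - y) vanishes.
    inverse-square-root : ∀ p y → θ y ≈ y → y 0 R.≈ R.0# → p 0 R.≈ R.1# →
      PX.two * ((S.1# - y) * θ p) ≈ y * p → p * p * (S.1# - y) ≈ S.1#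
    inverse-square-root p y θy y₀ p₀ hyp = S.trans (θ-kernel (p * p * (S.1# - y)) (begin
      θ (p * p * (S.1# - y))
        ≈⟨ θ-* (p * p) (S.1# - y) ⟩
      θ (p * p) * (S.1# - y) + p * p * θ (S.1# - y)
        ≈⟨ S.+-cong (SX.*-congʳ (θ-* p p)) (SX.*-congˡ θ[1-y]) ⟩
      (θ p * p + p * θ p) * (S.1# - y) + p * p * (S.- y)
        ≈⟨ solve 3 (λ p y q → (q :* p :+ p :* q) :* (:1 :- y) :+ p :* p :* (:- y)
             := p :* ((:1 :+ :1) :* ((:1 :- y) :* q) :- y :* p)) S.refl p y (θ p) ⟩
      p * (PX.two * ((S.1# - y) * θ p) - y * p)
        ≈⟨ LX.multiple≈0 hyp p ⟩
      S.0# ∎))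
      (S.constant-cong (R.trans (S.*-zero _ _) (R.trans
        (R.*-cong (R.trans (S.*-zero p p) (R.*-cong p₀ p₀))
          (R.trans (S.+-at _ _ 0) (R.+-congˡ (R.trans (S.-‿at y 0) (R.trans (R.-‿cong y₀) -0#≈0#)))))
        (R.trans (R.*-cong (R.*-identityˡ _) (R.+-identityʳ _)) (R.*-identityˡ _)))))
      where
      open SetoidReasoning S.setoid
      open IntegerCoefficients S.ring
      open RingProperties R.ring using (-0#≈0#; -‿distribʳ-*)
      θ[1-y] : θ (S.1# - y) ≈ S.- y
      θ[1-y] = S.trans (S.ext λ
        { zero    → R.trans (R.zeroˡ _) (R.sym (R.trans (S.-‿at y 0) (R.trans (R.-‿cong y₀) -0#≈0#)))
        ; (suc n) → R.trans (R.*-congˡ (R.trans (S.+-at _ _ (suc n)) (R.trans (R.+-identityˡ _) (S.-‿at y (suc n)))))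
            (R.trans (R.sym (-‿distribʳ-* _ _)) (R.trans (R.-‿cong (S.at θy (suc n))) (R.sym (S.-‿at y (suc n))))) })
        S.refl

-- The reciprocal 1 / n!.
J : ℕ → ℚ
J n = (+ 1 / n !) {{n ℕₚ.!≢0}}

!*J : ∀ n → fromℕ (n !) ℚ.* J n ≡ 1ℚ
!*J n = ≡.trans (ℚₚ.*-comm (fromℕ (n !)) (J n)) (fraction-* 1 (n !) {{n ℕₚ.!≢0}})

J-suc : ∀ n → J n ≡ fromℕ (suc n) ℚ.* J (suc n)
J-suc n = begin
  J n
    ≡⟨ solve 1 (λ a → a := a :* :1) ≡.refl (J n) ⟩
  J n ℚ.* 1ℚ
    ≡⟨ ≡.cong (J n ℚ.*_) (≡.trans (≡.sym (!*J (suc n))) (≡.cong (ℚ._* J (suc n)) (fromℕ-* (suc n) (n !)))) ⟩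
  J n ℚ.* (fromℕ (suc n) ℚ.* fromℕ (n !) ℚ.* J (suc n))
    ≡⟨ solve 4 (λ a b c d → a :* (b :* c :* d) := (c :* a) :* (b :* d)) ≡.refl (J n) (fromℕ (suc n)) (fromℕ (n !)) (J (suc n)) ⟩
  (fromℕ (n !) ℚ.* J n) ℚ.* (fromℕ (suc n) ℚ.* J (suc n))
    ≡⟨ ≡.trans (≡.cong (ℚ._* (fromℕ (suc n) ℚ.* J (suc n))) (!*J n)) (ℚₚ.*-identityˡ _) ⟩
  fromℕ (suc n) ℚ.* J (suc n) ∎
  where
  open ≡.≡-Reasoning
  open ℚ-Solver

-- The central binomial coefficient (2n)! / n!².
β : ℕ → ℚ
β n = fromℕ ((n ℕ.* 2) !) ℚ.* (J n ℚ.* J n)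

2ℚ : ℚ
2ℚ = 1ℚ ℚ.+ 1ℚ

β-suc : ∀ n → fromℕ (suc n) ℚ.* β (suc n) ≡ (2ℚ ℚ.+ 2ℚ) ℚ.* (fromℕ n ℚ.* β n) ℚ.+ 2ℚ ℚ.* β n
β-suc n = begin
  fromℕ (suc n) ℚ.* (fromℕ ((suc n ℕ.* 2) !) ℚ.* (j ℚ.* j))
    ≡⟨ ≡.cong₂ (λ a b → a ℚ.* (b ℚ.* (j ℚ.* j))) (fromℕ-suc n) factorial ⟩
  (1ℚ ℚ.+ m) ℚ.* ((2ℚ ℚ.+ m ℚ.* 2ℚ) ℚ.* ((1ℚ ℚ.+ m ℚ.* 2ℚ) ℚ.* f) ℚ.* (j ℚ.* j))
    ≡⟨ solve 3 (λ m f j → let :2 = :1 :+ :1 in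
         (:1 :+ m) :* ((:2 :+ m :* :2) :* ((:1 :+ m :* :2) :* f) :* (j :* j))
         := (:2 :+ :2) :* (m :* (f :* (((:1 :+ m) :* j) :* ((:1 :+ m) :* j))))
            :+ :2 :* (f :* (((:1 :+ m) :* j) :* ((:1 :+ m) :* j)))) ≡.refl m f j ⟩
  (2ℚ ℚ.+ 2ℚ) ℚ.* (m ℚ.* (f ℚ.* (j′ ℚ.* j′))) ℚ.+ 2ℚ ℚ.* (f ℚ.* (j′ ℚ.* j′))
    ≡⟨ ≡.cong (λ i → (2ℚ ℚ.+ 2ℚ) ℚ.* (m ℚ.* (f ℚ.* (i ℚ.* i))) ℚ.+ 2ℚ ℚ.* (f ℚ.* (i ℚ.* i)))
         (≡.trans (J-suc n) (≡.cong (ℚ._* j) (fromℕ-suc n))) ⟨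
  (2ℚ ℚ.+ 2ℚ) ℚ.* (m ℚ.* β n) ℚ.+ 2ℚ ℚ.* β n ∎
  where
  open ≡.≡-Reasoning
  open ℚ-Solver
  m f j j′ : ℚ
  m  = fromℕ n
  f  = fromℕ ((n ℕ.* 2) !)
  j  = J (suc n)
  j′ = (1ℚ ℚ.+ m) ℚ.* j
  factorial : fromℕ ((suc n ℕ.* 2) !) ≡ (2ℚ ℚ.+ m ℚ.* 2ℚ) ℚ.* ((1ℚ ℚ.+ m ℚ.* 2ℚ) ℚ.* f)
  factorial = ≡.trans (fromℕ-* (2 ℕ.+ n ℕ.* 2) ((1 ℕ.+ n ℕ.* 2) !)) (≡.cong₂ ℚ._*_
    (≡.trans (fromℕ-+ 2 (n ℕ.* 2)) (≡.cong (2ℚ ℚ.+_) (fromℕ-* n 2)))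
    (≡.trans (fromℕ-* (1 ℕ.+ n ℕ.* 2) ((n ℕ.* 2) !)) (≡.cong (ℚ._* f)
      (≡.trans (fromℕ-+ 1 (n ℕ.* 2)) (≡.cong (1ℚ ℚ.+_) (fromℕ-* n 2))))))

-- The powers of V.
V^ : ℕ → A.Series
V^ zero    = A.1#
V^ (suc n) = V A.* V^ n

module E = Euler A.ring

#-fromℕ : ∀ n → E.# n A.≈ A.constant (fromℕ n)
#-fromℕ zero    = A.refl
#-fromℕ (suc n) = A.trans (RA.+-congˡ (#-fromℕ n)) (A.trans (A.sym (+-homo 1ℚ (fromℕ n)))
  (A.constant-cong (≡.sym (fromℕ-suc n))))
  where open IsRingHomomorphism A.constant-isRingHomomorphism

torsion-free : ∀ n → Regular A.ring (E.# (suc n))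
torsion-free n = LA.regular-cong (A.sym (#-fromℕ (suc n))) (A.regular _ (≢0-regular (fromℕ-nonZero (suc n))))

-- 1 / √(1 - 4 V² u), the inverse square root of 1 - u U².
p : B.Series
p n = A.constant (β n) A.* V^ (n ℕ.* 2)

p-suc : ∀ n → E.# (suc n) A.* p (suc n) A.≈
        V A.* V A.* (PA.four A.* (E.# n A.* p n) A.+ PA.two A.* p n)
p-suc n = begin
  E.# (suc n) A.* (A.constant (β (suc n)) A.* (V A.* (V A.* v)))
    ≈⟨ RA.*-congʳ (#-fromℕ (suc n)) ⟩
  A.constant (fromℕ (suc n)) A.* (A.constant (β (suc n)) A.* (V A.* (V A.* v)))
    ≈⟨ solve 4 (λ a b V v → a :* (b :* (V :* (V :* v))) := a :* b :* (V :* V :* v)) A.refl _ _ V v ⟩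
  A.constant (fromℕ (suc n)) A.* A.constant (β (suc n)) A.* (V A.* V A.* v)
    ≈⟨ RA.*-congʳ (A.trans (A.sym (*-homo _ _)) (A.constant-cong (β-suc n))) ⟩
  A.constant ((2ℚ ℚ.+ 2ℚ) ℚ.* (fromℕ n ℚ.* β n) ℚ.+ 2ℚ ℚ.* β n) A.* (V A.* V A.* v)
    ≈⟨ RA.*-congʳ (natural (:4 Q.:* (m Q.:* b) Q.:+ :2 Q.:* b) (fromℕ n ∷ β n ∷ [])) ⟩
  (PA.four A.* (A.constant (fromℕ n) A.* A.constant (β n)) A.+ PA.two A.* A.constant (β n)) A.* (V A.* V A.* v)
    ≈⟨ RA.*-congʳ (RA.+-congʳ (RA.*-congˡ (RA.*-congʳ (#-fromℕ n)))) ⟨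
  (PA.four A.* (E.# n A.* A.constant (β n)) A.+ PA.two A.* A.constant (β n)) A.* (V A.* V A.* v)
    ≈⟨ solve 4 (λ m b V v → let :2 = :1 :+ :1 ; :4 = :2 :+ :2 in
         (:4 :* (m :* b) :+ :2 :* b) :* (V :* V :* v) := V :* V :* (:4 :* (m :* (b :* v)) :+ :2 :* (b :* v)))
         A.refl (E.# n) (A.constant (β n)) V v ⟩
  V A.* V A.* (PA.four A.* (E.# n A.* p n) A.+ PA.two A.* p n) ∎
  where
  open SetoidReasoning A.setoid
  open SA
  open Naturality ℚ-ring A.ring A.constant-isRingHomomorphism using (natural)
  open IsRingHomomorphism A.constant-isRingHomomorphism
  v = V^ (n ℕ.* 2)
  module Q = ℚ-Solver
  m b :2 :4 : Q.Polynomial 2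
  m = Q.var zero
  b = Q.var (suc zero)
  :2 = Q.:1 Q.:+ Q.:1
  :4 = :2 Q.:+ :2

p₀ : p 0 A.≈ A.1#
p₀ = A.trans (RA.*-identityʳ _) (A.constant-cong ≡.refl)

-- 4 V² u = u U².
y : B.Series
y = PB.four B.* (VB B.* VB) B.* u

module Y where
  -- The coefficient of u in y.
  v : A.Series
  v = PA.four A.* (V A.* V)

  y-constant : y B.≈ u B.* B.constant v
  y-constant = B.trans (RB.*-comm _ u) (RB.*-congˡ (B.sym (AB.natural (:4 :* (x :* x)) (V ∷ []))))
    where
    open SA
    x :4 : Polynomial 1
    x = var zero
    :4 = (:1 :+ :1) :+ (:1 :+ :1)

  y-0 : y 0 A.≈ A.0#
  y-0 = A.trans (B.at y-constant 0) (B.X*-zero _)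

  y-suc : ∀ f n → (y B.* f) (suc n) A.≈ v A.* f n
  y-suc f n = A.trans (B.at (RB.*-congʳ y-constant) (suc n)) (A.trans (B.at (RB.*-assoc u (B.constant v) f) (suc n))
    (A.trans (B.X*-suc (B.constant v B.* f) n) (B.constant-·-at v f n)))

  θy : E.θ y B.≈ y
  θy = B.trans (E.θ-cong y-constant) (B.trans (B.ext λ
    { zero → A.trans (RA.zeroˡ _) (A.sym (B.X*-zero _))
    ; (suc zero) → A.trans (RA.*-congʳ (RA.+-identityʳ A.1#)) (RA.*-identityˡ _)
    ; (suc (suc n)) → A.trans (RA.*-congˡ (B.X*-suc _ (suc n))) (A.trans (RA.zeroʳ _) (A.sym (B.X*-suc _ (suc n)))) })
    (B.sym y-constant))

  p-equation : PB.two B.* ((B.1# B.- y) B.* E.θ p) B.≈ y B.* p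
  p-equation = LB.combine₁ positive B.1# (solve 3 (λ y q p →
    (:1 :+ :1) :* ((:1 :- y) :* q) :- y :* p := :1 :* ((q :+ q) :- (y :* (q :+ q :+ p)))) B.refl y (E.θ p) p)
    where
    open SB
    positive : E.θ p B.+ E.θ p B.≈ y B.* (E.θ p B.+ E.θ p B.+ p)
    positive = B.ext λ
      { zero → A.trans (B.+-at _ _ 0) (A.trans (RA.+-cong (RA.zeroˡ _) (RA.zeroˡ _)) (A.trans (RA.+-identityʳ _)
          (A.sym (A.trans (B.*-zero y _) (A.trans (RA.*-congʳ y-0) (RA.zeroˡ _))))))
      ; (suc n) → A.trans (B.+-at _ _ (suc n)) (A.trans (RA.+-cong (p-suc n) (p-suc n)) (A.trans
          (rearrange V (E.θ p n) (p n)) (A.sym (A.trans (y-suc _ n) (RA.*-congˡ (A.trans (B.+-at _ _ n)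
            (RA.+-congʳ (B.+-at _ _ n))))))))  }
      where
      rearrange : ∀ V q p → V A.* V A.* (PA.four A.* q A.+ PA.two A.* p) A.+ V A.* V A.* (PA.four A.* q A.+ PA.two A.* p)
        A.≈ PA.four A.* (V A.* V) A.* (q A.+ q A.+ p)
      rearrange V q p = SA.solve 3 (λ V q p → let :2 = SA.:1 :+′ SA.:1 ; :4 = :2 :+′ :2 in
        V :*′ V :*′ (:4 :*′ q :+′ :2 :*′ p) :+′ V :*′ V :*′ (:4 :*′ q :+′ :2 :*′ p) SA.:= :4 :*′ (V :*′ V) :*′ (q :+′ q :+′ p))
        A.refl V q p
        where open SA using () renaming (_:+_ to infixl 7 _:+′_; _:*_ to infixl 8 _:*′_)

p-square : p B.* p B.* (B.1# B.- y) B.≈ B.1#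
p-square = E.inverse-square-root torsion-free p y Y.θy Y.y-0 p₀ Y.p-equation

-- Of the two roots e = p h and e = - p h of the quadratic equation, the first has
-- constant term 1, whereas e has constant term - 1.
diagonal : tB B.* (u B.* u) B.* D B.≈ B.1# B.- p B.* h
diagonal = LB.combine₁ (PB.root D-square p-square minus-two-regular) B.1#
  (solve 3 (λ d p h → d :- (:1 :- p :* h) := :1 :* (d :- :1 :- (:- (p :* h)))) B.refl _ p h)
  where
  open SB
  minus-two-regular : Regular B.ring (e B.- p B.* h)
  minus-two-regular = B.regular _ (A.regular _ (LQ.regular-cong (≡.sym value)
    (≢0-regular {ℚ.- 2ℚ} λ ())))
    where
    e₀ : e 0 0 ≡ ℚ.- 1ℚ
    e₀ = ≡.trans (B-+ _ _ 0 0) (≡.cong₂ ℚ._+_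
      (≡.trans (A.at (A.trans (B.*-zero _ D) (RA.*-congʳ (A.trans (B.*-zero tB (u B.* u)) (RA.*-congˡ (B.X*-zero u))))) 0)
        (≡.trans (A.*-zero _ (D 0)) (≡.trans (≡.cong (ℚ._* D 0 0) (≡.trans (A.*-zero _ A.0#) (ℚₚ.*-zeroʳ (tA 0)))) (ℚₚ.*-zeroˡ (D 0 0)))))
      (≡.trans (A.at (B.-‿at B.1# 0) 0) (A.-‿at A.1# 0)))
    h₀ : h 0 A.≈ A.1#
    h₀ = A.trans (B.+-at _ _ 0) (A.trans (RA.+-cong (A.trans (B.+-at _ _ 0) (A.trans
      (RA.+-congˡ (A.trans (B.-‿at _ 0) (A.trans (A.-‿cong (A.trans (B.*-zero _ u) (RA.zeroʳ _))) -0#≈0#))) (RA.+-identityʳ _)))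
      (A.trans (B.-‿at _ 0) (A.trans (A.-‿cong (A.trans (B.*-zero VB (u B.* u)) (A.trans (RA.*-congˡ (B.X*-zero u)) (RA.zeroʳ _)))) -0#≈0#)))
      (RA.+-identityʳ _))
      where open RingProperties RA.ring using (-0#≈0#)
    ph₀ : (p B.* h) 0 A.≈ A.1#
    ph₀ = A.trans (B.*-zero p h) (A.trans (RA.*-cong p₀ h₀) (RA.*-identityˡ _))
    value : (e B.- p B.* h) 0 0 ≡ ℚ.- 2ℚ
    value = ≡.trans (B-+ e (B.- (p B.* h)) 0 0) (≡.cong₂ ℚ._+_ e₀
      (≡.trans (A.at (B.-‿at (p B.* h) 0) 0) (≡.trans (A.-‿at ((p B.* h) 0) 0) (≡.cong ℚ.-_ (A.at ph₀ 0)))))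

-- Powers of V by Lagrange inversion

4ℚ : ℚ
4ℚ = 2ℚ ℚ.+ 2ℚ

-- V^(p+1) = t (V^p + 4 V^(p+3)), from which the coefficients of all powers of V are
-- determined by recursion on the exponent of t.
V^-equation : ∀ p → V^ (suc p) A.≈ tA A.* (V^ p A.+ PA.four A.* V^ (3 ℕ.+ p))
V^-equation p = A.trans (RA.*-congʳ V-eq) (solve 3 (λ t V v → let :2 = :1 :+ :1 ; :4 = :2 :+ :2 in
  t :* (:1 :+ :4 :* (V :* V :* V)) :* v := t :* (v :+ :4 :* (V :* (V :* (V :* v))))) A.refl tA V (V^ p))
  where open SA

V^-zero : ∀ p → V^ (suc p) 0 ≡ 0ℚ
V^-zero p = ≡.trans (A.at (V^-equation p) 0) (A.X*-zero _)

V^-suc : ∀ p m → V^ (suc p) (suc m) ≡ V^ p m ℚ.+ 4ℚ ℚ.* V^ (3 ℕ.+ p) m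
V^-suc p m = ≡.trans (A.at (V^-equation p) (suc m)) (≡.trans (A.X*-suc _ m) (≡.trans (A.+-at _ _ m)
  (≡.cong (V^ p m ℚ.+_) (≡.trans (A.at (RA.*-congʳ (A.sym four-constant)) m) (A.constant-·-at 4ℚ (V^ (3 ℕ.+ p)) m)))))
  where
  open IsRingHomomorphism A.constant-isRingHomomorphism
  four-constant : A.constant 4ℚ A.≈ PA.four
  four-constant = A.trans (+-homo 2ℚ 2ℚ) (A.+-cong (+-homo 1ℚ 1ℚ) (+-homo 1ℚ 1ℚ))

V^-below : ∀ p m → m ℕ.< p → V^ p m ≡ 0ℚ
V^-below (suc p) zero    _         = V^-zero p
V^-below (suc p) (suc m) (s≤s m<p) = ≡.trans (V^-suc p m) (≡.cong₂ (λ a b → a ℚ.+ 4ℚ ℚ.* b)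
  (V^-below p m m<p) (V^-below (3 ℕ.+ p) m (ℕₚ.m≤n⇒m≤o+n 3 m<p)))

-- The coefficient of t^(p+1+3e) in V^(p+1), which is
-- (p + 1) 4^e (p + 3e)! / (e! (p + 1 + 2e)!).
lagrange : ℕ → ℕ → ℚ
lagrange e p = fromℕ (suc p) ℚ.* fromℕ (4 ℕ.^ e) ℚ.* fromℕ ((e ℕ.* 3 ℕ.+ p) !) ℚ.* J e ℚ.* J (suc p ℕ.+ e ℕ.* 2)

V^-self : ∀ p → V^ p p ≡ 1ℚ
V^-self zero    = ≡.refl
V^-self (suc p) = ≡.trans (V^-suc p p) (≡.cong₂ (λ a b → a ℚ.+ 4ℚ ℚ.* b) (V^-self p)
  (V^-below (3 ℕ.+ p) p (ℕₚ.m≤n⇒m≤o+n 2 ℕₚ.≤-refl)))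

lagrange-zero : ∀ p → lagrange 0 p ≡ 1ℚ
lagrange-zero p = begin
  fromℕ (suc p) ℚ.* 1ℚ ℚ.* fromℕ (p !) ℚ.* J 0 ℚ.* J (suc p ℕ.+ 0)
    ≡⟨ ≡.cong₂ ℚ._*_ (solve 2 (λ a b → a :* :1 :* b :* :1 := a :* b) ≡.refl (fromℕ (suc p)) (fromℕ (p !)))
         (≡.cong J (ℕₚ.+-identityʳ (suc p))) ⟩
  fromℕ (suc p) ℚ.* fromℕ (p !) ℚ.* J (suc p)
    ≡⟨ ≡.cong (ℚ._* J (suc p)) (fromℕ-* (suc p) (p !)) ⟨
  fromℕ (suc p !) ℚ.* J (suc p)
    ≡⟨ !*J (suc p) ⟩
  1ℚ ∎
  where
  open ≡.≡-Reasoning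
  open ℚ-Solver

fromℕ-2+ : ∀ n → fromℕ (2 ℕ.+ n) ≡ 2ℚ ℚ.+ fromℕ n
fromℕ-2+ = fromℕ-+ 2

lagrange-suc₀ : ∀ e → lagrange (suc e) 0 ≡ 4ℚ ℚ.* lagrange e 2
lagrange-suc₀ e = begin
  fromℕ 1 ℚ.* fromℕ (4 ℕ.* 4 ℕ.^ e) ℚ.* fromℕ (suc (suc (suc (e ℕ.* 3 ℕ.+ 0))) !) ℚ.* J (suc e) ℚ.* J (3 ℕ.+ e ℕ.* 2)
    ≡⟨ ≡.cong (λ a → a ℚ.* J (suc e) ℚ.* j) (≡.cong₂ (λ a b → 1ℚ ℚ.* a ℚ.* b) (fromℕ-* 4 (4 ℕ.^ e)) (begin
         fromℕ (suc (suc (suc (e ℕ.* 3 ℕ.+ 0))) !)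
           ≡⟨ ≡.cong (λ n → fromℕ (suc n !)) (≡.sym (≡.trans (ℕₚ.+-suc (e ℕ.* 3) 1) (≡.cong suc (ℕₚ.+-suc (e ℕ.* 3) 0)))) ⟩
         fromℕ (suc (e ℕ.* 3 ℕ.+ 2) !)
           ≡⟨ fromℕ-* (suc (e ℕ.* 3 ℕ.+ 2)) ((e ℕ.* 3 ℕ.+ 2) !) ⟩
         fromℕ (suc (e ℕ.* 3 ℕ.+ 2)) ℚ.* f
           ≡⟨ ≡.cong (ℚ._* f) (≡.trans (≡.cong fromℕ (ℕₚ.+-comm (suc (e ℕ.* 3)) 2)) (≡.trans (fromℕ-+ 3 (e ℕ.* 3))
                (≡.cong (fromℕ 3 ℚ.+_) (fromℕ-* e 3)))) ⟩
         (fromℕ 3 ℚ.+ fromℕ e ℚ.* fromℕ 3) ℚ.* f ∎)) ⟩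
  1ℚ ℚ.* (4ℚ ℚ.* q) ℚ.* ((fromℕ 3 ℚ.+ fromℕ e ℚ.* fromℕ 3) ℚ.* f) ℚ.* J (suc e) ℚ.* j
    ≡⟨ solve 5 (λ q f e i j → let :3 = :1 :+ :1 :+ :1 ; :4 = (:1 :+ :1) :+ (:1 :+ :1) in
         :1 :* (:4 :* q) :* ((:3 :+ e :* :3) :* f) :* i :* j := :4 :* (:3 :* q :* f :* ((:1 :+ e) :* i) :* j))
         ≡.refl q f (fromℕ e) (J (suc e)) j ⟩
  4ℚ ℚ.* (fromℕ 3 ℚ.* q ℚ.* f ℚ.* ((1ℚ ℚ.+ fromℕ e) ℚ.* J (suc e)) ℚ.* j)
    ≡⟨ ≡.cong (λ i → 4ℚ ℚ.* (fromℕ 3 ℚ.* q ℚ.* f ℚ.* i ℚ.* j))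
         (≡.trans (≡.cong (ℚ._* J (suc e)) (≡.sym (fromℕ-suc e))) (≡.sym (J-suc e))) ⟩
  4ℚ ℚ.* lagrange e 2 ∎
  where
  open ≡.≡-Reasoning
  open ℚ-Solver
  q f j : ℚ
  q = fromℕ (4 ℕ.^ e)
  f = fromℕ ((e ℕ.* 3 ℕ.+ 2) !)
  j = J (3 ℕ.+ e ℕ.* 2)

lagrange-suc : ∀ e p → lagrange (suc e) (suc p) ≡ lagrange (suc e) p ℚ.+ 4ℚ ℚ.* lagrange e (3 ℕ.+ p)
lagrange-suc e p = begin
  fromℕ (2 ℕ.+ p) ℚ.* fromℕ (4 ℕ.* 4 ℕ.^ e) ℚ.* fromℕ ((3 ℕ.+ (e ℕ.* 3 ℕ.+ suc p)) !) ℚ.* J (suc e) ℚ.* J (2 ℕ.+ p ℕ.+ suc e ℕ.* 2)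
    ≡⟨ ≡.cong₂ (λ a b → a ℚ.* J (suc e) ℚ.* J b) (≡.cong₂ ℚ._*_ (≡.cong₂ ℚ._*_ (fromℕ-2+ p) (fromℕ-* 4 (4 ℕ.^ e))) factorial₄) index ⟩
  (2ℚ ℚ.+ r) ℚ.* (4ℚ ℚ.* q) ℚ.* ((fromℕ 4 ℚ.+ (ε ℚ.* fromℕ 3 ℚ.+ r)) ℚ.* f) ℚ.* i ℚ.* j
    ≡⟨ solve 6 (λ r ε q f i j → let :2 = :1 :+ :1 ; :3 = :1 :+ :1 :+ :1 ; :4 = (:1 :+ :1) :+ (:1 :+ :1) in
         (:2 :+ r) :* (:4 :* q) :* ((:4 :+ (ε :* :3 :+ r)) :* f) :* i :* j
         := (:1 :+ r) :* (:4 :* q) :* f :* i :* ((:4 :+ r :+ ε :* :2) :* j)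
            :+ :4 :* ((:4 :+ r) :* q :* f :* ((:1 :+ ε) :* i) :* j)) ≡.refl r ε q f i j ⟩
  (1ℚ ℚ.+ r) ℚ.* (4ℚ ℚ.* q) ℚ.* f ℚ.* i ℚ.* ((fromℕ 4 ℚ.+ r ℚ.+ ε ℚ.* 2ℚ) ℚ.* j)
    ℚ.+ 4ℚ ℚ.* ((fromℕ 4 ℚ.+ r) ℚ.* q ℚ.* f ℚ.* ((1ℚ ℚ.+ ε) ℚ.* i) ℚ.* j)
    ≡⟨ ≡.cong₂ (λ a b → a ℚ.+ 4ℚ ℚ.* b)
         (≡.cong₂ ℚ._*_ (≡.cong (ℚ._* i) (≡.cong₂ ℚ._*_ (≡.cong₂ ℚ._*_ (≡.sym (fromℕ-suc p)) (≡.sym (fromℕ-* 4 (4 ℕ.^ e)))) (≡.cong (λ n → fromℕ (n !)) index₃)))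
           (≡.trans (≡.cong (ℚ._* j) (≡.sym (≡.trans (fromℕ-+ (4 ℕ.+ p) (e ℕ.* 2)) (≡.cong₂ ℚ._+_ (fromℕ-+ 4 p) (fromℕ-* e 2)))))
             (≡.trans (≡.sym (J-suc (3 ℕ.+ p ℕ.+ e ℕ.* 2))) (≡.cong J (≡.sym index₁)))))
         (≡.cong (ℚ._* j) (≡.cong₂ (λ a b → a ℚ.* q ℚ.* f ℚ.* b) (≡.sym (fromℕ-+ 4 p))
           (≡.trans (≡.cong (ℚ._* i) (≡.sym (fromℕ-suc e))) (≡.sym (J-suc e))))) ⟩
  lagrange (suc e) p ℚ.+ 4ℚ ℚ.* lagrange e (3 ℕ.+ p) ∎
  where
  open ≡.≡-Reasoning
  open ℚ-Solver
  r ε q f i j : ℚ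
  r = fromℕ p
  ε = fromℕ e
  q = fromℕ (4 ℕ.^ e)
  f = fromℕ ((e ℕ.* 3 ℕ.+ (3 ℕ.+ p)) !)
  i = J (suc e)
  j = J (4 ℕ.+ p ℕ.+ e ℕ.* 2)
  index : 2 ℕ.+ p ℕ.+ suc e ℕ.* 2 ≡ 4 ℕ.+ p ℕ.+ e ℕ.* 2
  index = ≡.cong (2 ℕ.+_) (≡.trans (ℕₚ.+-suc p (suc (e ℕ.* 2))) (≡.cong suc (ℕₚ.+-suc p (e ℕ.* 2))))
  index₁ : suc p ℕ.+ suc e ℕ.* 2 ≡ 3 ℕ.+ p ℕ.+ e ℕ.* 2
  index₁ = ≡.cong ℕ.pred index
  index₃ : e ℕ.* 3 ℕ.+ (3 ℕ.+ p) ≡ 3 ℕ.+ (e ℕ.* 3 ℕ.+ p)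
  index₃ = ≡.trans (ℕₚ.+-suc (e ℕ.* 3) (2 ℕ.+ p)) (≡.cong suc (≡.trans (ℕₚ.+-suc (e ℕ.* 3) (1 ℕ.+ p)) (≡.cong suc (ℕₚ.+-suc (e ℕ.* 3) p))))
  factorial₄ : fromℕ ((3 ℕ.+ (e ℕ.* 3 ℕ.+ suc p)) !) ≡ (fromℕ 4 ℚ.+ (ε ℚ.* fromℕ 3 ℚ.+ r)) ℚ.* f
  factorial₄ = begin
    fromℕ ((3 ℕ.+ (e ℕ.* 3 ℕ.+ suc p)) !)
      ≡⟨ ≡.cong (λ n → fromℕ ((3 ℕ.+ n) !)) (ℕₚ.+-suc (e ℕ.* 3) p) ⟩
    fromℕ ((4 ℕ.+ (e ℕ.* 3 ℕ.+ p)) !)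
      ≡⟨ fromℕ-* (4 ℕ.+ (e ℕ.* 3 ℕ.+ p)) ((3 ℕ.+ (e ℕ.* 3 ℕ.+ p)) !) ⟩
    fromℕ (4 ℕ.+ (e ℕ.* 3 ℕ.+ p)) ℚ.* fromℕ ((3 ℕ.+ (e ℕ.* 3 ℕ.+ p)) !)
      ≡⟨ ≡.cong₂ ℚ._*_ (≡.trans (fromℕ-+ 4 (e ℕ.* 3 ℕ.+ p)) (≡.cong (fromℕ 4 ℚ.+_)
           (≡.trans (fromℕ-+ (e ℕ.* 3) p) (≡.cong (ℚ._+ r) (fromℕ-* e 3))))) (≡.cong (λ n → fromℕ (n !)) (≡.sym index₃)) ⟩
    (fromℕ 4 ℚ.+ (ε ℚ.* fromℕ 3 ℚ.+ r)) ℚ.* f ∎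

V^-coefficient : ∀ e p → V^ (suc p) (suc (e ℕ.* 3 ℕ.+ p)) ≡ lagrange e p
V^-coefficient zero p = ≡.trans (V^-self (suc p)) (≡.sym (lagrange-zero p))
V^-coefficient (suc e) zero = begin
  V^ 1 (suc (suc e ℕ.* 3 ℕ.+ 0))
    ≡⟨ V^-suc 0 (suc e ℕ.* 3 ℕ.+ 0) ⟩
  0ℚ ℚ.+ 4ℚ ℚ.* V^ 3 (3 ℕ.+ (e ℕ.* 3 ℕ.+ 0))
    ≡⟨ ≡.trans (ℚₚ.+-identityˡ _) (≡.cong (λ n → 4ℚ ℚ.* V^ 3 (suc n))
         (≡.sym (≡.trans (ℕₚ.+-suc (e ℕ.* 3) 1) (≡.cong suc (ℕₚ.+-suc (e ℕ.* 3) 0))))) ⟩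
  4ℚ ℚ.* V^ 3 (suc (e ℕ.* 3 ℕ.+ 2))
    ≡⟨ ≡.trans (≡.cong (4ℚ ℚ.*_) (V^-coefficient e 2)) (≡.sym (lagrange-suc₀ e)) ⟩
  lagrange (suc e) 0 ∎
  where open ≡.≡-Reasoning
V^-coefficient (suc e) (suc p) = begin
  V^ (2 ℕ.+ p) (suc (suc e ℕ.* 3 ℕ.+ suc p))
    ≡⟨ V^-suc (suc p) (suc e ℕ.* 3 ℕ.+ suc p) ⟩
  V^ (suc p) (3 ℕ.+ (e ℕ.* 3 ℕ.+ suc p)) ℚ.+ 4ℚ ℚ.* V^ (4 ℕ.+ p) (3 ℕ.+ (e ℕ.* 3 ℕ.+ suc p))
    ≡⟨ ≡.cong₂ (λ a b → V^ (suc p) a ℚ.+ 4ℚ ℚ.* V^ (4 ℕ.+ p) b)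
         (≡.cong (3 ℕ.+_) (ℕₚ.+-suc (e ℕ.* 3) p))
         (≡.cong suc (≡.sym (≡.trans (ℕₚ.+-suc (e ℕ.* 3) (2 ℕ.+ p)) (≡.cong suc (ℕₚ.+-suc (e ℕ.* 3) (1 ℕ.+ p)))))) ⟩
  V^ (suc p) (suc (suc e ℕ.* 3 ℕ.+ p)) ℚ.+ 4ℚ ℚ.* V^ (4 ℕ.+ p) (suc (e ℕ.* 3 ℕ.+ (3 ℕ.+ p)))
    ≡⟨ ≡.cong₂ (λ a b → a ℚ.+ 4ℚ ℚ.* b) (V^-coefficient (suc e) p) (V^-coefficient e (3 ℕ.+ p)) ⟩
  lagrange (suc e) p ℚ.+ 4ℚ ℚ.* lagrange e (3 ℕ.+ p)
    ≡⟨ lagrange-suc e p ⟨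
  lagrange (suc e) (suc p) ∎
  where open ≡.≡-Reasoning

-- Comparing coefficients of u^(a+2) in t u² D = 1 - p h.
D-coefficient : ∀ a m → D a m ≡
  (2ℚ ℚ.* β (suc a) ℚ.- β (2 ℕ.+ a)) ℚ.* V^ (4 ℕ.+ a ℕ.* 2) (suc m) ℚ.+ β a ℚ.* V^ (1 ℕ.+ a ℕ.* 2) (suc m)
D-coefficient a m = begin
  D a m
    ≡⟨ ≡.trans (≡.sym (B-u-suc D a m)) (≡.trans (≡.sym (B-u-suc _ (suc a) m)) (≡.sym (B-t-suc _ (2 ℕ.+ a) m))) ⟩
  (tB B.* (u B.* (u B.* D))) (2 ℕ.+ a) (suc m)
    ≡⟨ A.at (B.at expand (2 ℕ.+ a)) (suc m) ⟩
  (B.1# B.+ (PB.two B.* (VB B.* VB) B.* (u B.* p) B.+ (VB B.* (u B.* (u B.* p)) B.- p))) (2 ℕ.+ a) (suc m)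
    ≡⟨ A.at at-2+a (suc m) ⟩
  ((A.constant (2ℚ ℚ.* β (suc a) ℚ.- β (2 ℕ.+ a))) A.* V^ (4 ℕ.+ a ℕ.* 2) A.+ A.constant (β a) A.* V^ (1 ℕ.+ a ℕ.* 2)) (suc m)
    ≡⟨ ≡.trans (A.+-at _ _ (suc m)) (≡.cong₂ ℚ._+_ (A.constant-·-at _ (V^ (4 ℕ.+ a ℕ.* 2)) (suc m)) (A.constant-·-at _ (V^ (1 ℕ.+ a ℕ.* 2)) (suc m))) ⟩
  (2ℚ ℚ.* β (suc a) ℚ.- β (2 ℕ.+ a)) ℚ.* V^ (4 ℕ.+ a ℕ.* 2) (suc m) ℚ.+ β a ℚ.* V^ (1 ℕ.+ a ℕ.* 2) (suc m) ∎
  where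
  open ≡.≡-Reasoning
  expand : tB B.* (u B.* (u B.* D)) B.≈
           B.1# B.+ (PB.two B.* (VB B.* VB) B.* (u B.* p) B.+ (VB B.* (u B.* (u B.* p)) B.- p))
  expand = LB.combine₁ diagonal B.1# (solve 5 (λ t u D p V → let :2 = :1 :+ :1 in
    t :* (u :* (u :* D)) :- (:1 :+ (:2 :* (V :* V) :* (u :* p) :+ (V :* (u :* (u :* p)) :- p)))
    := :1 :* (t :* (u :* u) :* D :- (:1 :- p :* (:1 :- :2 :* (V :* V) :* u :- V :* (u :* u))))) B.refl tB u D p VB)
    where open SB
  two-V² : B.constant (PA.two A.* (V A.* V)) B.≈ PB.two B.* (VB B.* VB)
  two-V² = AB.natural ((:1 :+ :1) :* (x :* x)) (V ∷ [])
    where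
    open SA
    x : Polynomial 1
    x = var zero
  at-2+a : (B.1# B.+ (PB.two B.* (VB B.* VB) B.* (u B.* p) B.+ (VB B.* (u B.* (u B.* p)) B.- p))) (2 ℕ.+ a)
    A.≈ A.constant (2ℚ ℚ.* β (suc a) ℚ.- β (2 ℕ.+ a)) A.* V^ (4 ℕ.+ a ℕ.* 2) A.+ A.constant (β a) A.* V^ (1 ℕ.+ a ℕ.* 2)
  at-2+a = A.trans (A.trans (B.+-at _ _ (2 ℕ.+ a)) (A.trans (RA.+-identityˡ _) (A.trans (B.+-at _ _ (2 ℕ.+ a))
    (A.+-cong
      (A.trans (B.at (RB.*-congʳ (B.sym two-V²)) (2 ℕ.+ a)) (A.trans (B.constant-·-at _ (u B.* p) (2 ℕ.+ a)) (RA.*-congˡ (B.X*-suc p (suc a)))))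
      (A.trans (B.+-at _ _ (2 ℕ.+ a)) (A.+-cong
        (A.trans (B.constant-·-at V _ (2 ℕ.+ a)) (RA.*-congˡ (A.trans (B.X*-suc _ (suc a)) (B.X*-suc p a))))
        (B.-‿at p (2 ℕ.+ a))))))))
    (A.trans (SA.solve 5 (λ b₀ b₁ b₂ V v → rearranged b₀ b₁ b₂ V v) A.refl
        (A.constant (β a)) (A.constant (β (suc a))) (A.constant (β (2 ℕ.+ a))) V (V^ (a ℕ.* 2)))
      (RA.+-congʳ (RA.*-congʳ (A.sym constants))))
    where
    rearranged : ∀ {n} → (b₀ b₁ b₂ V v : SA.Polynomial n) → _
    rearranged b₀ b₁ b₂ V v =
      (:2 :* (V :* V)) :* (b₁ :* (V :* (V :* v))) :+ (V :* (b₀ :* v) :+ (:- (b₂ :* (V :* (V :* (V :* (V :* v)))))))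
      := (:2 :* b₁ :- b₂) :* (V :* (V :* (V :* (V :* v)))) :+ b₀ :* (V :* v)
      where
      open SA
      :2 = :1 :+ :1
    constants : A.constant (2ℚ ℚ.* β (suc a) ℚ.- β (2 ℕ.+ a)) A.≈ PA.two A.* A.constant (β (suc a)) A.- A.constant (β (2 ℕ.+ a))
    constants = natural ((:1 :+ :1) :* x :- y′) (β (suc a) ∷ β (2 ℕ.+ a) ∷ [])
      where
      open Naturality ℚ-ring A.ring A.constant-isRingHomomorphism using (natural)
      open ℚ-Solver
      x y′ : Polynomial 2
      x = var zero
      y′ = var (suc zero)

-- The closed form on the diagonal

length-eq : ∀ a e → 3 ℕ.* (a ℕ.+ e) ∸ a ≡ e ℕ.* 3 ℕ.+ a ℕ.* 2
length-eq a e = ≡.trans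
  (≡.cong (_∸ a) (solve 2 (λ a e → con 3 :* (a :+ e) := a :+ (e :* con 3 :+ a :* con 2)) ≡.refl a e))
  (ℕₚ.m+n∸m≡n a (e ℕ.* 3 ℕ.+ a ℕ.* 2))
  where open +-*-Solver

-- The number of walks to (a , a) of length 2a + 3e. With n = a + e it equals
-- 4^e (2a+1)! (a+1) (2a+3e)! / ((n+1) (2n+1)! a!² e!).
closed : ℕ → ℕ → ℚ
closed a e = β a ℚ.* (fromℕ (suc (a ℕ.* 2)) ℚ.* fromℕ (suc a) ℚ.* fromℕ (4 ℕ.^ e)
  ℚ.* fromℕ ((e ℕ.* 3 ℕ.+ a ℕ.* 2) !) ℚ.* 2ℚ ℚ.* J e ℚ.* J (2 ℕ.+ (a ℕ.+ e) ℕ.* 2))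

fromℕ-suc*2 : ∀ a → fromℕ (suc (a ℕ.* 2)) ≡ 1ℚ ℚ.+ fromℕ a ℚ.* 2ℚ
fromℕ-suc*2 a = ≡.trans (fromℕ-suc (a ℕ.* 2)) (≡.cong (1ℚ ℚ.+_) (fromℕ-* a 2))

β-relation : ∀ a → (4ℚ ℚ.+ fromℕ a ℚ.* 2ℚ) ℚ.* (2ℚ ℚ.* β (suc a) ℚ.- β (2 ℕ.+ a))
                 ≡ ℚ.- (4ℚ ℚ.* 2ℚ ℚ.* (1ℚ ℚ.+ fromℕ a ℚ.* 2ℚ) ℚ.* β a)
β-relation a = LQ.combine₂ b₁ b₂ (ℚ.- 4ℚ) (ℚ.- 2ℚ)
  (solve 4 (λ m b₀ b₁ b₂ → let :2 = :1 :+ :1 ; :4 = :2 :+ :2 in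
    (:4 :+ m :* :2) :* (:2 :* b₁ :- b₂) :- (:- (:4 :* :2 :* (:1 :+ m :* :2) :* b₀))
    := (:- :4) :* ((:1 :+ m) :* b₁ :- (:4 :* (m :* b₀) :+ :2 :* b₀))
       :+ (:- :2) :* ((:2 :+ m) :* b₂ :- (:4 :* ((:1 :+ m) :* b₁) :+ :2 :* b₁)))
    ≡.refl (fromℕ a) (β a) (β (suc a)) (β (2 ℕ.+ a)))
  where
  open ℚ-Solver
  b₁ : (1ℚ ℚ.+ fromℕ a) ℚ.* β (suc a) ≡ 4ℚ ℚ.* (fromℕ a ℚ.* β a) ℚ.+ 2ℚ ℚ.* β a
  b₁ = ≡.trans (≡.cong (ℚ._* β (suc a)) (≡.sym (fromℕ-suc a))) (β-suc a)
  b₂ : (2ℚ ℚ.+ fromℕ a) ℚ.* β (2 ℕ.+ a) ≡ 4ℚ ℚ.* ((1ℚ ℚ.+ fromℕ a) ℚ.* β (suc a)) ℚ.+ 2ℚ ℚ.* β (suc a)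
  b₂ = ≡.trans (≡.cong (ℚ._* β (2 ℕ.+ a)) (≡.sym (fromℕ-2+ a))) (≡.trans (β-suc (suc a))
    (≡.cong (λ x → 4ℚ ℚ.* (x ℚ.* β (suc a)) ℚ.+ 2ℚ ℚ.* β (suc a)) (fromℕ-suc a)))

D-closed : ∀ a e → D a (e ℕ.* 3 ℕ.+ a ℕ.* 2) ≡ closed a e
D-closed a zero = begin
  D a (a ℕ.* 2)
    ≡⟨ D-coefficient a (a ℕ.* 2) ⟩
  c ℚ.* V^ (4 ℕ.+ a ℕ.* 2) (suc (a ℕ.* 2)) ℚ.+ β a ℚ.* V^ (1 ℕ.+ a ℕ.* 2) (suc (a ℕ.* 2))
    ≡⟨ ≡.cong₂ (λ x y → c ℚ.* x ℚ.+ β a ℚ.* y) (V^-below (4 ℕ.+ a ℕ.* 2) (suc (a ℕ.* 2)) (ℕₚ.m≤n+m (2 ℕ.+ a ℕ.* 2) 2))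
         (V^-self (suc (a ℕ.* 2))) ⟩
  c ℚ.* 0ℚ ℚ.+ β a ℚ.* 1ℚ
    ≡⟨ solve 2 (λ c b → c :* :# 0 :+ b :* :1 := b :* :1) ≡.refl c (β a) ⟩
  β a ℚ.* 1ℚ
    ≡⟨ ≡.cong (β a ℚ.*_) (!*J (2 ℕ.+ a ℕ.* 2)) ⟨
  β a ℚ.* (fromℕ ((2 ℕ.+ a ℕ.* 2) !) ℚ.* J (2 ℕ.+ a ℕ.* 2))
    ≡⟨ ≡.cong₂ (λ x n → β a ℚ.* (x ℚ.* J (2 ℕ.+ n ℕ.* 2))) factorial (≡.sym (ℕₚ.+-identityʳ a)) ⟩
  β a ℚ.* (fromℕ (suc a) ℚ.* 2ℚ ℚ.* (fromℕ (suc (a ℕ.* 2)) ℚ.* f) ℚ.* j)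
    ≡⟨ solve 5 (λ b x y f j → b :* (x :* (:1 :+ :1) :* (y :* f) :* j)
         := b :* (y :* x :* :1 :* f :* (:1 :+ :1) :* :1 :* j)) ≡.refl (β a) (fromℕ (suc a)) (fromℕ (suc (a ℕ.* 2))) f j ⟩
  closed a 0 ∎
  where
  open ≡.≡-Reasoning
  open ℚ-Solver
  c f j : ℚ
  c = 2ℚ ℚ.* β (suc a) ℚ.- β (2 ℕ.+ a)
  f = fromℕ ((a ℕ.* 2) !)
  j = J (2 ℕ.+ (a ℕ.+ 0) ℕ.* 2)
  factorial : fromℕ ((2 ℕ.+ a ℕ.* 2) !) ≡ fromℕ (suc a) ℚ.* 2ℚ ℚ.* (fromℕ (suc (a ℕ.* 2)) ℚ.* f)
  factorial = ≡.trans (fromℕ-* (suc a ℕ.* 2) ((1 ℕ.+ a ℕ.* 2) !)) (≡.cong₂ ℚ._*_ (fromℕ-* (suc a) 2)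
    (fromℕ-* (1 ℕ.+ a ℕ.* 2) ((a ℕ.* 2) !)))
D-closed a (suc e) = begin
  D a (suc e ℕ.* 3 ℕ.+ a ℕ.* 2)
    ≡⟨ D-coefficient a (suc e ℕ.* 3 ℕ.+ a ℕ.* 2) ⟩
  c ℚ.* V^ (4 ℕ.+ a ℕ.* 2) (suc (suc e ℕ.* 3 ℕ.+ a ℕ.* 2)) ℚ.+ β a ℚ.* V^ (1 ℕ.+ a ℕ.* 2) (suc (suc e ℕ.* 3 ℕ.+ a ℕ.* 2))
    ≡⟨ ≡.cong₂ (λ x y → c ℚ.* x ℚ.+ β a ℚ.* y)
         (≡.trans (≡.cong (λ n → V^ (4 ℕ.+ a ℕ.* 2) (suc n)) (≡.sym index)) (V^-coefficient e (3 ℕ.+ a ℕ.* 2)))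
         (V^-coefficient (suc e) (a ℕ.* 2)) ⟩
  c ℚ.* lagrange e (3 ℕ.+ a ℕ.* 2) ℚ.+ β a ℚ.* lagrange (suc e) (a ℕ.* 2)
    ≡⟨ ≡.cong₂ (λ x y → c ℚ.* x ℚ.+ β a ℚ.* y)
         (≡.cong₂ ℚ._*_ (≡.cong₂ ℚ._*_ (≡.cong₂ ℚ._*_ (≡.cong (ℚ._* q) (≡.trans (fromℕ-+ 4 (a ℕ.* 2)) (≡.cong (4ℚ ℚ.+_) (fromℕ-* a 2))))
             (≡.cong (λ n → fromℕ (n !)) index))
           (≡.trans (J-suc e) (≡.cong (ℚ._* i) (fromℕ-suc e)))) (≡.cong J index₁))
         (≡.cong₂ ℚ._*_ (≡.cong₂ (λ x y → x ℚ.* y ℚ.* f ℚ.* i) (fromℕ-suc*2 a) (fromℕ-* 4 (4 ℕ.^ e)))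
           (≡.trans (J-suc (suc (a ℕ.* 2) ℕ.+ suc e ℕ.* 2)) (≡.cong₂ ℚ._*_
             (≡.trans (≡.cong fromℕ index₂) (≡.trans (fromℕ-+ 2 ((a ℕ.+ suc e) ℕ.* 2))
               (≡.cong (2ℚ ℚ.+_) (≡.trans (fromℕ-* (a ℕ.+ suc e) 2) (≡.cong (ℚ._* 2ℚ) (≡.trans (fromℕ-+ a (suc e)) (≡.cong (m ℚ.+_) (fromℕ-suc e))))))))
             (≡.cong J index₂)))) ⟩
  c ℚ.* ((4ℚ ℚ.+ m ℚ.* 2ℚ) ℚ.* q ℚ.* f ℚ.* ((1ℚ ℚ.+ ε) ℚ.* i) ℚ.* j)
    ℚ.+ β a ℚ.* ((1ℚ ℚ.+ m ℚ.* 2ℚ) ℚ.* (4ℚ ℚ.* q) ℚ.* f ℚ.* i ℚ.* ((2ℚ ℚ.+ (m ℚ.+ (1ℚ ℚ.+ ε)) ℚ.* 2ℚ) ℚ.* j))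
    ≡⟨ LQ.combine₁ (β-relation a) (q ℚ.* f ℚ.* ((1ℚ ℚ.+ ε) ℚ.* i) ℚ.* j)
         (solve 8 (λ c m q f ε i j b → let :2 = :1 :+ :1 ; :4 = :2 :+ :2 in
           c :* ((:4 :+ m :* :2) :* q :* f :* ((:1 :+ ε) :* i) :* j)
             :+ b :* ((:1 :+ m :* :2) :* (:4 :* q) :* f :* i :* ((:2 :+ (m :+ (:1 :+ ε)) :* :2) :* j))
             :- b :* ((:1 :+ m :* :2) :* (:1 :+ m) :* (:4 :* q) :* f :* :2 :* i :* j)
           := (q :* f :* ((:1 :+ ε) :* i) :* j) :* ((:4 :+ m :* :2) :* c :- (:- (:4 :* :2 :* (:1 :+ m :* :2) :* b))))
           ≡.refl c m q f ε i j (β a)) ⟩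
  β a ℚ.* ((1ℚ ℚ.+ m ℚ.* 2ℚ) ℚ.* (1ℚ ℚ.+ m) ℚ.* (4ℚ ℚ.* q) ℚ.* f ℚ.* 2ℚ ℚ.* i ℚ.* j)
    ≡⟨ ≡.cong (β a ℚ.*_) (≡.cong (λ x → x ℚ.* f ℚ.* 2ℚ ℚ.* i ℚ.* j) (≡.cong₂ ℚ._*_ (≡.cong₂ ℚ._*_ (fromℕ-suc*2 a) (fromℕ-suc a)) (fromℕ-* 4 (4 ℕ.^ e)))) ⟨
  closed a (suc e) ∎
  where
  open ≡.≡-Reasoning
  open ℚ-Solver
  c m q f ε i j : ℚ
  c = 2ℚ ℚ.* β (suc a) ℚ.- β (2 ℕ.+ a)
  m = fromℕ a
  q = fromℕ (4 ℕ.^ e)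
  f = fromℕ ((suc e ℕ.* 3 ℕ.+ a ℕ.* 2) !)
  ε = fromℕ e
  i = J (suc e)
  j = J (2 ℕ.+ (a ℕ.+ suc e) ℕ.* 2)
  index : e ℕ.* 3 ℕ.+ (3 ℕ.+ a ℕ.* 2) ≡ suc e ℕ.* 3 ℕ.+ a ℕ.* 2
  index = ≡.trans (≡.sym (ℕₚ.+-assoc (e ℕ.* 3) 3 (a ℕ.* 2))) (≡.cong (ℕ._+ a ℕ.* 2) (ℕₚ.+-comm (e ℕ.* 3) 3))
  index₁ : 4 ℕ.+ a ℕ.* 2 ℕ.+ e ℕ.* 2 ≡ 2 ℕ.+ (a ℕ.+ suc e) ℕ.* 2
  index₁ = ≡.cong (2 ℕ.+_) (≡.trans (≡.sym (≡.trans (ℕₚ.+-suc (a ℕ.* 2) (suc (e ℕ.* 2))) (≡.cong suc (ℕₚ.+-suc (a ℕ.* 2) (e ℕ.* 2)))))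
    (≡.sym (ℕₚ.*-distribʳ-+ 2 a (suc e))))
  index₂ : 2 ℕ.+ a ℕ.* 2 ℕ.+ suc e ℕ.* 2 ≡ 2 ℕ.+ (a ℕ.+ suc e) ℕ.* 2
  index₂ = ≡.cong (2 ℕ.+_) (≡.sym (ℕₚ.*-distribʳ-+ 2 a (suc e)))

-- Cross-multiplication reduces an equation with K n * diagonalRatio n a to one
-- between products of factorials.
module _ (n a : ℕ) where
  K-numerator K-denominator ratio-numerator ratio-denominator : ℕ
  K-numerator = 4 ℕ.^ n ℕ.* (3 ℕ.* n) !
  K-denominator = (n ℕ.+ 1) ! ℕ.* (2 ℕ.* n ℕ.+ 1) !
  ratio-numerator = (a ℕ.+ 1) ! ℕ.* (2 ℕ.* a ℕ.+ 1) ! ℕ.* n ! ℕ.* (3 ℕ.* n ∸ a) !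
  ratio-denominator = 4 ℕ.^ a ℕ.* (a !) ℕ.^ 3 ℕ.* (n ∸ a) ! ℕ.* (3 ℕ.* n) !

  instance
    K-denominator≢0 : ℕ.NonZero K-denominator
    K-denominator≢0 = ℕₚ.m*n≢0 ((n ℕ.+ 1) !) ((2 ℕ.* n ℕ.+ 1) !) {{(n ℕ.+ 1) ℕₚ.!≢0}} {{(2 ℕ.* n ℕ.+ 1) ℕₚ.!≢0}}
    ratio-denominator≢0 : ℕ.NonZero ratio-denominator
    ratio-denominator≢0 = ℕₚ.m*n≢0 (4 ℕ.^ a ℕ.* (a !) ℕ.^ 3 ℕ.* (n ∸ a) !) ((3 ℕ.* n) !)
      {{ℕₚ.m*n≢0 (4 ℕ.^ a ℕ.* (a !) ℕ.^ 3) ((n ∸ a) !)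
        {{ℕₚ.m*n≢0 (4 ℕ.^ a) ((a !) ℕ.^ 3) {{ℕₚ.m^n≢0 4 a}} {{ℕₚ.m^n≢0 (a !) 3 {{a ℕₚ.!≢0}}}}}}
        {{(n ∸ a) ℕₚ.!≢0}}}} {{(3 ℕ.* n) ℕₚ.!≢0}}

  K-eq : K n ℚ.* fromℕ K-denominator ≡ fromℕ K-numerator
  K-eq = fraction-* K-numerator K-denominator
  ratio-eq : diagonalRatio n a ℚ.* fromℕ ratio-denominator ≡ fromℕ ratio-numerator
  ratio-eq = fraction-* ratio-numerator ratio-denominator

  from-cross-multiplication : ∀ x →
    x ℚ.* (fromℕ K-denominator ℚ.* fromℕ ratio-denominator) ≡ fromℕ K-numerator ℚ.* fromℕ ratio-numerator →
    x ≡ K n ℚ.* diagonalRatio n a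
  from-cross-multiplication x hyp = LQ.regular-cancel {r = d ℚ.* d′}
    (LQ.regular-* {r = d} {s = d′} (≢0-regular (fromℕ-nonZero K-denominator)) (≢0-regular (fromℕ-nonZero ratio-denominator)))
    (begin
      d ℚ.* d′ ℚ.* x                        ≡⟨ ≡.trans (ℚₚ.*-comm (d ℚ.* d′) x) hyp ⟩
      fromℕ K-numerator ℚ.* fromℕ ratio-numerator    ≡⟨ ≡.cong₂ ℚ._*_ K-eq ratio-eq ⟨
      K n ℚ.* d ℚ.* (diagonalRatio n a ℚ.* d′)       ≡⟨ solve 4 (λ k d r d′ → k :* d :* (r :* d′) := d :* d′ :* (k :* r)) ≡.refl (K n) d (diagonalRatio n a) d′ ⟩
      d ℚ.* d′ ℚ.* (K n ℚ.* diagonalRatio n a) ∎)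
    where
    open ≡.≡-Reasoning
    open ℚ-Solver
    d d′ : ℚ
    d = fromℕ K-denominator
    d′ = fromℕ ratio-denominator

fromℕ-*₄ : ∀ a b c d → fromℕ (a ℕ.* b ℕ.* c ℕ.* d) ≡ fromℕ a ℚ.* fromℕ b ℚ.* fromℕ c ℚ.* fromℕ d
fromℕ-*₄ a b c d = ≡.trans (fromℕ-* (a ℕ.* b ℕ.* c) d) (≡.cong (ℚ._* fromℕ d)
  (≡.trans (fromℕ-* (a ℕ.* b) c) (≡.cong (ℚ._* fromℕ c) (fromℕ-* a b))))

closed-ratio : ∀ a e → closed a e ≡ K (a ℕ.+ e) ℚ.* diagonalRatio (a ℕ.+ e) a
closed-ratio a e = from-cross-multiplication n a (closed a e) (begin
  closed a e ℚ.* (fromℕ (K-denominator n a) ℚ.* fromℕ (ratio-denominator n a))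
    ≡⟨ ≡.cong (closed a e ℚ.*_) (≡.cong₂ ℚ._*_ K-den ratio-den) ⟩
  closed a e ℚ.* (((1ℚ ℚ.+ ν) ℚ.* n!) ℚ.* [2n+1]! ℚ.* (4^a ℚ.* (a! ℚ.* (a! ℚ.* (a! ℚ.* 1ℚ))) ℚ.* e! ℚ.* [3n]!))
    ≡⟨ generic ([2a]!) (J a) (fromℕ (suc (a ℕ.* 2))) (fromℕ (suc a)) 4^e m! (J e) j ν n! [2n+1]! 4^a a! e! [3n]! ⟩
  (4^a ℚ.* 4^e ℚ.* [3n]! ℚ.* ((fromℕ (suc a) ℚ.* a!) ℚ.* (fromℕ (suc (a ℕ.* 2)) ℚ.* [2a]!) ℚ.* n! ℚ.* m!))
    ℚ.* ((a! ℚ.* J a) ℚ.* (a! ℚ.* J a) ℚ.* (e! ℚ.* J e) ℚ.* ((2ℚ ℚ.+ ν ℚ.* 2ℚ) ℚ.* [2n+1]! ℚ.* j))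
    ≡⟨ ≡.cong₂ ℚ._*_ (≡.sym numerators) units ⟩
  fromℕ (K-numerator n a) ℚ.* fromℕ (ratio-numerator n a) ℚ.* 1ℚ
    ≡⟨ ℚₚ.*-identityʳ _ ⟩
  fromℕ (K-numerator n a) ℚ.* fromℕ (ratio-numerator n a) ∎)
  where
  open ≡.≡-Reasoning
  n : ℕ
  n = a ℕ.+ e
  ν n! [2n+1]! 4^a 4^e a! e! [3n]! [2a]! m! j : ℚ
  ν = fromℕ n
  n! = fromℕ (n !)
  [2n+1]! = fromℕ ((1 ℕ.+ n ℕ.* 2) !)
  4^a = fromℕ (4 ℕ.^ a)
  4^e = fromℕ (4 ℕ.^ e)
  a! = fromℕ (a !)
  e! = fromℕ (e !)
  [3n]! = fromℕ ((3 ℕ.* n) !)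
  [2a]! = fromℕ ((a ℕ.* 2) !)
  m! = fromℕ ((e ℕ.* 3 ℕ.+ a ℕ.* 2) !)
  j = J (2 ℕ.+ n ℕ.* 2)
  2*+1 : ∀ n → 2 ℕ.* n ℕ.+ 1 ≡ 1 ℕ.+ n ℕ.* 2
  2*+1 n = ≡.trans (ℕₚ.+-comm (2 ℕ.* n) 1) (≡.cong suc (ℕₚ.*-comm 2 n))
  [m+1]! : ∀ m → fromℕ ((m ℕ.+ 1) !) ≡ fromℕ (suc m) ℚ.* fromℕ (m !)
  [m+1]! m = ≡.trans (≡.cong (λ k → fromℕ (k !)) (ℕₚ.+-comm m 1)) (fromℕ-* (suc m) (m !))
  K-den : fromℕ (K-denominator n a) ≡ ((1ℚ ℚ.+ ν) ℚ.* n!) ℚ.* [2n+1]!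
  K-den = ≡.trans (fromℕ-* ((n ℕ.+ 1) !) ((2 ℕ.* n ℕ.+ 1) !)) (≡.cong₂ ℚ._*_
    (≡.trans ([m+1]! n) (≡.cong (ℚ._* n!) (fromℕ-suc n))) (≡.cong (λ k → fromℕ (k !)) (2*+1 n)))
  ratio-den : fromℕ (ratio-denominator n a) ≡ 4^a ℚ.* (a! ℚ.* (a! ℚ.* (a! ℚ.* 1ℚ))) ℚ.* e! ℚ.* [3n]!
  ratio-den = ≡.trans (fromℕ-*₄ (4 ℕ.^ a) ((a !) ℕ.^ 3) ((n ∸ a) !) ((3 ℕ.* n) !))
    (≡.cong₂ (λ x y → 4^a ℚ.* x ℚ.* y ℚ.* [3n]!)
      (≡.trans (fromℕ-* (a !) ((a !) ℕ.^ 2)) (≡.cong (a! ℚ.*_) (≡.trans (fromℕ-* (a !) ((a !) ℕ.^ 1)) (≡.cong (a! ℚ.*_) (fromℕ-* (a !) 1)))))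
      (≡.cong (λ k → fromℕ (k !)) (ℕₚ.m+n∸m≡n a e)))
  numerators : fromℕ (K-numerator n a) ℚ.* fromℕ (ratio-numerator n a) ≡
    4^a ℚ.* 4^e ℚ.* [3n]! ℚ.* ((fromℕ (suc a) ℚ.* a!) ℚ.* (fromℕ (suc (a ℕ.* 2)) ℚ.* [2a]!) ℚ.* n! ℚ.* m!)
  numerators = ≡.cong₂ ℚ._*_
    (≡.trans (fromℕ-* (4 ℕ.^ n) ((3 ℕ.* n) !)) (≡.cong (ℚ._* [3n]!)
      (≡.trans (≡.cong fromℕ (ℕₚ.^-distribˡ-+-* 4 a e)) (fromℕ-* (4 ℕ.^ a) (4 ℕ.^ e)))))
    (≡.trans (fromℕ-*₄ ((a ℕ.+ 1) !) ((2 ℕ.* a ℕ.+ 1) !) (n !) ((3 ℕ.* n ∸ a) !))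
      (≡.cong₂ ℚ._*_ (≡.cong (ℚ._* n!) (≡.cong₂ ℚ._*_ ([m+1]! a)
        (≡.trans (≡.cong (λ k → fromℕ (k !)) (2*+1 a)) (fromℕ-* (1 ℕ.+ a ℕ.* 2) ((a ℕ.* 2) !)))))
        (≡.cong (λ k → fromℕ (k !)) (length-eq a e))))
  units : (a! ℚ.* J a) ℚ.* (a! ℚ.* J a) ℚ.* (e! ℚ.* J e) ℚ.* ((2ℚ ℚ.+ ν ℚ.* 2ℚ) ℚ.* [2n+1]! ℚ.* j) ≡ 1ℚ
  units = ≡.cong₂ ℚ._*_ (≡.cong₂ ℚ._*_ (≡.cong₂ ℚ._*_ (!*J a) (!*J a)) (!*J e))
    (≡.trans (≡.cong (ℚ._* j) (≡.trans (≡.cong (ℚ._* [2n+1]!) (≡.sym (≡.trans (fromℕ-+ 2 (n ℕ.* 2)) (≡.cong (2ℚ ℚ.+_) (fromℕ-* n 2)))))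
      (≡.sym (fromℕ-* (2 ℕ.+ n ℕ.* 2) ((1 ℕ.+ n ℕ.* 2) !))))) (!*J (2 ℕ.+ n ℕ.* 2)))
  generic : ∀ f i x y q m i′ j ν n! g 4a a! e! h →
    f ℚ.* (i ℚ.* i) ℚ.* (x ℚ.* y ℚ.* q ℚ.* m ℚ.* 2ℚ ℚ.* i′ ℚ.* j) ℚ.*
      (((1ℚ ℚ.+ ν) ℚ.* n!) ℚ.* g ℚ.* (4a ℚ.* (a! ℚ.* (a! ℚ.* (a! ℚ.* 1ℚ))) ℚ.* e! ℚ.* h))
    ≡ (4a ℚ.* q ℚ.* h ℚ.* ((y ℚ.* a!) ℚ.* (x ℚ.* f) ℚ.* n! ℚ.* m))
      ℚ.* ((a! ℚ.* i) ℚ.* (a! ℚ.* i) ℚ.* (e! ℚ.* i′) ℚ.* ((2ℚ ℚ.+ ν ℚ.* 2ℚ) ℚ.* g ℚ.* j))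
  generic = solve 15 (λ f i x y q m i′ j ν n! g 4a a! e! h → let :2 = :1 :+ :1 in
    f :* (i :* i) :* (x :* y :* q :* m :* :2 :* i′ :* j) :*
      (((:1 :+ ν) :* n!) :* g :* (4a :* (a! :* (a! :* (a! :* :1))) :* e! :* h))
    := (4a :* q :* h :* ((y :* a!) :* (x :* f) :* n! :* m))
      :* ((a! :* i) :* (a! :* i) :* (e! :* i′) :* ((:2 :+ ν :* :2) :* g :* j))) ≡.refl
    where open ℚ-Solver

walks-closed : ∀ a e → fromℕ (k (3 ℕ.* (a ℕ.+ e) ∸ a) a a) ≡ closed a e
walks-closed a e = ≡.trans (≡.cong (λ m → fromℕ (k m a a)) (length-eq a e)) (D-closed a e)

walks-ratio : ∀ n a → a ℕ.≤ n → fromℕ (k (3 ℕ.* n ∸ a) a a) ≡ K n ℚ.* diagonalRatio n a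
walks-ratio n a a≤n = ≡.subst (λ n → fromℕ (k (3 ℕ.* n ∸ a) a a) ≡ K n ℚ.* diagonalRatio n a)
  (ℕₚ.m+[n∸m]≡n a≤n) (≡.trans (walks-closed a (n ∸ a)) (closed-ratio a (n ∸ a)))

-- Creative telescoping

-- With F(n,a) the number of walks of length 3n - a to (a , a), Zeilberger's method
-- gives a recurrence 𝒜(n) F(n+1,a) - ℬ(n) F(n,a) = G(a+1) - G(a), in which G is F
-- times a rational function with numerator built from φ.
module Certificate {c ℓ : Level} (R : CommutativeRing c ℓ) where
  open CommutativeRing R
  open IntegerCoefficients R
  open LinearCombination R

  # : ℕ → Carrier
  # n = fromℤ (+ n)

  𝒜 ℬ : Carrier → Carrier
  𝒜 n = (# 7 * n + # 5) * (n + # 2) * (# 4 * n + # 7) * (# 4 * n + # 9)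
  ℬ n = (# 7 * n + # 12) * (# 6 * (# 2 * n + # 1) * (# 6 * n + # 5) * (# 6 * n + # 7))

  φ : Carrier → Carrier → Carrier
  φ a n = (# 70 + # 138 * n + # 56 * (n * n)) * (a * a * a)
    - (# 510 + # 1634 * n + # 1648 * (n * n) + # 504 * (n * n * n)) * (a * a)
    - (# 724 + # 2588 * n + # 2784 * (n * n) + # 882 * (n * n * n)) * a
    - (# 96 + # 576 * n + # 864 * (n * n) + # 324 * (n * n * n))

  private
    :𝒜 :ℬ : ∀ {m} → Polynomial m → Polynomial m
    :𝒜 n = (:# 7 :* n :+ :# 5) :* (n :+ :# 2) :* (:# 4 :* n :+ :# 7) :* (:# 4 :* n :+ :# 9)
    :ℬ n = (:# 7 :* n :+ :# 12) :* (:# 6 :* (:# 2 :* n :+ :# 1) :* (:# 6 :* n :+ :# 5) :* (:# 6 :* n :+ :# 7))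
    :φ : ∀ {m} → Polynomial m → Polynomial m → Polynomial m
    :φ a n = (:# 70 :+ :# 138 :* n :+ :# 56 :* (n :* n)) :* (a :* a :* a)
      :- (:# 510 :+ :# 1634 :* n :+ :# 1648 :* (n :* n) :+ :# 504 :* (n :* n :* n)) :* (a :* a)
      :- (:# 724 :+ :# 2588 :* n :+ :# 2784 :* (n :* n) :+ :# 882 :* (n :* n :* n)) :* a
      :- (:# 96 :+ :# 576 :* n :+ :# 864 :* (n :* n) :+ :# 324 :* (n :* n :* n))

  -- The telescoping identity divided by its common hypergeometric factor, for
  -- a = b + 1 and n = a + e.
  polynomial-step : ∀ b e → let n = # 1 + b + e in
    𝒜 n * ((b + # 2) * # 4 * (# 2 * b + # 3 * e + # 3) * (# 2 * b + # 3 * e + # 4) * (# 2 * b + # 3 * e + # 5))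
      - ℬ n * ((b + # 2) * (e + # 1) * (# 2 * n + # 3) * (# 2 * n + # 4))
    ≈ (e + # 1) * (# 2 * n + # 4) * (# 2 * b + # 5) * φ (b + # 2) n
      - # 2 * (b + # 1) * (# 2 * b + # 3 * e + # 3) * (# 2 * n + # 4) * φ (b + # 1) n
  polynomial-step = solve 2 (λ b e → let n = :# 1 :+ b :+ e in
    :𝒜 n :* ((b :+ :# 2) :* :# 4 :* (:# 2 :* b :+ :# 3 :* e :+ :# 3) :* (:# 2 :* b :+ :# 3 :* e :+ :# 4) :* (:# 2 :* b :+ :# 3 :* e :+ :# 5))
      :- :ℬ n :* ((b :+ :# 2) :* (e :+ :# 1) :* (:# 2 :* n :+ :# 3) :* (:# 2 :* n :+ :# 4))
    := (e :+ :# 1) :* (:# 2 :* n :+ :# 4) :* (:# 2 :* b :+ :# 5) :* :φ (b :+ :# 2) n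
      :- :# 2 :* (b :+ :# 1) :* (:# 2 :* b :+ :# 3 :* e :+ :# 3) :* (:# 2 :* n :+ :# 4) :* :φ (b :+ :# 1) n) refl

  -- The case a = 0, where G(0) = 0.
  polynomial-start : ∀ e →
    # 4 * 𝒜 e * ((# 3 * e + # 1) * (# 3 * e + # 2) * (# 3 * e + # 3)) - ℬ e * ((e + # 1) * (# 2 * e + # 3) * (# 2 * e + # 4))
    ≈ # 3 * (e + # 1) * (# 2 * e + # 4) * φ (# 1) e
  polynomial-start = solve 1 (λ e →
    :# 4 :* :𝒜 e :* ((:# 3 :* e :+ :# 1) :* (:# 3 :* e :+ :# 2) :* (:# 3 :* e :+ :# 3)) :- :ℬ e :* ((e :+ :# 1) :* (:# 2 :* e :+ :# 3) :* (:# 2 :* e :+ :# 4))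
    := :# 3 :* (e :+ :# 1) :* (:# 2 :* e :+ :# 4) :* :φ (:# 1) e) refl

  -- The case a = n + 1, where F(n,a) and G(a+1) vanish.
  polynomial-end : ∀ n → # 2 * 𝒜 n * (# 2 * n + # 1) + φ (n + # 1) n ≈ 0#
  polynomial-end = solve 1 (λ n → :# 2 :* :𝒜 n :* (:# 2 :* n :+ :# 1) :+ :φ (n :+ :# 1) n := :# 0) refl

  -- The identities with the hypergeometric factors put back: β₀ and β₁ stand for
  -- consecutive central binomial coefficients, q for 4^e, f for a factorial, and i
  -- and j for reciprocal factorials.
  step : ∀ b e β₀ β₁ q f i j → let n = # 1 + b + e in
    (# 1 + b) * β₁ ≈ # 4 * (b * β₀) + # 2 * β₀ →
    𝒜 n * (β₁ * ((# 2 * b + # 3) * (b + # 2) * (# 4 * q) * ((# 2 * b + # 3 * e + # 5) * ((# 2 * b + # 3 * e + # 4) * ((# 2 * b + # 3 * e + # 3) * f))) * # 2 * i * j))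
      - ℬ n * (β₁ * ((# 2 * b + # 3) * (b + # 2) * q * f * # 2 * ((e + # 1) * i) * ((# 2 * n + # 3) * ((# 2 * n + # 4) * j))))
    ≈ β₁ * ((# 2 * b + # 3) * q * f * # 2 * ((e + # 1) * i) * j * (# 2 * n + # 4) * (# 2 * b + # 5) * φ (b + # 2) n)
      - β₀ * ((# 2 * b + # 1) * (# 4 * q) * ((# 2 * b + # 3 * e + # 3) * f) * # 2 * i * j * (# 2 * n + # 4) * (# 2 * b + # 3) * φ (b + # 1) n)
  step b e β₀ β₁ q f i j hyp = combine₂ hyp (polynomial-step b e)
    (- (# 2 * (q * ((# 2 * b + # 3 * e + # 3) * f) * # 2 * i * j * (# 2 * n + # 4) * (# 2 * b + # 3) * φ₁)))
    (β₁ * ((# 2 * b + # 3) * q * f * # 2 * i * j))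
    (solve 13 (λ b e n β₀ β₁ q f i j A B φ₁ φ₂ →
      (A :* (β₁ :* ((:# 2 :* b :+ :# 3) :* (b :+ :# 2) :* (:# 4 :* q) :* ((:# 2 :* b :+ :# 3 :* e :+ :# 5) :* ((:# 2 :* b :+ :# 3 :* e :+ :# 4) :* ((:# 2 :* b :+ :# 3 :* e :+ :# 3) :* f))) :* :# 2 :* i :* j))
      :- B :* (β₁ :* ((:# 2 :* b :+ :# 3) :* (b :+ :# 2) :* q :* f :* :# 2 :* ((e :+ :# 1) :* i) :* ((:# 2 :* n :+ :# 3) :* ((:# 2 :* n :+ :# 4) :* j)))))
      :- (β₁ :* ((:# 2 :* b :+ :# 3) :* q :* f :* :# 2 :* ((e :+ :# 1) :* i) :* j :* (:# 2 :* n :+ :# 4) :* (:# 2 :* b :+ :# 5) :* φ₂)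
      :- β₀ :* ((:# 2 :* b :+ :# 1) :* (:# 4 :* q) :* ((:# 2 :* b :+ :# 3 :* e :+ :# 3) :* f) :* :# 2 :* i :* j :* (:# 2 :* n :+ :# 4) :* (:# 2 :* b :+ :# 3) :* φ₁))
      := (:- (:# 2 :* (q :* ((:# 2 :* b :+ :# 3 :* e :+ :# 3) :* f) :* :# 2 :* i :* j :* (:# 2 :* n :+ :# 4) :* (:# 2 :* b :+ :# 3) :* φ₁)))
          :* ((:# 1 :+ b) :* β₁ :- (:# 4 :* (b :* β₀) :+ :# 2 :* β₀))
        :+ (β₁ :* ((:# 2 :* b :+ :# 3) :* q :* f :* :# 2 :* i :* j))
          :* ((A :* ((b :+ :# 2) :* :# 4 :* (:# 2 :* b :+ :# 3 :* e :+ :# 3) :* (:# 2 :* b :+ :# 3 :* e :+ :# 4) :* (:# 2 :* b :+ :# 3 :* e :+ :# 5))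
              :- B :* ((b :+ :# 2) :* (e :+ :# 1) :* (:# 2 :* n :+ :# 3) :* (:# 2 :* n :+ :# 4)))
            :- ((e :+ :# 1) :* (:# 2 :* n :+ :# 4) :* (:# 2 :* b :+ :# 5) :* φ₂
              :- :# 2 :* (b :+ :# 1) :* (:# 2 :* b :+ :# 3 :* e :+ :# 3) :* (:# 2 :* n :+ :# 4) :* φ₁)))
      refl b e n β₀ β₁ q f i j (𝒜 n) (ℬ n) φ₁ (φ (b + # 2) n))
    where
    n φ₁ : Carrier
    n = # 1 + b + e
    φ₁ = φ (b + # 1) n

  start : ∀ e q f i j →
    𝒜 e * (# 1 * (# 1 * # 1 * (# 4 * q) * ((# 3 * e + # 3) * ((# 3 * e + # 2) * ((# 3 * e + # 1) * f))) * # 2 * i * j))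
      - ℬ e * (# 1 * (# 1 * # 1 * q * f * # 2 * ((e + # 1) * i) * ((# 2 * e + # 3) * ((# 2 * e + # 4) * j))))
    ≈ # 1 * (# 1 * q * f * # 2 * ((e + # 1) * i) * j * (# 2 * e + # 4) * # 3 * φ (# 1) e)
  start e q f i j = combine₁ (polynomial-start e) (q * f * # 2 * i * j)
    (solve 8 (λ e q f i j A B φ₁ →
      A :* (:# 1 :* (:# 1 :* :# 1 :* (:# 4 :* q) :* ((:# 3 :* e :+ :# 3) :* ((:# 3 :* e :+ :# 2) :* ((:# 3 :* e :+ :# 1) :* f))) :* :# 2 :* i :* j))
      :- B :* (:# 1 :* (:# 1 :* :# 1 :* q :* f :* :# 2 :* ((e :+ :# 1) :* i) :* ((:# 2 :* e :+ :# 3) :* ((:# 2 :* e :+ :# 4) :* j))))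
      :- (:# 1 :* (:# 1 :* q :* f :* :# 2 :* ((e :+ :# 1) :* i) :* j :* (:# 2 :* e :+ :# 4) :* :# 3 :* φ₁))
      := (q :* f :* :# 2 :* i :* j) :*
        ((:# 4 :* A :* ((:# 3 :* e :+ :# 1) :* (:# 3 :* e :+ :# 2) :* (:# 3 :* e :+ :# 3)) :- B :* ((e :+ :# 1) :* (:# 2 :* e :+ :# 3) :* (:# 2 :* e :+ :# 4)))
        :- (:# 3 :* (e :+ :# 1) :* (:# 2 :* e :+ :# 4) :* φ₁)))
      refl e q f i j (𝒜 e) (ℬ e) (φ (# 1) e))

  end : ∀ n β₀ β₁ f j → (# 1 + n) * β₁ ≈ # 4 * (n * β₀) + # 2 * β₀ →
    𝒜 n * (β₁ * ((# 2 * n + # 3) * (n + # 2) * # 1 * ((# 2 * n + # 2) * ((# 2 * n + # 1) * f)) * # 2 * # 1 * j))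
      + β₀ * ((# 2 * n + # 1) * # 1 * f * # 2 * # 1 * j * (# 2 * n + # 4) * (# 2 * n + # 3) * φ (n + # 1) n) ≈ 0#
  end n β₀ β₁ f j hyp = combine₂ hyp (polynomial-end n)
    (# 4 * 𝒜 n * (# 2 * n + # 3) * (n + # 2) * (# 2 * n + # 1) * f * j)
    (# 4 * β₀ * (# 2 * n + # 1) * f * j * (n + # 2) * (# 2 * n + # 3))
    (solve 7 (λ n β₀ β₁ f j A φ₁ →
      A :* (β₁ :* ((:# 2 :* n :+ :# 3) :* (n :+ :# 2) :* :# 1 :* ((:# 2 :* n :+ :# 2) :* ((:# 2 :* n :+ :# 1) :* f)) :* :# 2 :* :# 1 :* j))
      :+ β₀ :* ((:# 2 :* n :+ :# 1) :* :# 1 :* f :* :# 2 :* :# 1 :* j :* (:# 2 :* n :+ :# 4) :* (:# 2 :* n :+ :# 3) :* φ₁) :- :# 0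
      := (:# 4 :* A :* (:# 2 :* n :+ :# 3) :* (n :+ :# 2) :* (:# 2 :* n :+ :# 1) :* f :* j)
          :* ((:# 1 :+ n) :* β₁ :- (:# 4 :* (n :* β₀) :+ :# 2 :* β₀))
        :+ (:# 4 :* β₀ :* (:# 2 :* n :+ :# 1) :* f :* j :* (n :+ :# 2) :* (:# 2 :* n :+ :# 3))
          :* (:# 2 :* A :* (:# 2 :* n :+ :# 1) :+ φ₁ :- :# 0))
      refl n β₀ β₁ f j (𝒜 n) (φ (n + # 1) n))

open Certificate ℚ-ring using (𝒜; ℬ; φ; step; start; end) renaming (# to #ℚ)

-- The value G(b+1), for n = b + e.
certificate : ℕ → ℕ → ℚ
certificate b e = β b ℚ.* ((#ℚ 2 ℚ.* fromℕ b ℚ.+ #ℚ 1) ℚ.* fromℕ (4 ℕ.^ e) ℚ.* fromℕ ((e ℕ.* 3 ℕ.+ b ℕ.* 2) !)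
  ℚ.* #ℚ 2 ℚ.* J e ℚ.* J (4 ℕ.+ (b ℕ.+ e) ℕ.* 2)
  ℚ.* (#ℚ 2 ℚ.* fromℕ (b ℕ.+ e) ℚ.+ #ℚ 4) ℚ.* (#ℚ 2 ℚ.* fromℕ b ℚ.+ #ℚ 3) ℚ.* φ (fromℕ b ℚ.+ #ℚ 1) (fromℕ (b ℕ.+ e)))

private
  same : (x : ℚ) → x ≡ x
  same x = ≡.refl

  closed-shape : ℚ → ℚ → ℚ → ℚ → ℚ → ℚ → ℚ → ℚ
  closed-shape b x y q f i j = b ℚ.* (x ℚ.* y ℚ.* q ℚ.* f ℚ.* #ℚ 2 ℚ.* i ℚ.* j)

  closed-cong : ∀ b {x x′ y y′ q q′ f f′ i i′ j j′} →
    x ≡ x′ → y ≡ y′ → q ≡ q′ → f ≡ f′ → i ≡ i′ → j ≡ j′ →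
    closed-shape b x y q f i j ≡ closed-shape b x′ y′ q′ f′ i′ j′
  closed-cong b ≡.refl ≡.refl ≡.refl ≡.refl ≡.refl ≡.refl = ≡.refl

  certificate-shape : ℚ → ℚ → ℚ → ℚ → ℚ → ℚ → ℚ → ℚ → ℚ → ℚ
  certificate-shape b x q f i j y z w = b ℚ.* (x ℚ.* q ℚ.* f ℚ.* #ℚ 2 ℚ.* i ℚ.* j ℚ.* y ℚ.* z ℚ.* w)

  certificate-cong : ∀ b {x x′ q q′ f f′ i i′ j j′ y y′ z z′ w w′} →
    x ≡ x′ → q ≡ q′ → f ≡ f′ → i ≡ i′ → j ≡ j′ → y ≡ y′ → z ≡ z′ → w ≡ w′ →
    certificate-shape b x q f i j y z w ≡ certificate-shape b x′ q′ f′ i′ j′ y′ z′ w′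
  certificate-cong b ≡.refl ≡.refl ≡.refl ≡.refl ≡.refl ≡.refl ≡.refl ≡.refl = ≡.refl

  fromℕ-!-suc : ∀ n → fromℕ (suc n !) ≡ fromℕ (suc n) ℚ.* fromℕ (n !)
  fromℕ-!-suc n = fromℕ-* (suc n) (n !)

  fromℕ-+* : ∀ c e b → fromℕ (c ℕ.+ (e ℕ.* 3 ℕ.+ b ℕ.* 2)) ≡ #ℚ 2 ℚ.* fromℕ b ℚ.+ #ℚ 3 ℚ.* fromℕ e ℚ.+ fromℕ c
  fromℕ-+* c e b = ≡.trans (fromℕ-+ c (e ℕ.* 3 ℕ.+ b ℕ.* 2)) (≡.trans
    (≡.cong (fromℕ c ℚ.+_) (≡.trans (fromℕ-+ (e ℕ.* 3) (b ℕ.* 2)) (≡.cong₂ ℚ._+_ (fromℕ-* e 3) (fromℕ-* b 2))))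
    (solve 3 (λ c e b → c :+ (e :* :# 3 :+ b :* :# 2) := :# 2 :* b :+ :# 3 :* e :+ c) ≡.refl (fromℕ c) (fromℕ e) (fromℕ b)))
    where open ℚ-Solver

  fromℕ-+*2 : ∀ c n → fromℕ (c ℕ.+ n ℕ.* 2) ≡ #ℚ 2 ℚ.* fromℕ n ℚ.+ fromℕ c
  fromℕ-+*2 c n = ≡.trans (fromℕ-+ c (n ℕ.* 2)) (≡.trans (≡.cong (fromℕ c ℚ.+_) (fromℕ-* n 2))
    (solve 2 (λ c n → c :+ n :* :# 2 := :# 2 :* n :+ c) ≡.refl (fromℕ c) (fromℕ n)))
    where open ℚ-Solver

  fromℕ-+ʳ : ∀ c n → fromℕ (c ℕ.+ n) ≡ fromℕ n ℚ.+ fromℕ c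
  fromℕ-+ʳ c n = ≡.trans (fromℕ-+ c n) (ℚₚ.+-comm (fromℕ c) (fromℕ n))

  J-suc′ : ∀ e → J e ≡ (fromℕ e ℚ.+ #ℚ 1) ℚ.* J (suc e)
  J-suc′ e = ≡.trans (J-suc e) (≡.cong (ℚ._* J (suc e)) (fromℕ-+ʳ 1 e))

  J-2+ : ∀ n → J (2 ℕ.+ n ℕ.* 2) ≡ (#ℚ 2 ℚ.* fromℕ n ℚ.+ #ℚ 3) ℚ.* ((#ℚ 2 ℚ.* fromℕ n ℚ.+ #ℚ 4) ℚ.* J (4 ℕ.+ n ℕ.* 2))
  J-2+ n = ≡.trans (J-suc (2 ℕ.+ n ℕ.* 2)) (≡.cong₂ ℚ._*_ (fromℕ-+*2 3 n)
    (≡.trans (J-suc (3 ℕ.+ n ℕ.* 2)) (≡.cong (ℚ._* J (4 ℕ.+ n ℕ.* 2)) (fromℕ-+*2 4 n))))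

  β-suc′ : ∀ b → (#ℚ 1 ℚ.+ fromℕ b) ℚ.* β (suc b) ≡ #ℚ 4 ℚ.* (fromℕ b ℚ.* β b) ℚ.+ #ℚ 2 ℚ.* β b
  β-suc′ b = ≡.trans (≡.cong (ℚ._* β (suc b)) (≡.sym (fromℕ-+ 1 b))) (β-suc b)

  2+ : ∀ e b → e ℕ.* 3 ℕ.+ suc b ℕ.* 2 ≡ 2 ℕ.+ (e ℕ.* 3 ℕ.+ b ℕ.* 2)
  2+ e b = ≡.trans (ℕₚ.+-suc (e ℕ.* 3) (suc (b ℕ.* 2))) (≡.cong suc (ℕₚ.+-suc (e ℕ.* 3) (b ℕ.* 2)))

  factorial-3 : ∀ m → fromℕ ((3 ℕ.+ m) !) ≡ fromℕ (3 ℕ.+ m) ℚ.* (fromℕ (2 ℕ.+ m) ℚ.* (fromℕ (1 ℕ.+ m) ℚ.* fromℕ (m !)))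
  factorial-3 m = ≡.trans (fromℕ-!-suc (2 ℕ.+ m)) (≡.cong (fromℕ (3 ℕ.+ m) ℚ.*_)
    (≡.trans (fromℕ-!-suc (1 ℕ.+ m)) (≡.cong (fromℕ (2 ℕ.+ m) ℚ.*_) (fromℕ-!-suc m))))

certificate-step : ∀ b e → let n = fromℕ (suc b ℕ.+ e) in
  𝒜 n ℚ.* closed (suc b) (suc e) ℚ.- ℬ n ℚ.* closed (suc b) e ≡ certificate (suc b) e ℚ.- certificate b (suc e)
certificate-step b e = begin
  𝒜 ν ℚ.* closed (suc b) (suc e) ℚ.- ℬ ν ℚ.* closed (suc b) e
    ≡⟨ ≡.cong₂ ℚ._-_
         (≡.cong₂ ℚ._*_ (≡.cong 𝒜 ν≡) (closed-cong (β (suc b)) (fromℕ-+*2 3 b) (fromℕ-+ʳ 2 b) (fromℕ-* 4 (4 ℕ.^ e)) factorial-F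
           (same (J (suc e))) (≡.cong (λ m → J (2 ℕ.+ m ℕ.* 2)) (ℕₚ.+-suc (suc b) e))))
         (≡.cong₂ ℚ._*_ (≡.cong ℬ ν≡) (closed-cong (β (suc b)) (fromℕ-+*2 3 b) (fromℕ-+ʳ 2 b) (same (fromℕ (4 ℕ.^ e))) (same f)
           (J-suc′ e) (≡.trans (J-2+ (suc b ℕ.+ e)) (≡.cong (λ ν → (#ℚ 2 ℚ.* ν ℚ.+ #ℚ 3) ℚ.* ((#ℚ 2 ℚ.* ν ℚ.+ #ℚ 4) ℚ.* j)) ν≡)))) ⟩
  _
    ≡⟨ step (fromℕ b) (fromℕ e) (β b) (β (suc b)) (fromℕ (4 ℕ.^ e)) f (J (suc e)) j (β-suc′ b) ⟩
  _
    ≡⟨ ≡.cong₂ ℚ._-_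
         (certificate-cong (β (suc b)) (≡.sym (≡.trans (≡.cong (λ x → #ℚ 2 ℚ.* x ℚ.+ #ℚ 1) (fromℕ-+ʳ 1 b)) (shift₁ (fromℕ b))))
           (same (fromℕ (4 ℕ.^ e))) (same f) (≡.sym (J-suc′ e)) (same j) (≡.cong (λ ν → #ℚ 2 ℚ.* ν ℚ.+ #ℚ 4) (≡.sym ν≡))
           (≡.sym (≡.trans (≡.cong (λ x → #ℚ 2 ℚ.* x ℚ.+ #ℚ 3) (fromℕ-+ʳ 1 b)) (shift₃ (fromℕ b))))
           (≡.cong₂ φ (≡.sym (≡.trans (≡.cong (ℚ._+ #ℚ 1) (fromℕ-+ʳ 1 b)) (ℚₚ.+-assoc (fromℕ b) (#ℚ 1) (#ℚ 1)))) (≡.sym ν≡)))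
         (certificate-cong (β b) (same (#ℚ 2 ℚ.* fromℕ b ℚ.+ #ℚ 1)) (≡.sym (fromℕ-* 4 (4 ℕ.^ e))) factorial-G (same (J (suc e)))
           (≡.cong (λ m → J (4 ℕ.+ m ℕ.* 2)) (≡.sym (ℕₚ.+-suc b e)))
           (≡.cong (λ ν → #ℚ 2 ℚ.* ν ℚ.+ #ℚ 4) ν≡′) (same (#ℚ 2 ℚ.* fromℕ b ℚ.+ #ℚ 3))
           (≡.cong (φ (fromℕ b ℚ.+ #ℚ 1)) ν≡′)) ⟩
  certificate (suc b) e ℚ.- certificate b (suc e) ∎
  where
  open ≡.≡-Reasoning
  ν f j : ℚ
  ν = fromℕ (suc b ℕ.+ e)
  f = fromℕ ((e ℕ.* 3 ℕ.+ suc b ℕ.* 2) !)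
  j = J (4 ℕ.+ (suc b ℕ.+ e) ℕ.* 2)
  ν≡ : ν ≡ #ℚ 1 ℚ.+ fromℕ b ℚ.+ fromℕ e
  ν≡ = ≡.trans (fromℕ-+ (suc b) e) (≡.cong (ℚ._+ fromℕ e) (fromℕ-+ 1 b))
  ν≡′ : #ℚ 1 ℚ.+ fromℕ b ℚ.+ fromℕ e ≡ fromℕ (b ℕ.+ suc e)
  ν≡′ = ≡.trans (≡.sym ν≡) (≡.cong fromℕ (≡.sym (ℕₚ.+-suc b e)))
  shift₁ : ∀ x → #ℚ 2 ℚ.* (x ℚ.+ #ℚ 1) ℚ.+ #ℚ 1 ≡ #ℚ 2 ℚ.* x ℚ.+ #ℚ 3
  shift₁ = solve 1 (λ x → :# 2 :* (x :+ :# 1) :+ :# 1 := :# 2 :* x :+ :# 3) ≡.refl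
    where open ℚ-Solver
  shift₃ : ∀ x → #ℚ 2 ℚ.* (x ℚ.+ #ℚ 1) ℚ.+ #ℚ 3 ≡ #ℚ 2 ℚ.* x ℚ.+ #ℚ 5
  shift₃ = solve 1 (λ x → :# 2 :* (x :+ :# 1) :+ :# 3 := :# 2 :* x :+ :# 5) ≡.refl
    where open ℚ-Solver
  index : ∀ c → fromℕ (c ℕ.+ (e ℕ.* 3 ℕ.+ suc b ℕ.* 2)) ≡ #ℚ 2 ℚ.* fromℕ b ℚ.+ #ℚ 3 ℚ.* fromℕ e ℚ.+ fromℕ (2 ℕ.+ c)
  index c = ≡.trans (≡.cong fromℕ (≡.trans (≡.cong (c ℕ.+_) (2+ e b)) (≡.trans (≡.sym (ℕₚ.+-assoc c 2 _))
    (≡.cong (ℕ._+ (e ℕ.* 3 ℕ.+ b ℕ.* 2)) (ℕₚ.+-comm c 2))))) (fromℕ-+* (2 ℕ.+ c) e b)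
  factorial-F : fromℕ ((suc e ℕ.* 3 ℕ.+ suc b ℕ.* 2) !) ≡ (#ℚ 2 ℚ.* fromℕ b ℚ.+ #ℚ 3 ℚ.* fromℕ e ℚ.+ #ℚ 5) ℚ.*
    ((#ℚ 2 ℚ.* fromℕ b ℚ.+ #ℚ 3 ℚ.* fromℕ e ℚ.+ #ℚ 4) ℚ.* ((#ℚ 2 ℚ.* fromℕ b ℚ.+ #ℚ 3 ℚ.* fromℕ e ℚ.+ #ℚ 3) ℚ.* f))
  factorial-F = ≡.trans (factorial-3 (e ℕ.* 3 ℕ.+ suc b ℕ.* 2))
    (≡.cong₂ ℚ._*_ (index 3) (≡.cong₂ ℚ._*_ (index 2) (≡.cong (ℚ._* f) (index 1))))
  factorial-G : (#ℚ 2 ℚ.* fromℕ b ℚ.+ #ℚ 3 ℚ.* fromℕ e ℚ.+ #ℚ 3) ℚ.* f ≡ fromℕ ((suc e ℕ.* 3 ℕ.+ b ℕ.* 2) !)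
  factorial-G = ≡.sym (≡.trans (fromℕ-!-suc (2 ℕ.+ (e ℕ.* 3 ℕ.+ b ℕ.* 2))) (≡.cong₂ ℚ._*_ (fromℕ-+* 3 e b)
    (≡.cong (λ m → fromℕ (m !)) (≡.sym (2+ e b)))))

certificate-start : ∀ e → 𝒜 (fromℕ e) ℚ.* closed 0 (suc e) ℚ.- ℬ (fromℕ e) ℚ.* closed 0 e ≡ certificate 0 e
certificate-start e = ≡.trans
  (≡.cong₂ ℚ._-_
    (≡.cong (𝒜 (fromℕ e) ℚ.*_) (closed-cong 1ℚ (same 1ℚ) (same 1ℚ) (fromℕ-* 4 (4 ℕ.^ e)) factorial-F (same (J (suc e))) (same (J (4 ℕ.+ e ℕ.* 2)))))
    (≡.cong (ℬ (fromℕ e) ℚ.*_) (closed-cong 1ℚ (same 1ℚ) (same 1ℚ) (same (fromℕ (4 ℕ.^ e))) (same f) (J-suc′ e) (J-2+ e))))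
  (≡.trans (start (fromℕ e) (fromℕ (4 ℕ.^ e)) f (J (suc e)) (J (4 ℕ.+ e ℕ.* 2)))
    (certificate-cong 1ℚ (same 1ℚ) (same (fromℕ (4 ℕ.^ e))) (same f) (≡.sym (J-suc′ e)) (same (J (4 ℕ.+ e ℕ.* 2)))
      (same (#ℚ 2 ℚ.* fromℕ e ℚ.+ #ℚ 4)) (same (#ℚ 3)) (same (φ (#ℚ 1) (fromℕ e)))))
  where
  f : ℚ
  f = fromℕ ((e ℕ.* 3 ℕ.+ 0) !)
  index : ∀ c → fromℕ (c ℕ.+ (e ℕ.* 3 ℕ.+ 0)) ≡ #ℚ 3 ℚ.* fromℕ e ℚ.+ fromℕ c
  index c = ≡.trans (≡.cong (λ m → fromℕ (c ℕ.+ m)) (ℕₚ.+-identityʳ (e ℕ.* 3)))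
    (≡.trans (fromℕ-+ʳ c (e ℕ.* 3)) (≡.cong (ℚ._+ fromℕ c) (≡.trans (fromℕ-* e 3) (ℚₚ.*-comm (fromℕ e) (#ℚ 3)))))
  factorial-F : fromℕ ((suc e ℕ.* 3 ℕ.+ 0) !) ≡ (#ℚ 3 ℚ.* fromℕ e ℚ.+ #ℚ 3) ℚ.*
    ((#ℚ 3 ℚ.* fromℕ e ℚ.+ #ℚ 2) ℚ.* ((#ℚ 3 ℚ.* fromℕ e ℚ.+ #ℚ 1) ℚ.* f))
  factorial-F = ≡.trans (factorial-3 (e ℕ.* 3 ℕ.+ 0))
    (≡.cong₂ ℚ._*_ (index 3) (≡.cong₂ ℚ._*_ (index 2) (≡.cong (ℚ._* f) (index 1))))

certificate-end : ∀ n → 𝒜 (fromℕ n) ℚ.* closed (suc n) 0 ℚ.+ certificate n 0 ≡ 0ℚ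
certificate-end n = ≡.trans
  (≡.cong₂ ℚ._+_
    (≡.cong (𝒜 (fromℕ n) ℚ.*_) (closed-cong (β (suc n)) (fromℕ-+*2 3 n) (fromℕ-+ʳ 2 n) (same 1ℚ) factorial-F (same 1ℚ)
      (≡.cong (λ m → J (4 ℕ.+ m ℕ.* 2)) (ℕₚ.+-identityʳ n))))
    (≡.cong (λ m → certificate-shape (β n) (#ℚ 2 ℚ.* fromℕ n ℚ.+ #ℚ 1) (#ℚ 1) (fromℕ ((n ℕ.* 2) !)) (#ℚ 1) (J (4 ℕ.+ m ℕ.* 2))
      (#ℚ 2 ℚ.* fromℕ m ℚ.+ #ℚ 4) (#ℚ 2 ℚ.* fromℕ n ℚ.+ #ℚ 3) (φ (fromℕ n ℚ.+ #ℚ 1) (fromℕ m))) (ℕₚ.+-identityʳ n)))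
  (end (fromℕ n) (β n) (β (suc n)) (fromℕ ((n ℕ.* 2) !)) (J (4 ℕ.+ n ℕ.* 2)) (β-suc′ n))
  where
  factorial-F : fromℕ ((suc n ℕ.* 2) !) ≡ (#ℚ 2 ℚ.* fromℕ n ℚ.+ #ℚ 2) ℚ.* ((#ℚ 2 ℚ.* fromℕ n ℚ.+ #ℚ 1) ℚ.* fromℕ ((n ℕ.* 2) !))
  factorial-F = ≡.trans (fromℕ-!-suc (1 ℕ.+ n ℕ.* 2)) (≡.cong₂ ℚ._*_ (fromℕ-+*2 2 n)
    (≡.trans (fromℕ-!-suc (n ℕ.* 2)) (≡.cong (ℚ._* fromℕ ((n ℕ.* 2) !)) (fromℕ-+*2 1 n))))

-- The sum over the diagonal


-- The sum f(0) + ... + f(n-1), with the last term split off.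
Σ< : ℕ → (ℕ → ℚ) → ℚ
Σ< zero    f = 0ℚ
Σ< (suc n) f = Σ< n f ℚ.+ f n

sumℚ-Σ< : ∀ n f → sumℚ {n} (λ i → f (toℕ i)) ≡ Σ< n f
sumℚ-Σ< zero    f = ≡.refl
sumℚ-Σ< (suc n) f = ≡.trans (≡.cong (f 0 ℚ.+_) (sumℚ-Σ< n (λ i → f (suc i)))) (first n)
  where
  first : ∀ n → f 0 ℚ.+ Σ< n (λ i → f (suc i)) ≡ Σ< n f ℚ.+ f n
  first zero    = ℚₚ.+-comm (f 0) 0ℚ
  first (suc n) = ≡.trans (≡.sym (ℚₚ.+-assoc (f 0) (Σ< n (λ i → f (suc i))) (f (suc n)))) (≡.cong (ℚ._+ f (suc n)) (first n))

productℚ-last : ∀ n (f : ℕ → ℚ) → productℚ {suc n} (λ i → f (toℕ i)) ≡ productℚ {n} (λ i → f (toℕ i)) ℚ.* f n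
productℚ-last zero    f = ℚₚ.*-comm (f 0) 1ℚ
productℚ-last (suc n) f = ≡.trans (≡.cong (f 0 ℚ.*_) (productℚ-last n (λ i → f (suc i))))
  (≡.sym (ℚₚ.*-assoc (f 0) (productℚ {n} (λ i → f (suc (toℕ i)))) (f (suc n))))

Σ<-cong : ∀ n {f g : ℕ → ℚ} → (∀ i → i ℕ.< n → f i ≡ g i) → Σ< n f ≡ Σ< n g
Σ<-cong zero    p = ≡.refl
Σ<-cong (suc n) p = ≡.cong₂ ℚ._+_ (Σ<-cong n (λ i i<n → p i (ℕₚ.m≤n⇒m≤1+n i<n))) (p n ℕₚ.≤-refl)

-- The number of walks of length 3n - a to (a , a), for a at most n.
summand : ℕ → ℕ → ℚ
summand n a = closed a (n ∸ a)

summand-+ : ∀ a e → summand (a ℕ.+ e) a ≡ closed a e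
summand-+ a e = ≡.cong (closed a) (ℕₚ.m+n∸m≡n a e)

summand-+′ : ∀ a e → summand (suc (a ℕ.+ e)) a ≡ closed a (suc e)
summand-+′ a e = ≡.trans (≡.cong (λ n → summand n a) (≡.sym (ℕₚ.+-suc a e))) (summand-+ a (suc e))

-- The partial sums of the telescoping identity.
telescope : ∀ b e n → n ≡ b ℕ.+ e →
  𝒜 (fromℕ n) ℚ.* Σ< (suc b) (summand (suc n)) ℚ.- ℬ (fromℕ n) ℚ.* Σ< (suc b) (summand n) ≡ certificate b e
telescope zero e n ≡.refl = begin
  𝒜 ν ℚ.* (0ℚ ℚ.+ closed 0 (suc e)) ℚ.- ℬ ν ℚ.* (0ℚ ℚ.+ closed 0 e)
    ≡⟨ ≡.cong₂ (λ x y → 𝒜 ν ℚ.* x ℚ.- ℬ ν ℚ.* y) (ℚₚ.+-identityˡ (closed 0 (suc e))) (ℚₚ.+-identityˡ (closed 0 e)) ⟩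
  𝒜 ν ℚ.* closed 0 (suc e) ℚ.- ℬ ν ℚ.* closed 0 e
    ≡⟨ certificate-start e ⟩
  certificate 0 e ∎
  where
  open ≡.≡-Reasoning
  ν = fromℕ e
telescope (suc b) e n ≡.refl = begin
  𝒜 ν ℚ.* (s₁ ℚ.+ summand (suc n) (suc b)) ℚ.- ℬ ν ℚ.* (s₀ ℚ.+ summand n (suc b))
    ≡⟨ ≡.cong₂ (λ x y → 𝒜 ν ℚ.* (s₁ ℚ.+ x) ℚ.- ℬ ν ℚ.* (s₀ ℚ.+ y)) (summand-+′ (suc b) e) (summand-+ (suc b) e) ⟩
  𝒜 ν ℚ.* (s₁ ℚ.+ closed (suc b) (suc e)) ℚ.- ℬ ν ℚ.* (s₀ ℚ.+ closed (suc b) e)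
    ≡⟨ solve 6 (λ a b s₁ s₀ x y → a :* (s₁ :+ x) :- b :* (s₀ :+ y) := (a :* s₁ :- b :* s₀) :+ (a :* x :- b :* y)) ≡.refl
         (𝒜 ν) (ℬ ν) s₁ s₀ (closed (suc b) (suc e)) (closed (suc b) e) ⟩
  (𝒜 ν ℚ.* s₁ ℚ.- ℬ ν ℚ.* s₀) ℚ.+ (𝒜 ν ℚ.* closed (suc b) (suc e) ℚ.- ℬ ν ℚ.* closed (suc b) e)
    ≡⟨ ≡.cong₂ ℚ._+_ (telescope b (suc e) n (≡.sym (ℕₚ.+-suc b e))) (certificate-step b e) ⟩
  certificate b (suc e) ℚ.+ (certificate (suc b) e ℚ.- certificate b (suc e))
    ≡⟨ solve 2 (λ x y → x :+ (y :- x) := y) ≡.refl (certificate b (suc e)) (certificate (suc b) e) ⟩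
  certificate (suc b) e ∎
  where
  open ≡.≡-Reasoning
  open ℚ-Solver
  ν s₀ s₁ : ℚ
  ν  = fromℕ n
  s₁ = Σ< (suc b) (summand (suc n))
  s₀ = Σ< (suc b) (summand n)

-- Beyond the partial sum up to a = n only the summand a = n + 1 of the left-hand
-- side remains, and it cancels the certificate.
sum-recurrence : ∀ n → 𝒜 (fromℕ n) ℚ.* Σ< (2 ℕ.+ n) (summand (suc n)) ≡ ℬ (fromℕ n) ℚ.* Σ< (suc n) (summand n)
sum-recurrence n = LQ.combine₂ (telescope n 0 n (≡.sym (ℕₚ.+-identityʳ n))) (certificate-end n) 1ℚ 1ℚ
  (≡.trans (≡.cong (λ x → 𝒜 ν ℚ.* (s₁ ℚ.+ x) ℚ.- ℬ ν ℚ.* s₀) (≡.cong (closed (suc n)) (ℕₚ.n∸n≡0 n)))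
  (solve 6 (λ a b s₁ s₀ x c → a :* (s₁ :+ x) :- b :* s₀ := :1 :* (a :* s₁ :- b :* s₀ :- c) :+ :1 :* (a :* x :+ c :- :# 0))
    ≡.refl (𝒜 ν) (ℬ ν) s₁ s₀ (closed (suc n) 0) (certificate n 0)))
  where
  open ℚ-Solver
  ν s₀ s₁ : ℚ
  ν  = fromℕ n
  s₁ = Σ< (suc n) (summand (suc n))
  s₀ = Σ< (suc n) (summand n)

private
  linear : ∀ a b n → fromℕ (a ℕ.* n ℕ.+ b) ≡ fromℕ a ℚ.* fromℕ n ℚ.+ fromℕ b
  linear a b n = ≡.trans (fromℕ-+ (a ℕ.* n) b) (≡.cong (ℚ._+ fromℕ b) (fromℕ-* a n))

T-factor-suc : ∀ n → T-factor (suc n) ℚ.* ((fromℕ n ℚ.+ #ℚ 2) ℚ.* (#ℚ 4 ℚ.* fromℕ n ℚ.+ #ℚ 7) ℚ.* (#ℚ 4 ℚ.* fromℕ n ℚ.+ #ℚ 9))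
  ≡ #ℚ 6 ℚ.* (#ℚ 2 ℚ.* fromℕ n ℚ.+ #ℚ 1) ℚ.* (#ℚ 6 ℚ.* fromℕ n ℚ.+ #ℚ 5) ℚ.* (#ℚ 6 ℚ.* fromℕ n ℚ.+ #ℚ 7)
T-factor-suc n = begin
  T-factor (suc n) ℚ.* ((fromℕ n ℚ.+ #ℚ 2) ℚ.* (#ℚ 4 ℚ.* fromℕ n ℚ.+ #ℚ 7) ℚ.* (#ℚ 4 ℚ.* fromℕ n ℚ.+ #ℚ 9))
    ≡⟨ ≡.cong (T-factor (suc n) ℚ.*_) (≡.sym (≡.trans (fromℕ-* ((2 ℕ.+ n) ℕ.* (3 ℕ.+ 4 ℕ.* suc n)) (5 ℕ.+ 4 ℕ.* suc n)) (≡.cong₂ ℚ._*_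
         (≡.trans (fromℕ-* (2 ℕ.+ n) (3 ℕ.+ 4 ℕ.* suc n)) (≡.cong₂ ℚ._*_ (≡.trans (≡.cong fromℕ (ℕₚ.+-comm 2 n)) (fromℕ-+ n 2))
           (≡.trans (≡.cong fromℕ (e₇ n)) (linear 4 7 n))))
         (≡.trans (≡.cong fromℕ (e₉ n)) (linear 4 9 n))))) ⟩
  T-factor (suc n) ℚ.* fromℕ ((2 ℕ.+ n) ℕ.* (3 ℕ.+ 4 ℕ.* suc n) ℕ.* (5 ℕ.+ 4 ℕ.* suc n))
    ≡⟨ fraction-* (6 ℕ.* (2 ℕ.* suc n ∸ 1) ℕ.* (6 ℕ.* suc n ∸ 1) ℕ.* (6 ℕ.* suc n ℕ.+ 1)) ((2 ℕ.+ n) ℕ.* (3 ℕ.+ 4 ℕ.* suc n) ℕ.* (5 ℕ.+ 4 ℕ.* suc n)) ⟩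
  fromℕ (6 ℕ.* (2 ℕ.* suc n ∸ 1) ℕ.* (6 ℕ.* suc n ∸ 1) ℕ.* (6 ℕ.* suc n ℕ.+ 1))
    ≡⟨ fromℕ-*₄ 6 (2 ℕ.* suc n ∸ 1) (6 ℕ.* suc n ∸ 1) (6 ℕ.* suc n ℕ.+ 1) ⟩
  #ℚ 6 ℚ.* fromℕ (2 ℕ.* suc n ∸ 1) ℚ.* fromℕ (6 ℕ.* suc n ∸ 1) ℚ.* fromℕ (6 ℕ.* suc n ℕ.+ 1)
    ≡⟨ ≡.cong₂ ℚ._*_ (≡.cong₂ (λ x y → #ℚ 6 ℚ.* x ℚ.* y) (≡.trans (≡.cong fromℕ (e₁ n)) (linear 2 1 n))
         (≡.trans (≡.cong fromℕ (e₅ n)) (linear 6 5 n))) (≡.trans (≡.cong fromℕ (e₆ n)) (linear 6 7 n)) ⟩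
  #ℚ 6 ℚ.* (#ℚ 2 ℚ.* fromℕ n ℚ.+ #ℚ 1) ℚ.* (#ℚ 6 ℚ.* fromℕ n ℚ.+ #ℚ 5) ℚ.* (#ℚ 6 ℚ.* fromℕ n ℚ.+ #ℚ 7) ∎
  where
  open ≡.≡-Reasoning
  open +-*-Solver using (solve; _:=_; con) renaming (_:+_ to infixl 6 _:+_; _:*_ to infixl 7 _:*_)
  e₇ : ∀ n → 3 ℕ.+ 4 ℕ.* suc n ≡ 4 ℕ.* n ℕ.+ 7
  e₇ = solve 1 (λ n → con 3 :+ con 4 :* (con 1 :+ n) := con 4 :* n :+ con 7) ≡.refl
  e₉ : ∀ n → 5 ℕ.+ 4 ℕ.* suc n ≡ 4 ℕ.* n ℕ.+ 9
  e₉ = solve 1 (λ n → con 5 :+ con 4 :* (con 1 :+ n) := con 4 :* n :+ con 9) ≡.refl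
  e₁ : ∀ n → 2 ℕ.* suc n ∸ 1 ≡ 2 ℕ.* n ℕ.+ 1
  e₁ = solve 1 (λ n → n :+ (con 1 :+ (n :+ con 0)) := con 2 :* n :+ con 1) ≡.refl
  e₅ : ∀ n → 6 ℕ.* suc n ∸ 1 ≡ 6 ℕ.* n ℕ.+ 5
  e₅ = solve 1 (λ n → n :+ con 5 :* (con 1 :+ n) := con 6 :* n :+ con 5) ≡.refl
  e₆ : ∀ n → 6 ℕ.* suc n ℕ.+ 1 ≡ 6 ℕ.* n ℕ.+ 7
  e₆ = solve 1 (λ n → con 6 :* (con 1 :+ n) :+ con 1 := con 6 :* n :+ con 7) ≡.refl

T-recurrence : ∀ n → 𝒜 (fromℕ n) ℚ.* T (suc n) ≡ ℬ (fromℕ n) ℚ.* T n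
T-recurrence n = LQ.regular-cancel {r = fromℕ 5} (≢0-regular (fromℕ-nonZero 5)) (begin
  fromℕ 5 ℚ.* (𝒜 ν ℚ.* (c₁ ℚ.* productℚ {suc n} (λ i → T-factor (suc (toℕ i)))))
    ≡⟨ ≡.cong (λ x → fromℕ 5 ℚ.* (𝒜 ν ℚ.* (c₁ ℚ.* x))) (productℚ-last n (λ i → T-factor (suc i))) ⟩
  fromℕ 5 ℚ.* (𝒜 ν ℚ.* (c₁ ℚ.* (π ℚ.* T-factor (suc n))))
    ≡⟨ solve 8 (λ f x y z w c π τ → f :* (x :* y :* z :* w :* (c :* (π :* τ))) := x :* (c :* f) :* (τ :* (y :* z :* w)) :* π) ≡.refl
         (fromℕ 5) (#ℚ 7 ℚ.* ν ℚ.+ #ℚ 5) (ν ℚ.+ #ℚ 2) (#ℚ 4 ℚ.* ν ℚ.+ #ℚ 7) (#ℚ 4 ℚ.* ν ℚ.+ #ℚ 9) c₁ π (T-factor (suc n)) ⟩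
  (#ℚ 7 ℚ.* ν ℚ.+ #ℚ 5) ℚ.* (c₁ ℚ.* fromℕ 5) ℚ.* (T-factor (suc n) ℚ.* ((ν ℚ.+ #ℚ 2) ℚ.* (#ℚ 4 ℚ.* ν ℚ.+ #ℚ 7) ℚ.* (#ℚ 4 ℚ.* ν ℚ.+ #ℚ 9))) ℚ.* π
    ≡⟨ ≡.cong (ℚ._* π) (≡.cong₂ ℚ._*_ (≡.cong₂ ℚ._*_ (≡.sym (≡.trans (fraction-* (7 ℕ.* n ℕ.+ 5) 5) (linear 7 5 n)))
         (≡.trans (fraction-* (7 ℕ.* suc n ℕ.+ 5) 5) (≡.trans (≡.cong fromℕ (e₁₂ n)) (linear 7 12 n)))) (T-factor-suc n)) ⟩
  (c₀ ℚ.* fromℕ 5) ℚ.* (#ℚ 7 ℚ.* ν ℚ.+ #ℚ 12) ℚ.* γ ℚ.* π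
    ≡⟨ solve 5 (λ c f x p π → c :* f :* x :* p :* π := f :* (x :* p :* (c :* π))) ≡.refl c₀ (fromℕ 5) (#ℚ 7 ℚ.* ν ℚ.+ #ℚ 12) γ π ⟩
  fromℕ 5 ℚ.* (ℬ ν ℚ.* T n) ∎)
  where
  open ≡.≡-Reasoning
  open ℚ-Solver
  ν c₀ c₁ π γ : ℚ
  ν  = fromℕ n
  c₀ = + (7 ℕ.* n ℕ.+ 5) / 5
  c₁ = + (7 ℕ.* suc n ℕ.+ 5) / 5
  π  = productℚ {n} (λ i → T-factor (suc (toℕ i)))
  γ  = #ℚ 6 ℚ.* (#ℚ 2 ℚ.* ν ℚ.+ #ℚ 1) ℚ.* (#ℚ 6 ℚ.* ν ℚ.+ #ℚ 5) ℚ.* (#ℚ 6 ℚ.* ν ℚ.+ #ℚ 7)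
  e₁₂ : ∀ n → 7 ℕ.* suc n ℕ.+ 5 ≡ 7 ℕ.* n ℕ.+ 12
  e₁₂ n = ≡.trans (≡.cong (ℕ._+ 5) (≡.trans (ℕₚ.*-suc 7 n) (ℕₚ.+-comm 7 (7 ℕ.* n)))) (ℕₚ.+-assoc (7 ℕ.* n) 7 5)

𝒜-regular : ∀ n → Regular ℚ-ring (𝒜 (fromℕ n))
𝒜-regular n = LQ.regular-cong {r = fromℕ 𝒩} value (≢0-regular (fromℕ-nonZero 𝒩 {{nonZero}}))
  where
  𝒩 : ℕ
  𝒩 = (7 ℕ.* n ℕ.+ 5) ℕ.* (n ℕ.+ 2) ℕ.* (4 ℕ.* n ℕ.+ 7) ℕ.* (4 ℕ.* n ℕ.+ 9)
  positive : ∀ m c → ℕ.NonZero (m ℕ.+ suc c)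
  positive m c = ≡.subst ℕ.NonZero (≡.sym (ℕₚ.+-suc m c)) _
  nonZero : ℕ.NonZero 𝒩
  nonZero = ℕₚ.m*n≢0 _ _ {{ℕₚ.m*n≢0 _ _ {{ℕₚ.m*n≢0 _ _ {{positive (7 ℕ.* n) 4}} {{positive n 1}}}} {{positive (4 ℕ.* n) 6}}}} {{positive (4 ℕ.* n) 8}}
  value : fromℕ 𝒩 ≡ 𝒜 (fromℕ n)
  value = ≡.trans (fromℕ-*₄ (7 ℕ.* n ℕ.+ 5) (n ℕ.+ 2) (4 ℕ.* n ℕ.+ 7) (4 ℕ.* n ℕ.+ 9))
    (≡.cong₂ ℚ._*_ (≡.cong₂ ℚ._*_ (≡.cong₂ ℚ._*_ (linear 7 5 n) (fromℕ-+ n 2)) (linear 4 7 n)) (linear 4 9 n))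

sum-closed : ∀ n → Σ< (suc n) (summand n) ≡ T n
sum-closed zero    = ≡.refl
sum-closed (suc n) = LQ.regular-cancel {r = 𝒜 (fromℕ n)} (𝒜-regular n) (≡.trans (sum-recurrence n)
  (≡.trans (≡.cong (ℬ (fromℕ n) ℚ.*_) (sum-closed n)) (≡.sym (T-recurrence n))))

walks-sum : ∀ n → sumℚ {suc n} (λ a → fromℕ (k (3 ℕ.* n ∸ toℕ a) (toℕ a) (toℕ a))) ≡ T n
walks-sum n = ≡.trans (sumℚ-Σ< (suc n) (λ a → fromℕ (k (3 ℕ.* n ∸ a) a a)))
  (≡.trans (Σ<-cong (suc n) (λ a a<1+n → term a (ℕₚ.≤-pred a<1+n))) (sum-closed n))
  where
  term : ∀ a → a ℕ.≤ n → fromℕ (k (3 ℕ.* n ∸ a) a a) ≡ summand n a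
  term a a≤n = ≡.trans (≡.cong (λ n → fromℕ (k (3 ℕ.* n ∸ a) a a)) (≡.sym (ℕₚ.m+[n∸m]≡n a≤n))) (walks-closed a (n ∸ a))

-- Algebraicity and the closed formula

open Defs using (fromℕ; k; K; diagonalRatio; sumℚ; productℚ; T; T-factor; Qd; The)
-- Polynomials in u and t.
IsPoly : B.Series → Set
IsPoly = ℚ[[x,t]].IsPolynomial

-- Bounds on the degree of a product.
module Degree {c ℓ : Level} (R : CommutativeRing c ℓ) where
  private
    module R = CommutativeRing R
    module S = SeriesRing R

  *-degree : ∀ m n f g → (∀ k → m ℕ.≤ k → f k R.≈ R.0#) → (∀ k → n ℕ.≤ k → g k R.≈ R.0#) →
             ∀ k → m ℕ.+ n ℕ.≤ k → (f S.* g) k R.≈ R.0#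
  *-degree zero    n f g p q k n≤k = S.zero-at (S.trans (CommutativeRing.*-congʳ S.ring (S.zero-ext (λ k → p k z≤n)))
    (CommutativeRing.zeroˡ S.ring g)) k
  *-degree (suc m) n f g p q (suc k) (s≤s m+n≤k) = R.trans (S.*-suc f g k) (R.trans (R.+-cong
    (R.trans (R.*-congˡ (q (suc k) (ℕₚ.m≤n⇒m≤1+n (ℕₚ.≤-trans (ℕₚ.m≤n+m n m) m+n≤k)))) (R.zeroʳ _))
    (*-degree m n (S.tail f) g (λ k m≤k → p (suc k) (s≤s m≤k)) q k m+n≤k)) (R.+-identityʳ _))

  -- A property inherited by the coefficients of a product from the products of
  -- coefficients.
  *-coefficients : (P : R.Carrier → Set) → (∀ {r s} → r R.≈ s → P r → P s) → (∀ {r s} → P r → P s → P (r R.+ s)) →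
    ∀ f g → (∀ i j → P (f i R.* g j)) → ∀ n → P ((f S.* g) n)
  *-coefficients P resp add f g p zero    = resp (R.sym (S.*-zero f g)) (p 0 0)
  *-coefficients P resp add f g p (suc n) = resp (R.sym (S.*-suc f g n))
    (add (p 0 (suc n)) (*-coefficients P resp add (S.tail f) g (λ i → p (suc i)) n))

polynomial-+ : ∀ {f g} → IsPoly f → IsPoly g → IsPoly (f B.+ g)
polynomial-+ {f} {g} (m , p) (n , q) = m ⊔ n , λ i j large → ≡.trans (B-+ f g i j) (≡.cong₂ ℚ._+_
  (p i j (weaken (ℕₚ.m≤m⊔n m n) large)) (q i j (weaken (ℕₚ.m≤n⊔m m n) large)))
  where
  weaken : ∀ {m n i j} → m ℕ.≤ n → n ℕ.≤ i ⊎ n ℕ.≤ j → m ℕ.≤ i ⊎ m ℕ.≤ j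
  weaken m≤n (inj₁ n≤i) = inj₁ (ℕₚ.≤-trans m≤n n≤i)
  weaken m≤n (inj₂ n≤j) = inj₂ (ℕₚ.≤-trans m≤n n≤j)

polynomial-neg : ∀ {f} → IsPoly f → IsPoly (B.- f)
polynomial-neg {f} (m , p) = m , λ i j large → ≡.trans (A.at (B.-‿at f i) j) (≡.trans (A.-‿at (f i) j)
  (≡.cong ℚ.-_ (p i j large)))

polynomial-* : ∀ {f g} → IsPoly f → IsPoly g → IsPoly (f B.* g)
polynomial-* {f} {g} (m , p) (n , q) = m ℕ.+ n , λ
  { i j (inj₁ large) → A.zero-at (DA.*-degree m n f g
      (λ k m≤k → A.zero-ext λ j → p k j (inj₁ m≤k)) (λ k n≤k → A.zero-ext λ j → q k j (inj₁ n≤k)) i large) j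
  ; i j (inj₂ large) → DA.*-coefficients (λ a → ∀ j → m ℕ.+ n ℕ.≤ j → a j ≡ 0ℚ)
      (λ r≈s z j large → ≡.trans (≡.sym (A.at r≈s j)) (z j large))
      (λ z z′ j large → ≡.trans (A.+-at _ _ j) (≡.cong₂ ℚ._+_ (z j large) (z′ j large)))
      f g (λ a b → DQ.*-degree m n (f a) (g b) (λ k m≤k → p a k (inj₂ m≤k)) (λ k n≤k → q b k (inj₂ n≤k))) i j large }
  where
  module DA = Degree A.ring
  module DQ = Degree ℚ-ring

polynomial-0 : IsPoly B.0#
polynomial-0 = 0 , λ i j _ → B-zero i j

polynomial-1 : IsPoly B.1#
polynomial-1 = 1 , λ
  { zero    zero    (inj₁ ()) ; zero zero (inj₂ ())
  ; zero    (suc j) _ → ≡.refl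
  ; (suc i) j       _ → A-zero j }

polynomial-u : IsPoly u
polynomial-u = 2 , λ
  { zero          j             _ → A-zero j
  ; (suc zero)    zero          (inj₁ (s≤s ())) ; (suc zero) zero (inj₂ ())
  ; (suc zero)    (suc j)       _ → ≡.refl
  ; (suc (suc i)) j             _ → A-zero j }

polynomial-t : IsPoly tB
polynomial-t = 2 , λ
  { zero    zero          _ → ≡.refl
  ; zero    (suc zero)    (inj₁ ()) ; zero (suc zero) (inj₂ (s≤s ()))
  ; zero    (suc (suc j)) _ → ≡.refl
  ; (suc i) j             _ → A-zero j }

polynomial-# : ∀ n → IsPoly (PB.# n)
polynomial-# zero          = polynomial-0
polynomial-# (suc zero)    = polynomial-1
polynomial-# (suc (suc n)) = polynomial-+ (polynomial-# (suc n)) polynomial-1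

polynomial-^ : ∀ {f} → IsPoly f → ∀ n → IsPoly (f PB.^ n)
polynomial-^ p zero    = polynomial-1
polynomial-^ p (suc n) = polynomial-* p (polynomial-^ p n)

module Cubic = PB.Cubic tB u

coefficient-polynomial : ∀ i → IsPoly (Cubic.coefficient i)
coefficient-polynomial = λ
  { zero                                     → b₀ ⊕ b₁ ⊕ b₂ ⊕ b₃
  ; (suc zero)                               → polynomial-neg (τ ⊗ (two ⊗ b₁ ⊕ four ⊗ b₂ ⊕ polynomial-# 6 ⊗ b₃))
  ; (suc (suc zero))                         → polynomial-^ τ 2 ⊗ (b₁ ⊕ polynomial-# 6 ⊗ b₂ ⊕ polynomial-# 15 ⊗ b₃)
  ; (suc (suc (suc zero)))                   → polynomial-neg (polynomial-^ τ 3 ⊗ (four ⊗ b₂ ⊕ polynomial-# 20 ⊗ b₃))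
  ; (suc (suc (suc (suc zero))))             → polynomial-^ τ 4 ⊗ (b₂ ⊕ polynomial-# 15 ⊗ b₃)
  ; (suc (suc (suc (suc (suc zero)))))       → polynomial-neg (polynomial-^ τ 5 ⊗ (polynomial-# 6 ⊗ b₃))
  ; (suc (suc (suc (suc (suc (suc zero)))))) → polynomial-^ τ 6 ⊗ b₃ }
  where
  infixl 7 _⊗_
  infixl 6 _⊕_ _⊖_
  _⊕_ : ∀ {f g} → IsPoly f → IsPoly g → IsPoly (f B.+ g)
  _⊕_ = polynomial-+
  _⊗_ : ∀ {f g} → IsPoly f → IsPoly g → IsPoly (f B.* g)
  _⊗_ = polynomial-*
  _⊖_ : ∀ {f g} → IsPoly f → IsPoly g → IsPoly (f B.- g)
  p ⊖ q = polynomial-+ p (polynomial-neg q)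
  t′ = polynomial-t
  u′ = polynomial-u
  two : IsPoly PB.two
  two = polynomial-1 ⊕ polynomial-1
  four : IsPoly PB.four
  four = two ⊕ two
  τ : IsPoly Cubic.τ
  τ = t′ ⊗ (u′ ⊗ u′)
  H : IsPoly Cubic.H
  H = t′ ⊗ (u′ ⊗ u′ ⊗ u′) ⊕ u′ ⊖ t′
  M₀ : IsPoly Cubic.M₀
  M₀ = H ⊗ H ⊖ polynomial-# 3 ⊗ (t′ ⊗ (u′ ⊗ u′ ⊗ (u′ ⊗ u′)))
  C₁ : IsPoly Cubic.C₁
  C₁ = u′ ⊗ u′ ⊗ (polynomial-# 3 ⊗ (t′ ⊗ H) ⊖ u′ ⊗ u′)
  C₂ : IsPoly Cubic.C₂
  C₂ = u′ ⊗ u′ ⊗ (polynomial-# 9 ⊗ (t′ ⊗ t′ ⊗ (u′ ⊗ u′)) ⊖ H)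
  Disc : IsPoly Cubic.Disc
  Disc = (u′ ⊖ t′) ⊗ (u′ ⊖ t′) ⊖ four ⊗ (t′ ⊗ t′) ⊗ (u′ ⊗ u′ ⊗ u′)
  α : IsPoly Cubic.α
  α = polynomial-# 16 ⊗ (t′ ⊗ t′)
  β′ : IsPoly Cubic.β
  β′ = polynomial-neg (polynomial-# 8 ⊗ (t′ ⊗ C₂))
  γ : IsPoly Cubic.γ
  γ = polynomial-# 12 ⊗ (t′ ⊗ t′ ⊗ (C₁ ⊗ C₂)) ⊖ four ⊗ (t′ ⊗ (C₁ ⊗ C₁)) ⊕ C₂ ⊗ C₂
  δ′ : IsPoly Cubic.δ
  δ′ = four ⊗ (t′ ⊗ t′ ⊗ (C₁ ⊗ C₁ ⊗ C₁)) ⊖ t′ ⊗ (C₁ ⊗ (C₂ ⊗ C₂)) ⊖ t′ ⊗ t′ ⊗ (C₂ ⊗ C₂ ⊗ C₂)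
  b₀ : IsPoly Cubic.b₀
  b₀ = β′ ⊗ (M₀ ⊗ M₀) ⊖ α ⊗ (M₀ ⊗ (M₀ ⊗ M₀)) ⊖ γ ⊗ M₀ ⊕ δ′
  b₁ : IsPoly Cubic.b₁
  b₁ = Disc ⊗ (polynomial-# 3 ⊗ (α ⊗ (M₀ ⊗ M₀)) ⊖ two ⊗ (β′ ⊗ M₀) ⊕ γ)
  b₂ : IsPoly Cubic.b₂
  b₂ = Disc ⊗ Disc ⊗ (β′ ⊖ polynomial-# 3 ⊗ (α ⊗ M₀))
  b₃ : IsPoly Cubic.b₃
  b₃ = α ⊗ (Disc ⊗ (Disc ⊗ Disc))

t-regularB : Regular B.ring tB
t-regularB = B.regular _ A.X-regular

constant-regular : ∀ {q} → q ≢ 0ℚ → Regular B.ring (B.constant (A.constant q))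
constant-regular q≢0 = B.regular _ (A.regular _ (≢0-regular q≢0))

-- The leading coefficient of the sextic is a power of t u² times 16 t² Disc³, and the
-- coefficient of u⁰ in Disc is t².
leading-regular : Regular B.ring (Cubic.coefficient (suc (suc (suc (suc (suc (suc zero)))))))
leading-regular = LB.regular-* τ⁶ (LB.regular-* (LB.regular-* sixteen (LB.regular-* t-regularB t-regularB))
  (LB.regular-* Disc-regular (LB.regular-* Disc-regular Disc-regular)))
  where
  τ-regular : Regular B.ring Cubic.τ
  τ-regular = LB.regular-* t-regularB (LB.regular-* B.X-regular B.X-regular)
  τ⁶ : Regular B.ring (Cubic.τ PB.^ 6)
  τ⁶ = LB.regular-* τ-regular (LB.regular-* τ-regular (LB.regular-* τ-regular (LB.regular-* τ-regular
    (LB.regular-* τ-regular (LB.regular-* τ-regular (regular-1 B.ring))))))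
  sixteen : Regular B.ring (PB.# 16)
  sixteen = LB.regular-cong (B.trans (B.constant-cong (QA.natural {0} (ℚ-Solver.con (+ 16)) [])) (AB.natural {0} (SA.con (+ 16)) []))
    (constant-regular (fromℕ-nonZero 16))
    where module QA = Naturality ℚ-ring A.ring A.constant-isRingHomomorphism
  Disc-regular : Regular B.ring Cubic.Disc
  Disc-regular = LB.regular-cong (B.sym (solve 2 (λ t u → let :4 = (:1 :+ :1) :+ (:1 :+ :1) in
      (u :- t) :* (u :- t) :- :4 :* (t :* t) :* (u :* u :* u)
      := t :* t :+ u :* (u :- t :- t :- :4 :* (t :* t) :* (u :* u))) B.refl tB u))
    (B.regular _ (LA.regular-cong (A.sym (A.trans (B.+-at _ _ 0) (A.trans (RA.+-cong (B.*-zero tB tB) (B.X*-zero _))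
      (RA.+-identityʳ _)))) (LA.regular-* A.X-regular A.X-regular)))
    where open SB

leading-nonZero : ¬ (Cubic.coefficient (suc (suc (suc (suc (suc (suc zero)))))) B.≈ B.0#)
leading-nonZero p = ℚₚ.1≢0 (A.at (B.at (leading-regular B.1# (B.trans (RB.*-congʳ p) (RB.zeroˡ B.1#))) 0) 0)

-- The sextic equation of the diagonal series.
algebraic-equation : PB.sum {7} (λ i → Cubic.coefficient i B.* D PB.^ toℕ i) B.≈ B.0#
algebraic-equation = B.trans (Cubic.sextic D) (Cubic.cubic VB _ VB-eq (Cubic.reduce VB D VB-eq D-quadratic))

-- The series U = t (2 + U³).
U : A.Series
U = V A.+ V

module U-fixpoint = A.Fixpoint A.0# (λ f → PA.two A.+ f PA.^ 3)
  (A.+-nonExpansive (A.const-nonExpansive PA.two) (A.*-nonExpansive A.id-nonExpansive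
    (A.*-nonExpansive A.id-nonExpansive (A.*-nonExpansive A.id-nonExpansive (A.const-nonExpansive A.1#)))))

U-eq : U A.≈ tA A.* (PA.two A.+ U PA.^ 3)
U-eq = LA.combine₁ V-eq PA.two (solve 2 (λ t V → let :2 = :1 :+ :1 ; :4 = :2 :+ :2 in
  V :+ V :- t :* (:2 :+ (V :+ V) :* ((V :+ V) :* ((V :+ V) :* :1))) := :2 :* (V :- t :* (:1 :+ :4 :* (V :* V :* V)))) A.refl tA V)
  where open SA

U-unique : ∀ {f} → f A.≈ tA A.* (PA.two A.+ f PA.^ 3) → U A.≈ f
U-unique f-eq = U-fixpoint.unique (A.trans U-eq (A.sym (RA.+-identityˡ _))) (A.trans f-eq (A.sym (RA.+-identityˡ _)))

UB : B.Series
UB = B.constant U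

UB-V : UB B.≈ VB B.+ VB
UB-V = IsRingHomomorphism.+-homo B.constant-isRingHomomorphism V V

y-U : y B.≈ u B.* UB PB.^ 2
y-U = B.sym (B.trans (RB.*-congˡ (RB.*-cong UB-V (RB.*-congʳ UB-V)))
  (solve 2 (λ u V → let :2 = :1 :+ :1 ; :4 = :2 :+ :2 in u :* ((V :+ V) :* ((V :+ V) :* :1)) := :4 :* (V :* V) :* u) B.refl u VB))
  where open SB

-- The square root of 1 - u U².
s : B.Series
s = (B.1# B.- y) B.* p

s*p : s B.* p B.≈ B.1#
s*p = B.trans (solve 2 (λ y p → (:1 :- y) :* p :* p := p :* p :* (:1 :- y)) B.refl y p) p-square
  where open SB

s-square : s PB.^ 2 B.≈ B.1# B.- u B.* UB PB.^ 2
s-square = B.trans (LB.combine₁ p-square (B.1# B.- y) (solve 2 (λ y p →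
    ((:1 :- y) :* p) :* (((:1 :- y) :* p) :* :1) :- (:1 :- y) := (:1 :- y) :* (p :* p :* (:1 :- y) :- :1)) B.refl y p))
  (RB.+-congˡ (B.-‿cong y-U))
  where open SB

s₀ : s 0 0 ≡ 1ℚ
s₀ = ≡.trans (A.at (A.trans (B.*-zero (B.1# B.- y) p) (A.trans (RA.*-cong 1-y (p₀)) (RA.*-identityˡ _))) 0) ≡.refl
  where
  open RingProperties RA.ring using (-0#≈0#)
  1-y : (B.1# B.- y) 0 A.≈ A.1#
  1-y = A.trans (B.+-at _ _ 0) (A.trans (RA.+-congˡ (A.trans (B.-‿at y 0) (A.trans (A.-‿cong Y.y-0) -0#≈0#))) (RA.+-identityʳ _))

-- For two square roots with constant term 1, the sum has constant term 2 and hence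
-- is not a zero divisor.
s-unique : ∀ {f} → f PB.^ 2 B.≈ B.1# B.- u B.* UB PB.^ 2 → f 0 0 ≡ 1ℚ → s B.≈ f
s-unique {f} f² f₀ = LB.combine₁ (sum-regular (s B.- f) (B.trans
    (solve 2 (λ s f → (s :+ f) :* (s :- f) := s :* (s :* :1) :- f :* (f :* :1)) B.refl s f)
    (LB.≈⇒-≈0 (B.trans s-square (B.sym f²))))) B.1#
  (solve 2 (λ s f → s :- f := :1 :* (s :- f :- :# 0)) B.refl s f)
  where
  open SB
  sum-regular : Regular B.ring (s B.+ f)
  sum-regular = B.regular _ (A.regular _ (LQ.regular-cong (≡.sym (≡.trans (B-+ s f 0 0) (≡.cong₂ ℚ._+_ s₀ f₀)))
    (≢0-regular {2ℚ} λ ())))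

s-regular : Regular B.ring s
s-regular f sf≈0 = B.trans (solve 3 (λ s p f → f := p :* (s :* f) :+ (:1 :- s :* p) :* f) B.refl s p f)
  (B.trans (B.+-cong (B.trans (RB.*-congˡ sf≈0) (RB.zeroʳ p)) (B.trans (RB.*-congʳ (LB.≈⇒-≈0 (B.sym s*p))) (RB.zeroˡ f)))
    (RB.+-identityʳ _))
  where open SB

-- U / (2 t) = W.
W-quotient : PB.two B.* tB B.* PB.W VB B.≈ UB
W-quotient = B.trans (LB.combine₁ VB-eq (B.- PB.two) (solve 3 (λ t V w →
    (:1 :+ :1) :* t :* w :- (V :+ V) := (:- (:1 :+ :1)) :* (V :- t :* w)) B.refl tB VB (PB.W VB))) (B.sym UB-V)
  where open SB

two-t-regular : Regular B.ring (PB.two B.* tB)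
two-t-regular = LB.regular-* (LB.regular-cong
  (B.trans (B.constant-cong (QA.natural {0} (ℚ-Solver.:1 ℚ-Solver.:+ ℚ-Solver.:1) [])) (AB.natural {0} (SA.:1 SA.:+ SA.:1) []))
  (constant-regular {2ℚ} λ ())) t-regularB
  where module QA = Naturality ℚ-ring A.ring A.constant-isRingHomomorphism

-- The constant 1/2.
halfB : B.Series
halfB = B.constant (A.constant ℚ.½)

half-double : halfB B.+ halfB B.≈ B.1#
half-double = B.trans (B.sym (HB.+-homo _ _)) (B.constant-cong (A.trans (A.sym (HA.+-homo ℚ.½ ℚ.½)) (A.constant-cong ≡.refl)))
  where
  module HA = IsRingHomomorphism A.constant-isRingHomomorphism
  module HB = IsRingHomomorphism B.constant-isRingHomomorphism

-- The quotient (√(1 - u U²) - 1 + u U² / 2) / (t u²), obtained by solving the formula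
-- for the diagonal series for it.
v : B.Series
v = s B.* D B.- PB.W VB

half-y : halfB B.* u B.* UB PB.^ 2 B.≈ PB.two B.* (VB B.* VB) B.* u
half-y = B.trans (B.trans (RB.*-assoc halfB u _) (RB.*-congˡ (B.sym y-U))) (LB.combine₁ half-double (PB.two B.* (VB B.* VB) B.* u)
  (solve 3 (λ h V u → let :2 = :1 :+ :1 ; :4 = :2 :+ :2 in
    h :* (:4 :* (V :* V) :* u) :- :2 :* (V :* V) :* u := :2 :* (V :* V) :* u :* (h :+ h :- :1)) B.refl halfB VB u))
  where open SB

v-quotient : tB B.* u PB.^ 2 B.* v B.≈ s B.- B.1# B.+ halfB B.* u B.* UB PB.^ 2
v-quotient = B.trans (LB.-≈0⇒≈ (B.trans
    (solve 7 (λ t u s D w V p → let :2 = :1 :+ :1 ; h = :1 :- :2 :* (V :* V) :* u :- V :* (u :* u) in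
      t :* (u :* (u :* :1)) :* (s :* D :- w) :- (s :- :1 :+ :2 :* (V :* V) :* u)
      := s :* (t :* (u :* u) :* D :- (:1 :- p :* h)) :+ ((:- h) :* (s :* p :- :1) :+ (u :* u) :* (V :- t :* w)))
      B.refl tB u s D (PB.W VB) VB p)
    (B.trans (B.+-cong (LB.multiple≈0 diagonal s) (B.trans (B.+-cong (LB.multiple≈0 s*p (B.- h)) (LB.multiple≈0 VB-eq (u B.* u)))
      (RB.+-identityʳ _))) (RB.+-identityʳ _))))
  (RB.+-congˡ (B.sym half-y))
  where open SB

tu²-regular : Regular B.ring (tB B.* u PB.^ 2)
tu²-regular = LB.regular-* t-regularB (LB.regular-* B.X-regular (LB.regular-* B.X-regular (regular-1 B.ring)))

D-formula : D B.≈ p B.* (PB.W VB B.+ v)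
D-formula = LB.combine₁ s*p (B.- D) (solve 4 (λ s p D w → D :- p :* (w :+ (s :* D :- w)) := (:- D) :* (s :* p :- :1)) B.refl s p D (PB.W VB))
  where open SB

p-unique : ∀ f → s B.* f B.≈ B.1# → p B.≈ f
p-unique f q = LB.regular-cancel s-regular (B.trans s*p (B.sym q))

W-unique : ∀ f → PB.two B.* tB B.* f B.≈ UB → PB.W VB B.≈ f
W-unique f q = LB.regular-cancel two-t-regular (B.trans W-quotient (B.sym q))

v-unique : ∀ f → tB B.* u PB.^ 2 B.* f B.≈ s B.- B.1# B.+ halfB B.* u B.* UB PB.^ 2 → v B.≈ f
v-unique f q = LB.regular-cancel tu²-regular (B.trans v-quotient (B.sym q))

opaque
  unfolding SeriesRing._≈_

  -- The ring operations unfold to those of the coefficient sequences in which the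
  -- notion of algebraicity is expressed.
  algebraic : ∀ {n} (c : Fin n → B.Series) f → (∀ i → IsPoly (c i)) → ∀ i → ¬ (c i B.≈ B.0#) →
    PB.sum (λ i → c i B.* f PB.^ toℕ i) B.≈ B.0# → ℚ[[x,t]].Algebraic f
  algebraic {n} c f polynomial i nonZero equation = n , c , polynomial , (i , nonZero) , equation

Qd-algebraic : ℚ[[x,t]].Algebraic Qd
Qd-algebraic = algebraic Cubic.coefficient D coefficient-polynomial
  (suc (suc (suc (suc (suc (suc zero)))))) leading-nonZero algebraic-equation

-- Here the operations on series unfold to those of coefficient sequences, so that
-- the witnesses and equations found above are the required ones.
opaque
  unfolding SeriesRing._≈_

  theorem7p2 :
    (∀ n → sumℚ {suc n} (λ a → fromℕ (k (3 ℕ.* n ∸ toℕ a) (toℕ a) (toℕ a))) ≡ T n)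
    × (∀ n a → a ℕ.≤ n → fromℕ (k (3 ℕ.* n ∸ a) a a) ≡ K n ℚ.* diagonalRatio n a)
    × ℚ[[x,t]].Algebraic Qd
    × The ℚ[[t]]._≈_ (λ U → let open ℚ[[t]] in U ≈ t * (two + U ^ 3)) (λ U₀ →
        let open ℚ[[x,t]]
            U = embed U₀
        in
        The _≈_ (IsSqrt (1# - x * U ^ 2)) (λ √1-xU² →
        The _≈_ (IsQuotient 1# √1-xU²) (λ 1/√1-xU² →
        The _≈_ (IsQuotient U (two * t)) (λ U/2t →
        The _≈_ (IsQuotient (√1-xU² - 1# + half * x * U ^ 2) (t * x ^ 2)) (λ V →
          Qd ≈ 1/√1-xU² * (U/2t + V))))))
  theorem7p2 = walks-sum , walks-ratio
    , Qd-algebraic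
    , (U , U-eq , U-unique)
    , (s , (s-square , s₀) , λ q → s-unique (proj₁ q) (proj₂ q))
    , (p , s*p , λ {f} → p-unique f)
    , (PB.W VB , W-quotient , λ {f} → W-unique f)
    , (v , v-quotient , λ {f} → v-unique f)
    , D-formula
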